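{- In $\mathbb Z[\Gamma^2]$ one has $I_H\cap I_V\cap I_D=\mathcal I_2$, i.e. the left ideal $I_H\cap I_V\cap I_D$ is generated by the four elements $(1+S,1+S)$, $(S,S)+(S,US)+(US,US)+(1,U)-(U^2,U^2)$, $(1+U+U^2,1)[(1,1)+(S,S)]$ and $(1,1+U+U^2)[(1,1)+(S,S)]$.
   Context: $\Gamma=PSL_2(\mathbb Z)$ acting on $\mathbb P^1(\mathbb Q)$ by Möbius transformations; $S=\pm\begin{pmatrix}0&-1\\1&0\end{pmatrix}$, $U=\pm\begin{pmatrix}0&1\\-1&1\end{pmatrix}$, $T=\pm\begin{pmatrix}1&1\\0&1\end{pmatrix}$. Identify $\mathbb Z[\Gamma^2]=\mathbb Z[\Gamma]\otimes\mathbb Z[\Gamma]$, writing $(a,b)=a\otimes b$ for $a,b\in\mathbb Z[\Gamma]$ (products componentwise). $\mathcal I_2$ denotes the left ideal generated by the four listed elements. Let $\Gamma_\infty=\{T^n\}$ and $\Gamma_0=\{(US)^n\}$ be the stabilizers of $\infty$ and $0$. For $\gamma\in\Gamma$ put $\partial\gamma=[\gamma\infty]-[\gamma0]\in\mathbb Z[\mathbb P^1(\mathbb Q)]$. Write an element of $\mathbb Z[\Gamma^2]$ as $\sum_i\lambda_i(\alpha_i,\beta_i)$ with distinct pairs $(\alpha_i,\beta_i)\in\Gamma^2$. Define $I_H$ as the set of such elements with $\sum_{i:\beta_i\in C}\lambda_i\,\partial\alpha_i=0$ for every coset $C\in\Gamma/\Gamma_\infty$; $I_V$ as those with $\sum_{i:\alpha_i\in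 C}\lambda_i\,\partial\beta_i=0$ for every coset $C\in\Gamma/\Gamma_0$; and $I_D$ as those with $\sum_{i:\beta_i\alpha_i^{ -1}=g}\lambda_i\,\partial\alpha_i=0$ for every $g\in\Gamma$. (These encode that $g$ maps the horizontal path from $(\infty,\infty)$ to $(0,\infty)$, the vertical path from $(0,\infty)$ to $(0,0)$, resp. the diagonal path from $(\infty,\infty)$ to $(0,0)$ in $(\mathbb H\cup\mathbb P^1(\mathbb Q))^2$, to closed chains of the same type.) -}

module Defs where

open import Algebra.Bundles using (Group; RawRing)
import Algebra.Construct.DirectProduct as DirectProduct
import Algebra.Definitions.RawMonoid as RawMonoidDefinitions
import Algebra.Properties.Group as GroupProperties
open import Data.Integer.Base as ℤ using (ℤ; +_; -[1+_]; 0ℤ; 1ℤ; -1ℤ)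
import Data.Integer.Properties as ℤ
open import Data.Integer.Tactic.RingSolver using (solve-∀)
open import Data.List.Base
  using (List; []; _∷_; _++_; map; foldr; filter; concatMap; cartesianProductWith)
open import Data.List.Membership.Propositional using (_∈_)
import Data.Nat.Base as ℕ
import Data.Nat.Properties as ℕ
open import Data.Product.Base using (_×_; _,_; proj₁; proj₂; ∃-syntax; map₁)
open import Data.Product.Relation.Binary.Pointwise.NonDependent using (×-decidable)
open import Data.Sum.Base using (_⊎_; inj₁; inj₂)
open import Function.Base using (_∘_)
open import Function.Bundles using (_⇔_; mk⇔)
open import Function.Construct.Symmetry using (⇔-sym)
open import Level using (0ℓ; _⊔_)
open import Relation.Binary.Bundles using (DecSetoid)
open import Relation.Binary.Definitions using (_Respects_) renaming (Decidable to Decidable₂)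
open import Relation.Binary.PropositionalEquality
  using (_≡_; refl; sym; trans; cong; cong₂; module ≡-Reasoning)
import Relation.Nullary.Decidable as Dec
open import Relation.Nullary using (¬_; Dec; yes; no; contradiction; _×-dec_)
open import Relation.Unary using (Pred; Decidable)

-- Finite formal sums Σ λᵢ xᵢ, compared by their coefficients.  The xᵢ need
-- not be distinct: repeated terms are added up by `coefficient`.
module FreeAbelian {a ℓ} (X : DecSetoid a ℓ) where
  open DecSetoid X using (_≟_) renaming (Carrier to A)

  FormalSum : Set a
  FormalSum = List (ℤ × A)

  coefficient : FormalSum → A → ℤ
  coefficient s x = foldr ℤ._+_ 0ℤ (map proj₁ (filter (λ t → proj₂ t ≟ x) s))

  infix 4 _≋_
  _≋_ : FormalSum → FormalSum → Set a
  s ≋ t = ∀ x → coefficient s x ≡ coefficient t x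

  scale : ℤ → FormalSum → FormalSum
  scale n = map (map₁ (n ℤ.*_))

  -- sumOver P? f (Σ λᵢ bᵢ) is Σ λᵢ f(bᵢ), over those i for which P bᵢ holds.
  sumOver : ∀ {b p} {B : Set b} {P : Pred B p} →
            Decidable P → (B → FormalSum) → List (ℤ × B) → FormalSum
  sumOver P? f s =
    concatMap (λ (n , b) → scale n (f b)) (filter (P? ∘ proj₂) s)

module GroupRing {c ℓ} (G : Group c ℓ) (_≟_ : Decidable₂ (Group._≈_ G)) where
  open Group G using (_∙_; ε; isEquivalence)

  decSetoid : DecSetoid c ℓ
  decSetoid = record
    { isDecEquivalence = record { isEquivalence = isEquivalence ; _≟_ = _≟_ } }

  open FreeAbelian decSetoid public

  groupRing : RawRing c c
  groupRing = record
    { Carrier = FormalSum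
    ; _≈_     = _≋_
    ; _+_     = _++_
    ; _*_     = cartesianProductWith λ (m , g) (n , h) → m ℤ.* n , g ∙ h
    ; -_      = scale -1ℤ
    ; 0#      = []
    ; 1#      = (1ℤ , ε) ∷ []
    }

module LeftIdeals {c ℓ} (R : RawRing c ℓ) where
  open RawRing R

  -- The least subset that contains gs, is closed under sums and under
  -- multiplication from the left, and is compatible with ≈.
  data LeftIdeal⟨_⟩ (gs : List Carrier) : Pred Carrier (c ⊔ ℓ) where
    generator : ∀ {x} → x ∈ gs → LeftIdeal⟨ gs ⟩ x
    zero      : LeftIdeal⟨ gs ⟩ 0#
    add       : ∀ {x y} → LeftIdeal⟨ gs ⟩ x → LeftIdeal⟨ gs ⟩ y → LeftIdeal⟨ gs ⟩ (x + y)
    mul       : ∀ r {x} → LeftIdeal⟨ gs ⟩ x → LeftIdeal⟨ gs ⟩ (r * x)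
    resp      : ∀ {x y} → x ≈ y → LeftIdeal⟨ gs ⟩ x → LeftIdeal⟨ gs ⟩ y

module Subgroups {c ℓ} (G : Group c ℓ) where
  open Group G
  open RawMonoidDefinitions rawMonoid using () renaming (_×_ to _times_)
  open GroupProperties G using (\\-leftDividesˡ; \\-leftDividesʳ)

  infixr 8 _^_
  _^_ : Carrier → ℤ → Carrier
  g ^ (+ n)    = n times g
  g ^ -[1+ n ] = (ℕ.suc n times g) ⁻¹

  ⟪_⟫ : Carrier → Pred Carrier ℓ
  ⟪ g ⟫ h = ∃[ n ] h ≈ g ^ n

  ⟪⟫-resp : ∀ g → ⟪ g ⟫ Respects _≈_
  ⟪⟫-resp g x≈y (n , x≈gⁿ) = n , trans′ (sym′ x≈y) x≈gⁿ
    where open Group G using () renaming (trans to trans′; sym to sym′)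

  LeftCoset : ∀ {p} → Carrier → Pred Carrier p → Pred Carrier (c ⊔ ℓ ⊔ p)
  LeftCoset g H x = ∃[ h ] H h × x ≈ g ∙ h

  leftCoset? : ∀ {p} {H : Pred Carrier p} → H Respects _≈_ → Decidable H →
               ∀ g → Decidable (LeftCoset g H)
  leftCoset? {H = H} resp H? g x = Dec.map′ to from (H? (g \\ x))
    where
    open Group G using () renaming (trans to trans′; sym to sym′)
    to : H (g \\ x) → LeftCoset g H x
    to Hh = g \\ x , Hh , sym′ (\\-leftDividesˡ g x)
    from : LeftCoset g H x → H (g \\ x)
    from (h , Hh , x≈gh) =
      resp (sym′ (trans′ (∙-congˡ x≈gh) (\\-leftDividesʳ g h))) Hh

open import Data.Integer.Base using (_+_; _*_; -_; _-_)

record Matrix : Set where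
  constructor mat
  field a b c d : ℤ

det : Matrix → ℤ
det (mat a b c d) = a * d - b * c

infixl 7 _·_
_·_ : Matrix → Matrix → Matrix
mat a b c d · mat a′ b′ c′ d′ =
  mat (a * a′ + b * c′) (a * b′ + b * d′) (c * a′ + d * c′) (c * b′ + d * d′)

I : Matrix
I = mat 1ℤ 0ℤ 0ℤ 1ℤ

neg adj : Matrix → Matrix
neg (mat a b c d) = mat (- a) (- b) (- c) (- d)
adj (mat a b c d) = mat d (- b) (- c) a

mat-cong : ∀ {a b c d a′ b′ c′ d′} → a ≡ a′ → b ≡ b′ → c ≡ c′ → d ≡ d′ →
           mat a b c d ≡ mat a′ b′ c′ d′
mat-cong refl refl refl refl = refl

infix 4 _≟ᴹ_
_≟ᴹ_ : (M N : Matrix) → Dec (M ≡ N)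
mat a b c d ≟ᴹ mat a′ b′ c′ d′ =
  Dec.map′ (λ { (p , q , r , s) → mat-cong p q r s })
           (λ { refl → refl , refl , refl , refl })
           ((a ℤ.≟ a′) ×-dec (b ℤ.≟ b′) ×-dec (c ℤ.≟ c′) ×-dec (d ℤ.≟ d′))

neg-involutive : ∀ M → neg (neg M) ≡ M
neg-involutive (mat a b c d) =
  mat-cong (ℤ.neg-involutive a) (ℤ.neg-involutive b)
           (ℤ.neg-involutive c) (ℤ.neg-involutive d)

·-assoc : ∀ L M N → (L · M) · N ≡ L · (M · N)
·-assoc (mat a b c d) (mat e f g h) (mat k l m n) =
  mat-cong (lemma a b e f g h k m) (lemma a b e f g h l n)
           (lemma c d e f g h k m) (lemma c d e f g h l n)
  where
  lemma : ∀ a b e f g h k m →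
          (a * e + b * g) * k + (a * f + b * h) * m ≡
          a * (e * k + f * m) + b * (g * k + h * m)
  lemma = solve-∀

·-identityˡ : ∀ M → I · M ≡ M
·-identityˡ (mat a b c d) =
  mat-cong (first a c) (first b d) (second a c) (second b d)
  where
  first : ∀ x y → 1ℤ * x + 0ℤ * y ≡ x
  first = solve-∀
  second : ∀ x y → 0ℤ * x + 1ℤ * y ≡ y
  second = solve-∀

·-identityʳ : ∀ M → M · I ≡ M
·-identityʳ (mat a b c d) =
  mat-cong (first a b) (second a b) (first c d) (second c d)
  where
  first : ∀ x y → x * 1ℤ + y * 0ℤ ≡ x
  first = solve-∀
  second : ∀ x y → x * 0ℤ + y * 1ℤ ≡ y
  second = solve-∀

·-inverseˡ : ∀ M → det M ≡ 1ℤ → adj M · M ≡ I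
·-inverseˡ (mat a b c d) p =
  mat-cong (trans (e₁ a b c d) p) (e₂ b d) (e₃ a c) (trans (e₄ a b c d) p)
  where
  e₁ : ∀ a b c d → d * a + (- b) * c ≡ a * d - b * c
  e₁ = solve-∀
  e₂ : ∀ b d → d * b + (- b) * d ≡ 0ℤ
  e₂ = solve-∀
  e₃ : ∀ a c → (- c) * a + a * c ≡ 0ℤ
  e₃ = solve-∀
  e₄ : ∀ a b c d → (- c) * b + a * d ≡ a * d - b * c
  e₄ = solve-∀

·-inverseʳ : ∀ M → det M ≡ 1ℤ → M · adj M ≡ I
·-inverseʳ (mat a b c d) p =
  mat-cong (trans (e₁ a b c d) p) (e₂ a b) (e₃ c d) (trans (e₄ a b c d) p)
  where
  e₁ : ∀ a b c d → a * d + b * (- c) ≡ a * d - b * c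
  e₁ = solve-∀
  e₂ : ∀ a b → a * (- b) + b * a ≡ 0ℤ
  e₂ = solve-∀
  e₃ : ∀ c d → c * d + d * (- c) ≡ 0ℤ
  e₃ = solve-∀
  e₄ : ∀ a b c d → c * (- b) + d * a ≡ a * d - b * c
  e₄ = solve-∀

neg-·ˡ : ∀ M N → neg M · N ≡ neg (M · N)
neg-·ˡ (mat a b c d) (mat e f g h) =
  mat-cong (lemma a b e g) (lemma a b f h) (lemma c d e g) (lemma c d f h)
  where
  lemma : ∀ a b e g → (- a) * e + (- b) * g ≡ - (a * e + b * g)
  lemma = solve-∀

neg-·ʳ : ∀ M N → M · neg N ≡ neg (M · N)
neg-·ʳ (mat a b c d) (mat e f g h) =
  mat-cong (lemma a b e g) (lemma a b f h) (lemma c d e g) (lemma c d f h)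
  where
  lemma : ∀ a b e g → a * (- e) + b * (- g) ≡ - (a * e + b * g)
  lemma = solve-∀

det-· : ∀ M N → det (M · N) ≡ det M * det N
det-· (mat a b c d) (mat e f g h) = lemma a b c d e f g h
  where
  lemma : ∀ a b c d e f g h →
          (a * e + b * g) * (c * f + d * h) - (a * f + b * h) * (c * e + d * g) ≡
          (a * d - b * c) * (e * h - f * g)
  lemma = solve-∀

det-adj : ∀ M → det (adj M) ≡ det M
det-adj (mat a b c d) = lemma a b c d
  where
  lemma : ∀ a b c d → d * a - (- b) * (- c) ≡ a * d - b * c
  lemma = solve-∀

record SL₂ℤ : Set where
  constructor sl₂
  field
    matrix : Matrix
    det≡1  : det matrix ≡ 1ℤ

open SL₂ℤ public

-- PSL₂(ℤ) is SL₂(ℤ) with the equality that identifies g and -g.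
infix 4 _≈±_
data _≈±_ (g h : SL₂ℤ) : Set where
  plus  : matrix g ≡ matrix h       → g ≈± h
  minus : matrix g ≡ neg (matrix h) → g ≈± h

infix 4 _≟±_
_≟±_ : Decidable₂ _≈±_
g ≟± h with matrix g ≟ᴹ matrix h | matrix g ≟ᴹ neg (matrix h)
... | yes p | _     = yes (plus p)
... | no  _ | yes q = yes (minus q)
... | no ¬p | no ¬q = no λ { (plus p) → ¬p p ; (minus q) → ¬q q }

Γ : Group 0ℓ 0ℓ
Γ = record
  { Carrier = SL₂ℤ
  ; _≈_     = _≈±_
  ; _∙_     = mul
  ; ε       = sl₂ I refl
  ; _⁻¹     = inv
  ; isGroup = record
    { isMonoid = record
      { isSemigroup = record
        { isMagma = record
          { isEquivalence = record
            { refl  = plus refl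
            ; sym   = sym±
            ; trans = trans±
            }
          ; ∙-cong = mul-cong
          }
        ; assoc = λ g h k → plus (·-assoc (matrix g) (matrix h) (matrix k))
        }
      ; identity = (λ g → plus (·-identityˡ (matrix g)))
                 , (λ g → plus (·-identityʳ (matrix g)))
      }
    ; inverse = (λ g → plus (·-inverseˡ (matrix g) (det≡1 g)))
              , (λ g → plus (·-inverseʳ (matrix g) (det≡1 g)))
    ; ⁻¹-cong = inv-cong
    }
  }
  where
  mul : SL₂ℤ → SL₂ℤ → SL₂ℤ
  mul (sl₂ M p) (sl₂ N q) = sl₂ (M · N) (trans (det-· M N) (cong₂ _*_ p q))

  inv : SL₂ℤ → SL₂ℤ
  inv (sl₂ M p) = sl₂ (adj M) (trans (det-adj M) p)

  flip-neg : ∀ {M N} → M ≡ neg N → N ≡ neg M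
  flip-neg refl = sym (neg-involutive _)

  sym± : ∀ {g h} → g ≈± h → h ≈± g
  sym± (plus p)  = plus (sym p)
  sym± (minus p) = minus (flip-neg p)

  trans± : ∀ {g h k} → g ≈± h → h ≈± k → g ≈± k
  trans± (plus p)  (plus q)  = plus (trans p q)
  trans± (plus p)  (minus q) = minus (trans p q)
  trans± (minus p) (plus q)  = minus (trans p (cong neg q))
  trans± (minus p) (minus q) = plus (trans p (sym (flip-neg q)))

  mul-cong : ∀ {g g′ h h′} → g ≈± g′ → h ≈± h′ → mul g h ≈± mul g′ h′
  mul-cong (plus p) (plus q) = plus (cong₂ _·_ p q)
  mul-cong {g′ = g} {h′ = h} (plus p) (minus q) =
    minus (trans (cong₂ _·_ p q) (neg-·ʳ (matrix g) (matrix h)))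
  mul-cong {g′ = g} {h′ = h} (minus p) (plus q) =
    minus (trans (cong₂ _·_ p q) (neg-·ˡ (matrix g) (matrix h)))
  mul-cong {g′ = g} {h′ = h} (minus p) (minus q) = plus (begin
    _                    ≡⟨ cong₂ _·_ p q ⟩
    neg M · neg N        ≡⟨ neg-·ˡ M (neg N) ⟩
    neg (M · neg N)      ≡⟨ cong neg (neg-·ʳ M N) ⟩
    neg (neg (M · N))    ≡⟨ neg-involutive (M · N) ⟩
    M · N                ∎)
    where
    open ≡-Reasoning
    M = matrix g
    N = matrix h

  inv-cong : ∀ {g h} → g ≈± h → inv g ≈± inv h
  inv-cong (plus p)  = plus (cong adj p)
  inv-cong (minus p) = minus (cong adj p)

S U T : SL₂ℤ
S = sl₂ (mat 0ℤ -1ℤ 1ℤ 0ℤ) refl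
U = sl₂ (mat 0ℤ 1ℤ -1ℤ 1ℤ) refl
T = sl₂ (mat 1ℤ 1ℤ 0ℤ 1ℤ) refl

-- A point (x : y) of ℙ¹(ℚ) in integral, not necessarily coprime, coordinates.
record ℙ¹ℚ : Set where
  constructor point
  field
    x y     : ℤ
    nonzero : ¬ (x ≡ 0ℤ × y ≡ 0ℤ)

infix 4 _≈ᴾ_
record _≈ᴾ_ (p q : ℙ¹ℚ) : Set where
  constructor proportional
  open ℙ¹ℚ
  field cross : x p * y q ≡ x q * y p

ℙ¹ : DecSetoid 0ℓ 0ℓ
ℙ¹ = record
  { Carrier = ℙ¹ℚ
  ; _≈_ = _≈ᴾ_
  ; isDecEquivalence = record
    { isEquivalence = record
      { refl  = proportional refl
      ; sym   = λ { (proportional e) → proportional (sym e) }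
      ; trans = λ {p} {q} {r} → transᴾ p q r
      }
    ; _≟_ = λ p q → Dec.map′ proportional _≈ᴾ_.cross (_ ℤ.≟ _)
    }
  }
  where
  open ≡-Reasoning

  transᴾ : ∀ p q r → p ≈ᴾ q → q ≈ᴾ r → p ≈ᴾ r
  transᴾ (point x₁ y₁ _) (point x₂ y₂ nz) (point x₃ y₃ _)
         (proportional e) (proportional f) with x₂ ℤ.≟ 0ℤ | y₂ ℤ.≟ 0ℤ
  ... | yes x≡0 | yes y≡0 = contradiction (x≡0 , y≡0) nz
  ... | no x≢0  | _       =
    proportional (ℤ.*-cancelˡ-≡ x₂ _ _ {{ℤ.≢-nonZero x≢0}} (begin
      x₂ * (x₁ * y₃)  ≡⟨ swap x₂ x₁ y₃ ⟩
      x₁ * (x₂ * y₃)  ≡⟨ cong (x₁ *_) f ⟩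
      x₁ * (x₃ * y₂)  ≡⟨ swap x₁ x₃ y₂ ⟩
      x₃ * (x₁ * y₂)  ≡⟨ cong (x₃ *_) e ⟩
      x₃ * (x₂ * y₁)  ≡⟨ swap x₃ x₂ y₁ ⟩
      x₂ * (x₃ * y₁)  ∎))
    where
    swap : ∀ i j k → i * (j * k) ≡ j * (i * k)
    swap = solve-∀
  ... | yes _   | no y≢0  =
    proportional (ℤ.*-cancelˡ-≡ y₂ _ _ {{ℤ.≢-nonZero y≢0}} (begin
      y₂ * (x₁ * y₃)  ≡⟨ rot y₂ x₁ y₃ ⟩
      y₃ * (x₁ * y₂)  ≡⟨ cong (y₃ *_) e ⟩
      y₃ * (x₂ * y₁)  ≡⟨ rot y₃ x₂ y₁ ⟩
      y₁ * (x₂ * y₃)  ≡⟨ cong (y₁ *_) f ⟩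
      y₁ * (x₃ * y₂)  ≡⟨ rot y₁ x₃ y₂ ⟩
      y₂ * (x₃ * y₁)  ∎))
    where
    rot : ∀ i j k → i * (j * k) ≡ k * (j * i)
    rot = solve-∀

∞ 𝟎 : ℙ¹ℚ
∞ = point 1ℤ 0ℤ λ ()
𝟎 = point 0ℤ 1ℤ λ ()

infixr 7 _•_
_•_ : SL₂ℤ → ℙ¹ℚ → ℙ¹ℚ
sl₂ (mat a b c d) det≡1 • point x y nz =
  point (a * x + b * y) (c * x + d * y) λ (p , q) → nz
    ( (begin
        x                                              ≡⟨ ℤ.*-identityˡ x ⟨
        1ℤ * x                                         ≡⟨ cong (_* x) det≡1 ⟨
        (a * d - b * c) * x                            ≡⟨ e₁ a b c d x y ⟩
        d * (a * x + b * y) + (- b) * (c * x + d * y)  ≡⟨ cong₂ (λ m n → d * m + (- b) * n) p q ⟩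
        d * 0ℤ + (- b) * 0ℤ                            ≡⟨ e₀ d (- b) ⟩
        0ℤ                                             ∎)
    , (begin
        y                                              ≡⟨ ℤ.*-identityˡ y ⟨
        1ℤ * y                                         ≡⟨ cong (_* y) det≡1 ⟨
        (a * d - b * c) * y                            ≡⟨ e₂ a b c d x y ⟩
        (- c) * (a * x + b * y) + a * (c * x + d * y)  ≡⟨ cong₂ (λ m n → (- c) * m + a * n) p q ⟩
        (- c) * 0ℤ + a * 0ℤ                            ≡⟨ e₀ (- c) a ⟩
        0ℤ                                             ∎))
  where
  open ≡-Reasoning
  e₀ : ∀ m n → m * 0ℤ + n * 0ℤ ≡ 0ℤ
  e₀ = solve-∀
  e₁ : ∀ a b c d x y → (a * d - b * c) * x ≡ d * (a * x + b * y) + (- b) * (c * x + d * y)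
  e₁ = solve-∀
  e₂ : ∀ a b c d x y → (a * d - b * c) * y ≡ (- c) * (a * x + b * y) + a * (c * x + d * y)
  e₂ = solve-∀

open Group Γ using (_∙_; _⁻¹)
open Subgroups Γ

US : SL₂ℤ
US = U ∙ S

Γ∞ Γ₀ : Pred SL₂ℤ 0ℓ
Γ∞ = ⟪ T ⟫
Γ₀ = ⟪ US ⟫

upper lower : ℤ → Matrix
upper n = mat 1ℤ n 0ℤ 1ℤ
lower n = mat 1ℤ 0ℤ n 1ℤ

T^n : ∀ n → matrix (T ^ n) ≡ upper n
T^n = powers
  where
  step : ∀ n → matrix T · upper n ≡ upper (1ℤ + n)
  step n = mat-cong refl (e n) refl refl
    where
    e : ∀ n → 1ℤ * n + 1ℤ * 1ℤ ≡ 1ℤ + n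
    e = solve-∀
  natural : ∀ k → matrix (T ^ (+ k)) ≡ upper (+ k)
  natural ℕ.zero    = refl
  natural (ℕ.suc k) = trans (cong (matrix T ·_) (natural k)) (step (+ k))
  powers : ∀ n → matrix (T ^ n) ≡ upper n
  powers (+ k)    = natural k
  powers -[1+ k ] = cong adj (natural (ℕ.suc k))

US^n : ∀ n → matrix (US ^ n) ≡ lower n
US^n = powers
  where
  step : ∀ n → matrix US · lower n ≡ lower (1ℤ + n)
  step n = mat-cong refl refl (e n) refl
    where
    e : ∀ n → 1ℤ * 1ℤ + 1ℤ * n ≡ 1ℤ + n
    e = solve-∀
  natural : ∀ k → matrix (US ^ (+ k)) ≡ lower (+ k)
  natural ℕ.zero    = refl
  natural (ℕ.suc k) = trans (cong (matrix US ·_) (natural k)) (step (+ k))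
  powers : ∀ n → matrix (US ^ n) ≡ lower n
  powers (+ k)    = natural k
  powers -[1+ k ] = cong adj (natural (ℕ.suc k))

units : ∀ a d → a * d ≡ 1ℤ → (a ≡ 1ℤ × d ≡ 1ℤ) ⊎ (a ≡ -1ℤ × d ≡ -1ℤ)
units a d ad≡1 = cases a d ad≡1
  (ℕ.m*n≡1⇒m≡1 ℤ.∣ a ∣ ℤ.∣ d ∣ norms) (ℕ.m*n≡1⇒n≡1 ℤ.∣ a ∣ ℤ.∣ d ∣ norms)
  where
  norms : ℤ.∣ a ∣ ℕ.* ℤ.∣ d ∣ ≡ 1
  norms = trans (sym (ℤ.abs-* a d)) (cong ℤ.∣_∣ ad≡1)
  cases : ∀ a d → a * d ≡ 1ℤ → ℤ.∣ a ∣ ≡ 1 → ℤ.∣ d ∣ ≡ 1 →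
          (a ≡ 1ℤ × d ≡ 1ℤ) ⊎ (a ≡ -1ℤ × d ≡ -1ℤ)
  cases (+ _)    (+ _)    _  refl refl = inj₁ (refl , refl)
  cases (+ _)    -[1+ _ ] () refl refl
  cases -[1+ _ ] (+ _)    () refl refl
  cases -[1+ _ ] -[1+ _ ] _  refl refl = inj₂ (refl , refl)

Γ∞⇔stabilizer : ∀ γ → Γ∞ γ ⇔ γ • ∞ ≈ᴾ ∞
Γ∞⇔stabilizer γ@(sl₂ (mat a b c d) det≡1) = mk⇔ to from
  where
  e₁ : ∀ a b c d → 1ℤ * (c * 1ℤ + d * 0ℤ) ≡ c
  e₁ = solve-∀
  e₂ : ∀ a b → (a * 1ℤ + b * 0ℤ) * 0ℤ ≡ 0ℤ
  e₂ = solve-∀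
  e₃ : ∀ a b d → a * d - b * 0ℤ ≡ a * d
  e₃ = solve-∀

  to : Γ∞ γ → γ • ∞ ≈ᴾ ∞
  to (n , γ≈Tⁿ) = proportional (trans (e₂ a b) (trans (sym (c≡0 γ≈Tⁿ)) (sym (e₁ a b c d))))
    where
    c≡0 : γ ≈± T ^ n → c ≡ 0ℤ
    c≡0 (plus p)  = cong Matrix.c (trans p (T^n n))
    c≡0 (minus p) = cong Matrix.c (trans p (cong neg (T^n n)))

  from : γ • ∞ ≈ᴾ ∞ → Γ∞ γ
  from (proportional e) with trans (sym (e₁ a b c d)) (trans (sym e) (e₂ a b))
  ... | refl with units a d (trans (sym (e₃ a b d)) det≡1)
  ... | inj₁ (refl , refl) = b , plus (sym (T^n b))
  ... | inj₂ (refl , refl) = - b , minus (trans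
    (mat-cong refl (sym (ℤ.neg-involutive b)) refl refl) (cong neg (sym (T^n (- b)))))

Γ₀⇔stabilizer : ∀ γ → Γ₀ γ ⇔ γ • 𝟎 ≈ᴾ 𝟎
Γ₀⇔stabilizer γ@(sl₂ (mat a b c d) det≡1) = mk⇔ to from
  where
  e₁ : ∀ a b → (a * 0ℤ + b * 1ℤ) * 1ℤ ≡ b
  e₁ = solve-∀
  e₂ : ∀ c d → 0ℤ * (c * 0ℤ + d * 1ℤ) ≡ 0ℤ
  e₂ = solve-∀
  e₃ : ∀ a c d → a * d - 0ℤ * c ≡ a * d
  e₃ = solve-∀

  to : Γ₀ γ → γ • 𝟎 ≈ᴾ 𝟎
  to (n , γ≈USⁿ) = proportional (trans (e₁ a b) (trans (b≡0 γ≈USⁿ) (sym (e₂ c d))))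
    where
    b≡0 : γ ≈± US ^ n → b ≡ 0ℤ
    b≡0 (plus p)  = cong Matrix.b (trans p (US^n n))
    b≡0 (minus p) = cong Matrix.b (trans p (cong neg (US^n n)))

  from : γ • 𝟎 ≈ᴾ 𝟎 → Γ₀ γ
  from (proportional e) with trans (sym (e₁ a b)) (trans e (e₂ c d))
  ... | refl with units a d (trans (sym (e₃ a c d)) det≡1)
  ... | inj₁ (refl , refl) = c , plus (sym (US^n c))
  ... | inj₂ (refl , refl) = - c , minus (trans
    (mat-cong refl refl (sym (ℤ.neg-involutive c)) refl) (cong neg (sym (US^n (- c)))))

Γ∞? : Decidable Γ∞
Γ∞? γ = Dec.map (⇔-sym (Γ∞⇔stabilizer γ)) (γ • ∞ ℙ¹.≟ ∞)
  where module ℙ¹ = DecSetoid ℙ¹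

Γ₀? : Decidable Γ₀
Γ₀? γ = Dec.map (⇔-sym (Γ₀⇔stabilizer γ)) (γ • 𝟎 ℙ¹.≟ 𝟎)
  where module ℙ¹ = DecSetoid ℙ¹

Γ² : Group 0ℓ 0ℓ
Γ² = DirectProduct.group Γ Γ

module ℤ[Γ]  = GroupRing Γ _≟±_
module ℤ[Γ²] = GroupRing Γ² (×-decidable _≟±_ _≟±_)
module ℤ[ℙ¹] = FreeAbelian ℙ¹

-- The pair (a,b) = a ⊗ b in ℤ[Γ²] = ℤ[Γ] ⊗ ℤ[Γ].
⟨_,_⟩ : ℤ[Γ].FormalSum → ℤ[Γ].FormalSum → ℤ[Γ²].FormalSum
⟨_,_⟩ = cartesianProductWith λ (m , α) (n , β) → m * n , (α , β)

∂ : SL₂ℤ → ℤ[ℙ¹].FormalSum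
∂ γ = (1ℤ , γ • ∞) ∷ (-1ℤ , γ • 𝟎) ∷ []

-- The defining sums are additive in x and their conditions only depend on the
-- class of a pair in Γ², so x may contain repeated pairs.  γ runs over
-- representatives of the cosets in Γ/Γ∞ and Γ/Γ₀.
I-H I-V I-D : Pred ℤ[Γ²].FormalSum 0ℓ
I-H x = ∀ γ → sumOver (leftCoset? (⟪⟫-resp T) Γ∞? γ ∘ proj₂) (∂ ∘ proj₁) x ≋ []
  where open ℤ[ℙ¹]
I-V x = ∀ γ → sumOver (leftCoset? (⟪⟫-resp US) Γ₀? γ ∘ proj₁) (∂ ∘ proj₂) x ≋ []
  where open ℤ[ℙ¹]
I-D x = ∀ g → sumOver (λ (α , β) → β ∙ α ⁻¹ ≟± g) (∂ ∘ proj₁) x ≋ []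
  where open ℤ[ℙ¹]

generators : List ℤ[Γ²].FormalSum
generators =
    ⟨ 1# ⊕ s , 1# ⊕ s ⟩
  ∷ ⟨ s , s ⟩ ⊞ ⟨ s , u ⊛ s ⟩ ⊞ ⟨ u ⊛ s , u ⊛ s ⟩ ⊞ ⟨ 1# , u ⟩ ⊞ ⊟ ⟨ u ⊛ u , u ⊛ u ⟩
  ∷ ⟨ 1# ⊕ u ⊕ u ⊛ u , 1# ⟩ ⊠ (⟨ 1# , 1# ⟩ ⊞ ⟨ s , s ⟩)
  ∷ ⟨ 1# , 1# ⊕ u ⊕ u ⊛ u ⟩ ⊠ (⟨ 1# , 1# ⟩ ⊞ ⟨ s , s ⟩)
  ∷ []
  where
  open RawRing ℤ[Γ].groupRing using (1#)
    renaming (_+_ to infixl 6 _⊕_; _*_ to infixl 7 _⊛_)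
  open RawRing ℤ[Γ²].groupRing using ()
    renaming (_+_ to infixl 6 _⊞_; _*_ to infixl 7 _⊠_; -_ to infix 8 ⊟_)
  s u : ℤ[Γ].FormalSum
  s = (1ℤ , S) ∷ []
  u = (1ℤ , U) ∷ []

open LeftIdeals ℤ[Γ²].groupRing public

𝓘₂ : Pred ℤ[Γ²].FormalSum 0ℓ
𝓘₂ = LeftIdeal⟨ generators ⟩

-- Write q(α,β) for the class of (α,β) modulo 𝓘₂ and h(α,β) = q(α,β) + q(αS,βS).
-- The generators say that h satisfies Manin's relations f(g) + f(gS) = 0 and
-- f(g) + f(gU) + f(gU²) = 0 in each variable, and that
--   q(α,β) + q(αU,βU) + q(αU²,βU²) = h(α,βU) + h(α,β) + h(αU,βU).
-- By Manin's theorem (Euclid's algorithm) every f with these relations has the form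
-- f(g) = F(g∞) - F(g0), so Σ λᵢ f(γᵢ) depends only on Σ λᵢ ∂γᵢ.  Apply this to h(α,·) and
-- call K(α,β) the value at β∞ of the resulting primitive.  Then K(·,β) satisfies Manin's
-- relations and depends only on βΓ∞, hence K vanishes on I_H; and α ↦ (q - K)(α,gα)
-- satisfies them for every g, hence q - K vanishes on I_D.  So q vanishes on I_H ∩ I_D.
-- Conversely the coefficients of the sums that define I_H, I_V and I_D are functions of
-- (α,β) with the same relations as q.

module Submission where

open import Algebra.Bundles using (CommutativeMonoid; Group; RawRing)
import Algebra.Construct.DirectProduct as DirectProduct
open import Algebra.Module.Bundles using (LeftModule)
import Algebra.Module.Construct.TensorUnit as TensorUnit
import Algebra.Module.Properties.LeftModule as LeftModuleProperties
import Algebra.Properties.CommutativeSemigroup as CommutativeSemigroupProperties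
import Algebra.Properties.Group as GroupProperties
open import Algebra.Structures using (IsGroup)
open import Data.Bool.Base using (if_then_else_)
open import Data.Empty using (⊥)
open import Data.Fin.Base using (Fin)
open import Data.Fin.Patterns
import Data.Fin.Properties as Fin
open import Data.Integer.Base as ℤ using (ℤ; +_; -[1+_]; 0ℤ; 1ℤ; -1ℤ; ∣_∣; _+_; _*_; -_; _-_)
import Data.Integer.Properties as ℤ
open import Data.Integer.Tactic.RingSolver using (solve-∀)
open import Data.List.Base
  using (List; []; _∷_; _++_; map; foldr; filter; concatMap; length; cartesianProductWith)
open import Data.List.Membership.Propositional using (_∈_)
open import Data.List.Properties using (length-filter; filter-≐; ++-identityʳ; ++-assoc)
open import Data.List.Relation.Binary.Pointwise using (Pointwise; []; _∷_)
open import Data.List.Relation.Unary.Any using (here; there)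
open import Data.Nat.Base as ℕ using (ℕ; zero; suc; s≤s)
open import Data.Nat.Induction using (<-wellFounded)
import Data.Nat.Properties as ℕ
import Data.Nat.Tactic.RingSolver as ℕ-Solver
open import Data.Product.Base using (_×_; _,_; proj₁; proj₂; map₁; map₂; ∃-syntax)
open import Data.Product.Relation.Binary.Pointwise.NonDependent using (×-decidable)
open import Data.Sum.Base using (_⊎_; inj₁; inj₂)
open import Data.Vec.Base using (Vec; []; _∷_; lookup)
open import Defs
  using (module FreeAbelian; module GroupRing; module LeftIdeals; ℙ¹ℚ; point; _≈ᴾ_; proportional)
open import Function.Base using (_∘_; _on_)
open import Function.Bundles using (_⇔_; Equivalence)
open import Induction.WellFounded using (Acc; acc)
open import Level using (Level; 0ℓ; _⊔_)
open import Relation.Binary.Bundles using (DecSetoid)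
open import Relation.Binary.Definitions using () renaming (Decidable to Decidable₂)
open import Relation.Binary.PropositionalEquality
  using (_≡_; refl; sym; trans; cong; cong₂; subst; module ≡-Reasoning)
open import Relation.Nullary using (¬_; Dec; yes; no; does; ¬?; contradiction)
open import Relation.Nullary.Decidable using (True; toWitness)
open import Relation.Unary using (Pred; Decidable; _∩_; _≐_)

-- Both inclusions become statements about evaluating a function of pairs at a formal sum, with
-- values in a ℤ-module: ℤ[Γ²] modulo the left ideal for one, ℤ itself for the other. Formal sums
-- are lists with repetitions, so sums over cosets are obtained by splitting a list into classes.
-- The delicate object is the primitive F. It must be a function on ℙ¹(ℚ), whose points come with
-- common factors and signs. So F(p) is the value of f on an explicit chain `path p` from ∞ to p,
-- found by subtraction alone, which sees only ratios and needs no reduction to lowest terms. As the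
-- chain does not depend on f, F(p) is additive in f; this is why K(·,β) inherits the relations that
-- h(·,γ) satisfies for each γ. That F(g∞) - F(g0) = f(g) is proved by induction for words in T and
-- L, and carried to all g by signs and by S on either side. The algebra is done over an abstract
-- group, so that products of matrices and their determinant proofs stay folded.

private variable
  a b p ℓ : Level
  A : Set a
  B : Set b

-- Linear extension of functions to formal sums, with values in a ℤ-module.

module Evaluation {m ℓm} (M : LeftModule ℤ.+-*-ring m ℓm) where
  open LeftModule M
  open LeftModuleProperties M using (inverseˡ-uniqueᴹ)
  open import Relation.Binary.Reasoning.Setoid ≈ᴹ-setoid

  eval : (B → Carrierᴹ) → List (ℤ × B) → Carrierᴹ
  eval f = foldr (λ (n , b) e → n *ₗ f b +ᴹ e) 0ᴹ

  interchange : ∀ w x y z → (w +ᴹ x) +ᴹ (y +ᴹ z) ≈ᴹ (w +ᴹ y) +ᴹ (x +ᴹ z)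
  interchange = CommutativeSemigroupProperties.interchange
    (CommutativeMonoid.commutativeSemigroup +ᴹ-commutativeMonoid)

  eval-cong : ∀ {f g : B → Carrierᴹ} → (∀ b → f b ≈ᴹ g b) → ∀ s → eval f s ≈ᴹ eval g s
  eval-cong f≈g []            = ≈ᴹ-refl
  eval-cong f≈g ((n , b) ∷ s) = +ᴹ-cong (*ₗ-congˡ (f≈g b)) (eval-cong f≈g s)

  eval-++ : ∀ (f : B → Carrierᴹ) s t → eval f (s ++ t) ≈ᴹ eval f s +ᴹ eval f t
  eval-++ f []            t = ≈ᴹ-sym (+ᴹ-identityˡ _)
  eval-++ f ((n , b) ∷ s) t = ≈ᴹ-trans (+ᴹ-congˡ (eval-++ f s t)) (≈ᴹ-sym (+ᴹ-assoc _ _ _))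

  eval-scale : ∀ (f : B → Carrierᴹ) n s → eval f (map (map₁ (n ℤ.*_)) s) ≈ᴹ n *ₗ eval f s
  eval-scale f n []            = ≈ᴹ-sym (*ₗ-zeroʳ n)
  eval-scale f n ((k , b) ∷ s) =
    ≈ᴹ-trans (+ᴹ-cong (*ₗ-assoc n k _) (eval-scale f n s)) (≈ᴹ-sym (*ₗ-distribˡ n _ _))

  eval-map : ∀ (f : B → Carrierᴹ) (g : A → B) s → eval f (map (map₂ g) s) ≡ eval (f ∘ g) s
  eval-map f g []            = refl
  eval-map f g ((n , a) ∷ s) = cong (n *ₗ f (g a) +ᴹ_) (eval-map f g s)

  eval-+ : ∀ (f g : B → Carrierᴹ) s → eval (λ b → f b +ᴹ g b) s ≈ᴹ eval f s +ᴹ eval g s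
  eval-+ f g []            = ≈ᴹ-sym (+ᴹ-identityˡ _)
  eval-+ f g ((n , b) ∷ s) =
    ≈ᴹ-trans (+ᴹ-cong (*ₗ-distribˡ n _ _) (eval-+ f g s)) (interchange _ _ _ _)

  eval-0 : ∀ (s : List (ℤ × B)) → eval (λ _ → 0ᴹ) s ≈ᴹ 0ᴹ
  eval-0 []            = ≈ᴹ-refl
  eval-0 ((n , b) ∷ s) = ≈ᴹ-trans (+ᴹ-cong (*ₗ-zeroʳ n) (eval-0 s)) (+ᴹ-identityˡ _)

  eval-pointwise : ∀ (f : A → Carrierᴹ) (g : B → Carrierᴹ) s t →
                   Pointwise (λ (m , a) (n , b) → m ≡ n × f a ≈ᴹ g b) s t → eval f s ≈ᴹ eval g t
  eval-pointwise f g [] [] []                                   = ≈ᴹ-refl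
  eval-pointwise f g ((m , a) ∷ s) ((n , b) ∷ t) ((refl , e) ∷ s≈t) =
    +ᴹ-cong (*ₗ-congˡ e) (eval-pointwise f g s t s≈t)

  eval-filter-cong : ∀ {P : Pred B p} (P? : Decidable P) {f g : B → Carrierᴹ} →
                     (∀ b → P b → f b ≈ᴹ g b) → ∀ s →
                     eval f (filter (P? ∘ proj₂) s) ≈ᴹ eval g (filter (P? ∘ proj₂) s)
  eval-filter-cong P? f≈g []            = ≈ᴹ-refl
  eval-filter-cong P? f≈g ((n , b) ∷ s) with P? b
  ... | yes Pb = +ᴹ-cong (*ₗ-congˡ (f≈g b Pb)) (eval-filter-cong P? f≈g s)
  ... | no  _  = eval-filter-cong P? f≈g s

  eval-filter-split : ∀ {P : Pred B p} (P? : Decidable P) (f : B → Carrierᴹ) s →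
                      eval f s ≈ᴹ eval f (filter (P? ∘ proj₂) s)
                               +ᴹ eval f (filter (¬? ∘ P? ∘ proj₂) s)
  eval-filter-split P? f []            = ≈ᴹ-sym (+ᴹ-identityˡ _)
  eval-filter-split P? f ((n , b) ∷ s) with P? b
  ... | yes _ = ≈ᴹ-trans (+ᴹ-congˡ (eval-filter-split P? f s)) (≈ᴹ-sym (+ᴹ-assoc _ _ _))
  ... | no  _ = begin
    n *ₗ f b +ᴹ eval f s    ≈⟨ +ᴹ-congˡ (eval-filter-split P? f s) ⟩
    n *ₗ f b +ᴹ (u +ᴹ v)    ≈⟨ +ᴹ-assoc _ _ _ ⟨
    (n *ₗ f b +ᴹ u) +ᴹ v    ≈⟨ +ᴹ-congʳ (+ᴹ-comm _ _) ⟩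
    (u +ᴹ n *ₗ f b) +ᴹ v    ≈⟨ +ᴹ-assoc _ _ _ ⟩
    u +ᴹ (n *ₗ f b +ᴹ v)    ∎
    where
    u = eval f (filter (P? ∘ proj₂) s)
    v = eval f (filter (¬? ∘ P? ∘ proj₂) s)

  module _ {x ℓx} (X : DecSetoid x ℓx) where
    open DecSetoid X using (_≟_)
      renaming (Carrier to C; _≈_ to _~_; refl to ~-refl; sym to ~-sym; trans to ~-trans)
    open FreeAbelian X using (coefficient; _≋_; scale; sumOver)

    class : C → List (ℤ × C) → List (ℤ × C)
    class c = filter (λ t → proj₂ t ≟ c)

    class-reject : ∀ c d s → ¬ c ~ d → class d (filter (λ t → ¬? (proj₂ t ≟ c)) s) ≡ class d s
    class-reject c d []            c≁d = refl
    class-reject c d ((n , b) ∷ s) c≁d with b ≟ c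
    ... | yes b~c with b ≟ d
    ...   | yes b~d = contradiction (~-trans (~-sym b~c) b~d) c≁d
    ...   | no  _   = class-reject c d s c≁d
    class-reject c d ((n , b) ∷ s) c≁d | no _ with b ≟ d
    ...   | yes _ = cong ((n , b) ∷_) (class-reject c d s c≁d)
    ...   | no  _ = class-reject c d s c≁d

    class-empty : ∀ c d s → c ~ d → class d (filter (λ t → ¬? (proj₂ t ≟ c)) s) ≡ []
    class-empty c d []            c~d = refl
    class-empty c d ((n , b) ∷ s) c~d with b ≟ c
    ... | yes _ = class-empty c d s c~d
    ... | no b≁c with b ≟ d
    ...   | yes b~d = contradiction (~-trans b~d (~-sym c~d)) b≁c
    ...   | no  _   = class-empty c d s c~d

    -- The class of the head is split off and the rest is shorter. The hypothesis survives because a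
    -- class of the rest is either empty or unchanged. With other equivalences on the same carrier
    -- this also gives the sums over cosets and over diagonals.
    eval-classes : ∀ (f : C → Carrierᴹ) s → (∀ c → eval f (class c s) ≈ᴹ 0ᴹ) → eval f s ≈ᴹ 0ᴹ
    eval-classes f s = go s (<-wellFounded (length s))
      where
      go : ∀ s → Acc ℕ._<_ (length s) → (∀ c → eval f (class c s) ≈ᴹ 0ᴹ) → eval f s ≈ᴹ 0ᴹ
      go []                _         _    = ≈ᴹ-refl
      go s@((n , c) ∷ s₀) (acc rec) null = begin
        eval f s                              ≈⟨ eval-filter-split (_≟ c) f s ⟩
        eval f (class c s) +ᴹ eval f rest
          ≈⟨ +ᴹ-cong (null c) (go rest (rec shorter) rest-null) ⟩
        0ᴹ +ᴹ 0ᴹ                              ≈⟨ +ᴹ-identityˡ _ ⟩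
        0ᴹ                                    ∎
        where
        rest = filter (λ t → ¬? (proj₂ t ≟ c)) s
        shorter : length rest ℕ.< length s
        shorter with c ≟ c
        ... | yes _   = ℕ.s≤s (length-filter (λ t → ¬? (proj₂ t ≟ c)) s₀)
        ... | no  c≁c = contradiction ~-refl c≁c
        rest-null : ∀ d → eval f (class d rest) ≈ᴹ 0ᴹ
        rest-null d with c ≟ d
        ... | yes c~d rewrite class-empty c d s c~d = ≈ᴹ-refl
        ... | no  c≁d rewrite class-reject c d s c≁d = null d

    module _ {f : C → Carrierᴹ} (f-cong : ∀ {c d} → c ~ d → f c ≈ᴹ f d) where

      eval-class : ∀ s c → eval f (class c s) ≈ᴹ coefficient s c *ₗ f c
      eval-class []            c = ≈ᴹ-sym (*ₗ-zeroˡ _)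
      eval-class ((n , b) ∷ s) c with b ≟ c
      ... | yes b~c = ≈ᴹ-trans (+ᴹ-cong (*ₗ-congˡ (f-cong b~c)) (eval-class s c))
                               (≈ᴹ-sym (*ₗ-distribʳ _ _ _))
      ... | no  _   = eval-class s c

      -- On a class f is constant, so the class contributes its coefficient times one value of f.
      eval-null : ∀ s → s ≋ [] → eval f s ≈ᴹ 0ᴹ
      eval-null s s≋0 = eval-classes f s λ c → begin
        eval f (class c s)       ≈⟨ eval-class s c ⟩
        coefficient s c *ₗ f c   ≡⟨ cong (_*ₗ f c) (s≋0 c) ⟩
        0ℤ *ₗ f c                ≈⟨ *ₗ-zeroˡ _ ⟩
        0ᴹ                       ∎

    eval-sumOver : ∀ {P : Pred B p} (P? : Decidable P) (f : C → Carrierᴹ) g s →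
                   eval f (sumOver P? g s) ≈ᴹ eval (eval f ∘ g) (filter (P? ∘ proj₂) s)
    eval-sumOver P? f g s = go (filter (P? ∘ proj₂) s)
      where
      go : ∀ s → eval f (concatMap (λ (n , b) → scale n (g b)) s) ≈ᴹ eval (eval f ∘ g) s
      go []            = ≈ᴹ-refl
      go ((n , b) ∷ s) = ≈ᴹ-trans (eval-++ f (scale n (g b)) _)
                                  (+ᴹ-cong (eval-scale f n (g b)) (go s))

  infixl 6 _⊕_
  infix  8 ⊝_

  -- Reflected linear expressions in finitely many module elements. An identity is decided by
  -- computing its integer coefficients; `sum` embeds an explicit linear combination, such as a
  -- translated generator.
  data Expr (n : ℕ.ℕ) : Set where
    var : Fin n → Expr n
    _⊕_ : Expr n → Expr n → Expr n
    ⊝_  : Expr n → Expr n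
    sum : List (ℤ × Fin n) → Expr n

  module _ {n : ℕ.ℕ} where
    finDecSetoid : DecSetoid 0ℓ 0ℓ
    finDecSetoid = Fin.≡-decSetoid n
    open FreeAbelian finDecSetoid using (FormalSum; coefficient; scale)

    formal : Expr n → FormalSum
    formal (var i)  = (1ℤ , i) ∷ []
    formal (d ⊕ e)  = formal d ++ formal e
    formal (⊝ e)    = scale -1ℤ (formal e)
    formal (sum s)  = s

    ⟦_⟧ : Expr n → Vec Carrierᴹ n → Carrierᴹ
    ⟦ var i ⟧ ρ = lookup ρ i
    ⟦ d ⊕ e ⟧ ρ = ⟦ d ⟧ ρ +ᴹ ⟦ e ⟧ ρ
    ⟦ ⊝ e ⟧   ρ = -ᴹ ⟦ e ⟧ ρ
    ⟦ sum s ⟧ ρ = eval (lookup ρ) s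

    -1*ₗ : ∀ x → -1ℤ *ₗ x ≈ᴹ -ᴹ x
    -1*ₗ x = inverseˡ-uniqueᴹ (-1ℤ *ₗ x) x (begin
      -1ℤ *ₗ x +ᴹ x         ≈⟨ +ᴹ-congˡ (*ₗ-identityˡ x) ⟨
      -1ℤ *ₗ x +ᴹ 1ℤ *ₗ x   ≈⟨ *ₗ-distribʳ x -1ℤ 1ℤ ⟨
      0ℤ *ₗ x               ≈⟨ *ₗ-zeroˡ x ⟩
      0ᴹ                    ∎)

    formal-sound : ∀ e ρ → eval (lookup ρ) (formal e) ≈ᴹ ⟦ e ⟧ ρ
    formal-sound (var i) ρ = ≈ᴹ-trans (+ᴹ-identityʳ _) (*ₗ-identityˡ _)
    formal-sound (d ⊕ e) ρ = ≈ᴹ-trans (eval-++ (lookup ρ) (formal d) (formal e))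
                                      (+ᴹ-cong (formal-sound d ρ) (formal-sound e ρ))
    formal-sound (⊝ e)   ρ = begin
      eval (lookup ρ) (scale -1ℤ (formal e))   ≈⟨ eval-scale (lookup ρ) -1ℤ (formal e) ⟩
      -1ℤ *ₗ eval (lookup ρ) (formal e)        ≈⟨ -1*ₗ _ ⟩
      -ᴹ eval (lookup ρ) (formal e)            ≈⟨ -ᴹ‿cong (formal-sound e ρ) ⟩
      -ᴹ ⟦ e ⟧ ρ                               ∎

    formal-sound (sum s) ρ = ≈ᴹ-refl

    Null? : ∀ e → Dec (∀ i → coefficient (formal e) i ≡ 0ℤ)
    Null? e = Fin.all? λ i → coefficient (formal e) i ℤ.≟ 0ℤ

    -- Proves d = e from the relation r = 0 by checking that d - e - r vanishes formally.
    combine : ∀ ρ d e r {_ : True (Null? (d ⊕ ⊝ e ⊕ ⊝ r))} →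
              ⟦ r ⟧ ρ ≈ᴹ 0ᴹ → ⟦ d ⟧ ρ ≈ᴹ ⟦ e ⟧ ρ
    combine ρ d e r {null} r≈0 = begin
      ⟦ d ⟧ ρ                               ≈⟨ uncancel (⟦ d ⟧ ρ) (⟦ e ⟧ ρ) ⟩
      (⟦ d ⟧ ρ +ᴹ -ᴹ ⟦ e ⟧ ρ) +ᴹ ⟦ e ⟧ ρ    ≈⟨ +ᴹ-congʳ d-e≈0 ⟩
      0ᴹ +ᴹ ⟦ e ⟧ ρ                         ≈⟨ +ᴹ-identityˡ _ ⟩
      ⟦ e ⟧ ρ                               ∎
      where
      uncancel : ∀ x y → x ≈ᴹ (x +ᴹ -ᴹ y) +ᴹ y
      uncancel x y = begin
        x                    ≈⟨ +ᴹ-identityʳ x ⟨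
        x +ᴹ 0ᴹ              ≈⟨ +ᴹ-congˡ (-ᴹ‿inverseˡ y) ⟨
        x +ᴹ (-ᴹ y +ᴹ y)     ≈⟨ +ᴹ-assoc x _ y ⟨
        (x +ᴹ -ᴹ y) +ᴹ y     ∎
      whole≈0 : ⟦ d ⊕ ⊝ e ⊕ ⊝ r ⟧ ρ ≈ᴹ 0ᴹ
      whole≈0 = ≈ᴹ-trans (≈ᴹ-sym (formal-sound (d ⊕ ⊝ e ⊕ ⊝ r) ρ))
        (eval-null finDecSetoid (λ { refl → ≈ᴹ-refl }) (formal (d ⊕ ⊝ e ⊕ ⊝ r)) (toWitness null))
      d-e≈0 : ⟦ d ⊕ ⊝ e ⟧ ρ ≈ᴹ 0ᴹ
      d-e≈0 = begin
        ⟦ d ⊕ ⊝ e ⟧ ρ                         ≈⟨ uncancel _ (⟦ r ⟧ ρ) ⟩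
        ⟦ d ⊕ ⊝ e ⊕ ⊝ r ⟧ ρ +ᴹ ⟦ r ⟧ ρ        ≈⟨ +ᴹ-cong whole≈0 r≈0 ⟩
        0ᴹ +ᴹ 0ᴹ                              ≈⟨ +ᴹ-identityˡ _ ⟩
        0ᴹ                                    ∎

    rearrange : ∀ ρ d e {_ : True (Null? (d ⊕ ⊝ e ⊕ ⊝ sum []))} → ⟦ d ⟧ ρ ≈ᴹ ⟦ e ⟧ ρ
    rearrange ρ d e {null} = combine ρ d e (sum []) {null} ≈ᴹ-refl

-- Coefficients as linear functionals with values in ℤ.

ℤ-module : LeftModule ℤ.+-*-ring 0ℓ 0ℓ
ℤ-module = TensorUnit.leftModule

module ℤ-Evaluation = Evaluation ℤ-module

indicator : ∀ {p} {P : Set p} → Dec P → ℤ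
indicator P? = if does P? then 1ℤ else 0ℤ

indicator-cong : ∀ {p q} {P : Set p} {Q : Set q} (P? : Dec P) (Q? : Dec Q) →
                 (P → Q) → (Q → P) → indicator P? ≡ indicator Q?
indicator-cong (yes p) (yes q) to from = refl
indicator-cong (no ¬p) (no ¬q) to from = refl
indicator-cong (yes p) (no ¬q) to from = contradiction (to p) ¬q
indicator-cong (no ¬p) (yes q) to from = contradiction (from q) ¬p

module _ {a ℓ} (X : DecSetoid a ℓ) where
  open DecSetoid X using (_≟_)
  open FreeAbelian X
  open ℤ-Evaluation

  coefficient-eval : ∀ s x → coefficient s x ≡ eval (λ y → indicator (y ≟ x)) s
  coefficient-eval []            x = refl
  coefficient-eval ((n , y) ∷ s) x with y ≟ x
  ... | yes _ = cong₂ _+_ (sym (ℤ.*-identityʳ n)) (coefficient-eval s x)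
  ... | no  _ = trans (coefficient-eval s x)
    (trans (sym (ℤ.+-identityˡ _)) (cong (_+ _) (sym (ℤ.*-zeroʳ n))))

  coefficient-++ : ∀ s t x → coefficient (s ++ t) x ≡ coefficient s x + coefficient t x
  coefficient-++ s t x = trans (coefficient-eval (s ++ t) x)
    (trans (eval-++ _ s t) (sym (cong₂ _+_ (coefficient-eval s x) (coefficient-eval t x))))

  coefficient-scale : ∀ n s x → coefficient (scale n s) x ≡ n * coefficient s x
  coefficient-scale n s x = trans (coefficient-eval (scale n s) x)
    (trans (eval-scale _ n s) (cong (n *_) (sym (coefficient-eval s x))))

-- The group ring modulo a left ideal, as a ℤ-module.

module QuotientByLeftIdeal {c ℓ} (G : Group c ℓ) (_≟_ : Decidable₂ (Group._≈_ G))
                           (gs : List (GroupRing.FormalSum G _≟_)) where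
  open Group G using (Carrier; _≈_; _∙_; ε; ∙-congˡ; identityˡ; assoc)
    renaming (sym to ≈-sym; trans to ≈-trans)
  open GroupRing G _≟_
  open LeftIdeals groupRing

  _·ʳ_ : FormalSum → FormalSum → FormalSum
  _·ʳ_ = cartesianProductWith λ (m , g) (n , h) → m * n , g ∙ h

  module _ {m ℓm} (M : LeftModule ℤ.+-*-ring m ℓm) where
    open LeftModule M
    open Evaluation M
    open import Relation.Binary.Reasoning.Setoid ≈ᴹ-setoid

    eval-monomial : ∀ (f : Carrier → Carrierᴹ) m g x →
                    eval f (map (λ (n , h) → m * n , g ∙ h) x) ≈ᴹ m *ₗ eval (f ∘ (g ∙_)) x
    eval-monomial f m g []            = ≈ᴹ-sym (*ₗ-zeroʳ m)
    eval-monomial f m g ((n , h) ∷ x) =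
      ≈ᴹ-trans (+ᴹ-cong (*ₗ-assoc m n _) (eval-monomial f m g x)) (≈ᴹ-sym (*ₗ-distribˡ m _ _))

    eval-product : ∀ (f : Carrier → Carrierᴹ) r x →
                   eval f (r ·ʳ x) ≈ᴹ eval (λ g → eval (f ∘ (g ∙_)) x) r
    eval-product f []            x = ≈ᴹ-refl
    eval-product f ((m , g) ∷ r) x = ≈ᴹ-trans (eval-++ f (map (λ (n , h) → m * n , g ∙ h) x) (r ·ʳ x))
      (+ᴹ-cong (eval-monomial f m g x) (eval-product f r x))

    eval-≋ : ∀ {f : Carrier → Carrierᴹ} → (∀ {g h} → g ≈ h → f g ≈ᴹ f h) →
             ∀ x y → x ≋ y → eval f x ≈ᴹ eval f y
    eval-≋ {f} f-cong x y x≋y = begin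
      eval f x                                  ≈⟨ +ᴹ-identityʳ _ ⟨
      eval f x +ᴹ 0ᴹ                            ≈⟨ +ᴹ-congˡ (-ᴹ‿inverseˡ (eval f y)) ⟨
      eval f x +ᴹ (-ᴹ eval f y +ᴹ eval f y)     ≈⟨ +ᴹ-assoc _ _ _ ⟨
      (eval f x +ᴹ -ᴹ eval f y) +ᴹ eval f y     ≈⟨ +ᴹ-congʳ difference ⟨
      eval f (x ++ scale -1ℤ y) +ᴹ eval f y
        ≈⟨ +ᴹ-congʳ (eval-null decSetoid f-cong (x ++ scale -1ℤ y) null) ⟩
      0ᴹ +ᴹ eval f y                            ≈⟨ +ᴹ-identityˡ _ ⟩
      eval f y                                  ∎
      where
      difference : eval f (x ++ scale -1ℤ y) ≈ᴹ eval f x +ᴹ -ᴹ eval f y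
      difference = ≈ᴹ-trans (eval-++ f x (scale -1ℤ y))
        (+ᴹ-congˡ (≈ᴹ-trans (eval-scale f -1ℤ y) (-1*ₗ {n = 0} _)))
      null : x ++ scale -1ℤ y ≋ []
      null z = trans (coefficient-++ decSetoid x (scale -1ℤ y) z)
        (trans (cong₂ _+_ (x≋y z) (coefficient-scale decSetoid -1ℤ y z)) (lemma (coefficient y z)))
        where
        lemma : ∀ k → k + -1ℤ * k ≡ 0ℤ
        lemma = solve-∀

    -- All left translates are treated at once: evaluating the translate by g at a product r * x
    -- gives a combination of values at x of the translates by g ∙ h, so the induction needs every
    -- translate.
    eval-ideal : ∀ {f : Carrier → Carrierᴹ} → (∀ {g h} → g ≈ h → f g ≈ᴹ f h) →
                 (∀ {y} → y ∈ gs → ∀ g → eval (f ∘ (g ∙_)) y ≈ᴹ 0ᴹ) →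
                 ∀ {x} → LeftIdeal⟨ gs ⟩ x → ∀ g → eval (f ∘ (g ∙_)) x ≈ᴹ 0ᴹ
    eval-ideal f-cong kills (generator y∈gs) g = kills y∈gs g
    eval-ideal f-cong kills zero             g = ≈ᴹ-refl
    eval-ideal f-cong kills (add {x} {y} i j) g = begin
      eval _ (x ++ y)          ≈⟨ eval-++ _ x y ⟩
      eval _ x +ᴹ eval _ y
        ≈⟨ +ᴹ-cong (eval-ideal f-cong kills i g) (eval-ideal f-cong kills j g) ⟩
      0ᴹ +ᴹ 0ᴹ                 ≈⟨ +ᴹ-identityˡ _ ⟩
      0ᴹ                       ∎
    eval-ideal {f} f-cong kills (mul r {x} i) g = begin
      eval (f ∘ (g ∙_)) (r ·ʳ x)                        ≈⟨ eval-product (f ∘ (g ∙_)) r x ⟩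
      eval (λ h → eval (λ k → f (g ∙ (h ∙ k))) x) r
        ≈⟨ eval-cong (λ h → eval-cong (λ k → f-cong (≈-sym (assoc g h k))) x) r ⟩
      eval (λ h → eval (f ∘ ((g ∙ h) ∙_)) x) r
        ≈⟨ eval-cong (λ h → eval-ideal f-cong kills i (g ∙ h)) r ⟩
      eval (λ _ → 0ᴹ) r                                 ≈⟨ eval-0 r ⟩
      0ᴹ                                                ∎
    eval-ideal f-cong kills (resp {x} {y} x≋y i) g = ≈ᴹ-trans
      (≈ᴹ-sym (eval-≋ (f-cong ∘ ∙-congˡ) x y x≋y)) (eval-ideal f-cong kills i g)

  infix 4 _∼_
  _∼_ : FormalSum → FormalSum → Set c
  x ∼ y = LeftIdeal⟨ gs ⟩ (x ++ scale -1ℤ y)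

  private
    coeff-++ : ∀ x y z → coefficient (x ++ y) z ≡ coefficient x z + coefficient y z
    coeff-++ = coefficient-++ decSetoid

    coeff-difference : ∀ x y z → coefficient (x ++ scale -1ℤ y) z ≡ coefficient x z - coefficient y z
    coeff-difference x y z = trans (coeff-++ x (scale -1ℤ y) z)
      (cong (λ k → coefficient x z + k) (trans (coefficient-scale decSetoid -1ℤ y z) (ℤ.-1*i≡-i _)))

    -- An integer n acts as left multiplication by the ring element n ε.
    ideal-scale : ∀ n {x} → LeftIdeal⟨ gs ⟩ x → LeftIdeal⟨ gs ⟩ (scale n x)
    ideal-scale n {x} i = resp scalar (mul ((n , ε) ∷ []) i)
      where
      scalar : ((n , ε) ∷ []) ·ʳ x ≋ scale n x
      scalar z = begin
        coefficient (((n , ε) ∷ []) ·ʳ x) z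
          ≡⟨ coefficient-eval decSetoid (((n , ε) ∷ []) ·ʳ x) z ⟩
        eval δ (((n , ε) ∷ []) ·ʳ x)
          ≡⟨ eval-product ℤ-module δ ((n , ε) ∷ []) x ⟩
        n * eval (δ ∘ (ε ∙_)) x + 0ℤ                                 ≡⟨ ℤ.+-identityʳ _ ⟩
        n * eval (δ ∘ (ε ∙_)) x
          ≡⟨ cong (n *_) (eval-cong (λ y → indicator-cong ((ε ∙ y) ≟ z) (y ≟ z)
               (≈-trans (≈-sym (identityˡ y))) (≈-trans (identityˡ y))) x) ⟩
        n * eval δ x                                                 ≡⟨ eval-scale δ n x ⟨
        eval δ (scale n x)
          ≡⟨ coefficient-eval decSetoid (scale n x) z ⟨
        coefficient (scale n x) z                                    ∎
        where
        open ≡-Reasoning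
        open ℤ-Evaluation
        δ : Carrier → ℤ
        δ y = indicator (y ≟ z)

  ≋⇒∼ : ∀ {x y} → x ≋ y → x ∼ y
  ≋⇒∼ {x} {y} x≋y = resp (λ z → sym (trans (coeff-difference x y z)
    (trans (cong (_- coefficient y z) (x≋y z)) (ℤ.+-inverseʳ (coefficient y z))))) zero

  ∼-sym : ∀ {x y} → x ∼ y → y ∼ x
  ∼-sym {x} {y} x∼y = resp (λ z → begin
    coefficient (scale -1ℤ (x ++ scale -1ℤ y)) z
      ≡⟨ coefficient-scale decSetoid -1ℤ (x ++ scale -1ℤ y) z ⟩
    -1ℤ * coefficient (x ++ scale -1ℤ y) z          ≡⟨ cong (-1ℤ *_) (coeff-difference x y z) ⟩
    -1ℤ * (coefficient x z - coefficient y z)       ≡⟨ lemma (coefficient x z) (coefficient y z) ⟩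
    coefficient y z - coefficient x z               ≡⟨ coeff-difference y x z ⟨
    coefficient (y ++ scale -1ℤ x) z                ∎) (ideal-scale -1ℤ x∼y)
    where
    open ≡-Reasoning
    lemma : ∀ m n → -1ℤ * (m - n) ≡ n - m
    lemma = solve-∀

  ∼-trans : ∀ {x y w} → x ∼ y → y ∼ w → x ∼ w
  ∼-trans {x} {y} {w} x∼y y∼w = resp (λ z → begin
    coefficient ((x ++ scale -1ℤ y) ++ (y ++ scale -1ℤ w)) z
      ≡⟨ coeff-++ (x ++ scale -1ℤ y) (y ++ scale -1ℤ w) z ⟩
    coefficient (x ++ scale -1ℤ y) z + coefficient (y ++ scale -1ℤ w) z
      ≡⟨ cong₂ _+_ (coeff-difference x y z) (coeff-difference y w z) ⟩
    (coefficient x z - coefficient y z) + (coefficient y z - coefficient w z)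
      ≡⟨ lemma (coefficient x z) (coefficient y z) (coefficient w z) ⟩
    coefficient x z - coefficient w z
      ≡⟨ coeff-difference x w z ⟨
    coefficient (x ++ scale -1ℤ w) z                                      ∎) (add x∼y y∼w)
    where
    open ≡-Reasoning
    lemma : ∀ k m n → (k - m) + (m - n) ≡ k - n
    lemma = solve-∀

  ++-cong-∼ : ∀ {x x′ y y′} → x ∼ x′ → y ∼ y′ → (x ++ y) ∼ (x′ ++ y′)
  ++-cong-∼ {x} {x′} {y} {y′} i j = resp (λ z → begin
    coefficient ((x ++ scale -1ℤ x′) ++ (y ++ scale -1ℤ y′)) z
      ≡⟨ coeff-++ (x ++ scale -1ℤ x′) (y ++ scale -1ℤ y′) z ⟩
    coefficient (x ++ scale -1ℤ x′) z + coefficient (y ++ scale -1ℤ y′) z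
      ≡⟨ cong₂ _+_ (coeff-difference x x′ z) (coeff-difference y y′ z) ⟩
    (coefficient x z - coefficient x′ z) + (coefficient y z - coefficient y′ z)
      ≡⟨ lemma (coefficient x z) (coefficient x′ z) (coefficient y z) (coefficient y′ z) ⟩
    (coefficient x z + coefficient y z) - (coefficient x′ z + coefficient y′ z)
      ≡⟨ cong₂ _-_ (coeff-++ x y z) (coeff-++ x′ y′ z) ⟨
    coefficient (x ++ y) z - coefficient (x′ ++ y′) z
      ≡⟨ coeff-difference (x ++ y) (x′ ++ y′) z ⟨
    coefficient ((x ++ y) ++ scale -1ℤ (x′ ++ y′)) z                       ∎) (add i j)
    where
    open ≡-Reasoning
    lemma : ∀ k k′ m m′ → (k - k′) + (m - m′) ≡ (k + m) - (k′ + m′)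
    lemma = solve-∀

  scale-cong-∼ : ∀ n {x y} → x ∼ y → scale n x ∼ scale n y
  scale-cong-∼ n {x} {y} x∼y = resp (λ z → begin
    coefficient (scale n (x ++ scale -1ℤ y)) z
      ≡⟨ coefficient-scale decSetoid n (x ++ scale -1ℤ y) z ⟩
    n * coefficient (x ++ scale -1ℤ y) z                   ≡⟨ cong (n *_) (coeff-difference x y z) ⟩
    n * (coefficient x z - coefficient y z)
      ≡⟨ lemma n (coefficient x z) (coefficient y z) ⟩
    n * coefficient x z - n * coefficient y z
      ≡⟨ cong₂ _-_ (coefficient-scale decSetoid n x z) (coefficient-scale decSetoid n y z) ⟨
    coefficient (scale n x) z - coefficient (scale n y) z
      ≡⟨ coeff-difference (scale n x) (scale n y) z ⟨
    coefficient (scale n x ++ scale -1ℤ (scale n y)) z     ∎) (ideal-scale n x∼y)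
    where
    open ≡-Reasoning
    lemma : ∀ n k m → n * (k - m) ≡ n * k - n * m
    lemma = solve-∀

  private
    by-coefficients : ∀ x y → (∀ z → coefficient x z ≡ coefficient y z) → x ∼ y
    by-coefficients x y = ≋⇒∼ {x} {y}

    c-scale : ∀ n x z → coefficient (scale n x) z ≡ n * coefficient x z
    c-scale = coefficient-scale decSetoid

  quotient : LeftModule ℤ.+-*-ring c c
  quotient = record
    { Carrierᴹ = FormalSum
    ; _≈ᴹ_ = _∼_
    ; _+ᴹ_ = _++_
    ; _*ₗ_ = scale
    ; 0ᴹ = []
    ; -ᴹ_ = scale -1ℤ
    ; isLeftModule = record
      { isLeftSemimodule = record
        { +ᴹ-isCommutativeMonoid = record
          { isMonoid = record
            { isSemigroup = record
              { isMagma = record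
                { isEquivalence = record
                  { refl  = λ {x} → by-coefficients x x λ _ → refl
                  ; sym   = λ {x} {y} → ∼-sym {x} {y}
                  ; trans = λ {x} {y} {w} → ∼-trans {x} {y} {w}
                  }
                ; ∙-cong = λ {x} {x′} {y} {y′} → ++-cong-∼ {x} {x′} {y} {y′}
                }
              ; assoc = λ x y w → by-coefficients _ (x ++ (y ++ w)) λ z →
                  cong (λ s → coefficient s z) (++-assoc x y w)
              }
            ; identity = (λ x → by-coefficients x x λ _ → refl)
                       , (λ x → by-coefficients (x ++ []) x λ z →
                           cong (λ s → coefficient s z) (++-identityʳ x))
            }
          ; comm = λ x y → by-coefficients (x ++ y) (y ++ x) λ z →
              trans (coeff-++ x y z) (trans (ℤ.+-comm (coefficient x z) _) (sym (coeff-++ y x z)))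
          }
        ; isPreleftSemimodule = record
          { *ₗ-cong = λ { {n} {_} {x} {y} refl x∼y → scale-cong-∼ n {x} {y} x∼y }
          ; *ₗ-zeroˡ = λ x → by-coefficients (scale 0ℤ x) [] λ z →
              trans (c-scale 0ℤ x z) (ℤ.*-zeroˡ (coefficient x z))
          ; *ₗ-distribʳ = λ x m n → by-coefficients (scale (m + n) x) (scale m x ++ scale n x) λ z →
              trans (c-scale (m + n) x z) (trans (ℤ.*-distribʳ-+ (coefficient x z) m n)
                (sym (trans (coeff-++ (scale m x) (scale n x) z)
                (cong₂ _+_ (c-scale m x z) (c-scale n x z)))))
          ; *ₗ-identityˡ = λ x → by-coefficients (scale 1ℤ x) x λ z → trans (c-scale 1ℤ x z) (ℤ.*-identityˡ _)
          ; *ₗ-assoc = λ m n x → by-coefficients (scale (m * n) x) (scale m (scale n x)) λ z →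
              trans (c-scale (m * n) x z) (trans (ℤ.*-assoc m n _)
                (sym (trans (c-scale m (scale n x) z) (cong (m *_) (c-scale n x z)))))
          ; *ₗ-zeroʳ = λ n → by-coefficients [] [] λ _ → refl
          ; *ₗ-distribˡ = λ n x y → by-coefficients (scale n (x ++ y)) (scale n x ++ scale n y) λ z →
              trans (c-scale n (x ++ y) z) (trans (cong (n *_) (coeff-++ x y z))
                (trans (ℤ.*-distribˡ-+ n (coefficient x z) (coefficient y z))
                (sym (trans (coeff-++ (scale n x) (scale n y) z)
                (cong₂ _+_ (c-scale n x z) (c-scale n y z))))))
          }
        }
      ; -ᴹ‿cong = λ {x} {y} → scale-cong-∼ -1ℤ {x} {y}
      ; -ᴹ‿inverse = (λ x → by-coefficients (scale -1ℤ x ++ x) [] λ z → trans (coeff-++ (scale -1ℤ x) x z)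
                        (trans (cong (_+ coefficient x z) (c-scale -1ℤ x z)) (cancelˡ (coefficient x z))))
                   , (λ x → by-coefficients (x ++ scale -1ℤ x) [] λ z →
                        trans (coeff-difference x x z) (ℤ.+-inverseʳ (coefficient x z)))
      }
    }
    where
    cancelˡ : ∀ k → -1ℤ * k + k ≡ 0ℤ
    cancelˡ = solve-∀

  open Evaluation quotient using (eval)

  -- The universal function into the quotient. Evaluating it at x returns x itself, so its vanishing
  -- at x is membership of x in the ideal.
  monomial : Carrier → FormalSum
  monomial g = (1ℤ , g) ∷ []

  monomial-cong : ∀ {g h} → g ≈ h → monomial g ∼ monomial h
  monomial-cong {g} {h} g≈h = by-coefficients (monomial g) (monomial h) λ z →
    trans (coefficient-eval decSetoid (monomial g) z) (trans (cong (λ k → 1ℤ * k + 0ℤ)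
      (indicator-cong (g ≟ z) (h ≟ z) (≈-trans (≈-sym g≈h)) (≈-trans g≈h)))
    (sym (coefficient-eval decSetoid (monomial h) z)))

  eval-monomials : ∀ x → eval monomial x ≡ x
  eval-monomials []            = refl
  eval-monomials ((n , g) ∷ x) = cong₂ (λ k y → (k , g) ∷ y) (ℤ.*-identityʳ n) (eval-monomials x)

  null⇒ideal : ∀ x → x ∼ [] → LeftIdeal⟨ gs ⟩ x
  null⇒ideal x x∼0 = resp (λ z → cong (λ s → coefficient s z) (++-identityʳ x)) x∼0

  -- Up to a trailing `[]`, the value is the product of g with the generator y.
  monomials-null : ∀ {y} → y ∈ gs → ∀ g → eval (monomial ∘ (g ∙_)) y ∼ []
  monomials-null {y} y∈gs g =
    resp (λ z → cong (λ s → coefficient s z) (same y)) (mul (monomial g) (generator y∈gs))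
    where
    same : ∀ y → monomial g ·ʳ y ≡ eval (monomial ∘ (g ∙_)) y ++ []
    same []            = refl
    same ((n , h) ∷ y) = cong₂ (λ k s → (k , g ∙ h) ∷ s)
      (trans (ℤ.*-identityˡ n) (sym (ℤ.*-identityʳ n))) (same y)

-- L generates the stabilizer of 0 as T does that of ∞. The last two equations say that T and L are,
-- up to reversal by S, two sides of the triangle formed by 1, U and U².
record ModularGenerators {c ℓ} (G : Group c ℓ) : Set (c ⊔ ℓ) where
  open Group G
  field
    S T U L : Carrier
    S²≈ε  : S ∙ S ≈ ε
    T≈U²S : T ≈ (U ∙ U) ∙ S
    L≈US  : L ≈ U ∙ S

-- Ratios of integers under the subtractive Euclidean algorithm.

cross-≤ : ∀ {x y x′ y′} → suc x ℕ.* suc y′ ≡ suc x′ ℕ.* suc y → y ℕ.≤ x → y′ ℕ.≤ x′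
cross-≤ {x} {y} {x′} {y′} e y≤x = ℕ.s≤s⁻¹ (ℕ.*-cancelˡ-≤ (suc x) (begin
  suc x ℕ.* suc y′   ≡⟨ e ⟩
  suc x′ ℕ.* suc y   ≤⟨ ℕ.*-monoʳ-≤ (suc x′) (s≤s y≤x) ⟩
  suc x′ ℕ.* suc x   ≡⟨ ℕ.*-comm (suc x′) (suc x) ⟩
  suc x ℕ.* suc x′   ∎))
  where open ℕ.≤-Reasoning

cross-∸ : ∀ x y x′ y′ → x ℕ.* y′ ≡ x′ ℕ.* y → (x ℕ.∸ y) ℕ.* y′ ≡ (x′ ℕ.∸ y′) ℕ.* y
cross-∸ x y x′ y′ e = begin
  (x ℕ.∸ y) ℕ.* y′            ≡⟨ ℕ.*-distribʳ-∸ y′ x y ⟩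
  x ℕ.* y′ ℕ.∸ y ℕ.* y′       ≡⟨ cong₂ ℕ._∸_ e (ℕ.*-comm y y′) ⟩
  x′ ℕ.* y ℕ.∸ y′ ℕ.* y       ≡⟨ ℕ.*-distribʳ-∸ y x′ y′ ⟨
  (x′ ℕ.∸ y′) ℕ.* y           ∎
  where open ≡-Reasoning

drop-fuelˡ : ∀ {n} x y → suc x ℕ.+ suc y ℕ.≤ suc n → x ℕ.∸ y ℕ.+ suc y ℕ.≤ n
drop-fuelˡ x y bound =
  ℕ.≤-trans (ℕ.+-monoˡ-≤ (suc y) (ℕ.m∸n≤m x y)) (ℕ.s≤s⁻¹ bound)

drop-fuelʳ : ∀ {n} x y → suc x ℕ.+ suc y ℕ.≤ suc n → suc x ℕ.+ (y ℕ.∸ x) ℕ.≤ n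
drop-fuelʳ {n} x y bound = ℕ.≤-trans (ℕ.+-monoʳ-≤ (suc x) (ℕ.m∸n≤m y x))
  (ℕ.s≤s⁻¹ (subst (ℕ._≤ suc n) (ℕ.+-suc (suc x) y) bound))

abs-nonzero : ∀ x y → ¬ (x ≡ 0ℤ × y ≡ 0ℤ) → 0 ℕ.< ∣ x ∣ ℕ.+ ∣ y ∣
abs-nonzero (+ zero)    (+ zero)    nz = contradiction (refl , refl) nz
abs-nonzero (+ zero)    (+ suc y)   nz = ℕ.z<s
abs-nonzero (+ zero)    -[1+ y ]    nz = ℕ.z<s
abs-nonzero (+ suc x)   y           nz = ℕ.z<s
abs-nonzero -[1+ x ]    y           nz = ℕ.z<s

abs-cross : ∀ x y x′ y′ → x * y′ ≡ x′ * y → ∣ x ∣ ℕ.* ∣ y′ ∣ ≡ ∣ x′ ∣ ℕ.* ∣ y ∣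
abs-cross x y x′ y′ e = trans (sym (ℤ.abs-* x y′)) (trans (cong ∣_∣ e) (ℤ.abs-* x′ y))

-- By proportionality (xy)(x′y′) is the square of xy′. A negative xy and a positive x′y′ contradict
-- this; if x′y′ = 0, then xy′ = x′y = 0 with x and y nonzero, which forces x′ = y′ = 0.
sign-agrees : ∀ x y x′ y′ {m n} → ¬ (x′ ≡ 0ℤ × y′ ≡ 0ℤ) → x * y′ ≡ x′ * y →
              x * y ≡ -[1+ m ] → x′ * y′ ≡ + n → ⊥
sign-agrees x y x′ y′ {m} {n} nz e xy x′y′ = absurd n x′y′
  (trans (sym (cong₂ _*_ xy x′y′)) (trans (regroup x y x′ y′) (cong (x * y′ *_) (sym e))))
  where
  regroup : ∀ x y x′ y′ → (x * y) * (x′ * y′) ≡ (x * y′) * (x′ * y)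
  regroup = solve-∀
  square : ∀ z {k} → ¬ -[1+ k ] ≡ z * z
  square (+ zero)  ()
  square (+ suc _) ()
  square -[1+ _ ]  ()
  vanish : x * y′ ≡ 0ℤ → ⊥
  vanish z with ℤ.i*j≡0⇒i≡0∨j≡0 x z | ℤ.i*j≡0⇒i≡0∨j≡0 x′ (trans (sym e) z)
  ... | inj₁ refl | _         = contradiction xy λ ()
  ... | inj₂ _    | inj₂ refl = contradiction (trans (sym xy) (ℤ.*-zeroʳ x)) λ ()
  ... | inj₂ y′≡0 | inj₁ x′≡0 = nz (x′≡0 , y′≡0)
  absurd : ∀ n → x′ * y′ ≡ + n → -[1+ m ] * + n ≡ (x * y′) * (x * y′) → ⊥
  absurd (suc n) _ s = square (x * y′) s
  absurd zero    _ s with ℤ.i*j≡0⇒i≡0∨j≡0 (x * y′) (sym (trans (sym (ℤ.*-zeroʳ -[1+ m ])) s))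
  ... | inj₁ z = vanish z
  ... | inj₂ z = vanish z

-- Chains of Farey edges from ∞ to a rational point.

module Paths {c ℓ} (G : Group c ℓ) (S T L : Group.Carrier G) where
  open Group G using (Carrier; _∙_; ε)

  -- Reading g as a path from g0 to g∞, this is a path from ∞ to x/y.  The smaller of
  -- x ≥ 0 and y ≥ 0 is subtracted from the larger one: T maps (x - y)/y to x/y and fixes ∞,
  -- while L maps x/(y - x) to x/y and ∞ to 1 = T0.  The first argument bounds x + y.
  subtractivePath : ℕ → ℕ → ℕ → List (ℤ × Carrier)
  subtractivePath zero    x       y       = []
  subtractivePath (suc n) x       zero    = []
  subtractivePath (suc n) zero    (suc y) = (-1ℤ , ε) ∷ []
  subtractivePath (suc n) (suc x) (suc y) with y ℕ.≤? x
  ... | yes _ = map (map₂ (T ∙_)) (subtractivePath n (x ℕ.∸ y) (suc y))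
  ... | no  _ = (-1ℤ , T) ∷ map (map₂ (L ∙_)) (subtractivePath n (suc x) (y ℕ.∸ x))

  -- Proportional pairs lie on the same side of 1, so they take the same branch, and they remain
  -- proportional after the subtraction. Any bound that is large enough yields the same list.
  subtractivePath-cong :
    ∀ n x y n′ x′ y′ → x ℕ.+ y ℕ.≤ n → x′ ℕ.+ y′ ℕ.≤ n′ → 0 ℕ.< x ℕ.+ y → 0 ℕ.< x′ ℕ.+ y′ →
    x ℕ.* y′ ≡ x′ ℕ.* y → subtractivePath n x y ≡ subtractivePath n′ x′ y′
  subtractivePath-cong zero x y n′ x′ y′ b b′ nz nz′ e = contradiction b (ℕ.<⇒≱ nz)
  subtractivePath-cong (suc n) x y zero x′ y′ b b′ nz nz′ e = contradiction b′ (ℕ.<⇒≱ nz′)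
  subtractivePath-cong (suc n) x zero (suc n′) x′ zero b b′ nz nz′ e = refl
  subtractivePath-cong (suc n) (suc x) zero (suc n′) x′ (suc y′) b b′ nz nz′ e
    rewrite ℕ.*-zeroʳ x′ = contradiction e λ ()
  subtractivePath-cong (suc n) zero zero (suc n′) x′ (suc y′) b b′ () nz′ e
  subtractivePath-cong (suc n) x (suc y) (suc n′) (suc x′) zero b b′ nz nz′ e
    rewrite ℕ.*-zeroʳ x = contradiction e λ ()
  subtractivePath-cong (suc n) x (suc y) (suc n′) zero zero b b′ nz () e
  subtractivePath-cong (suc n) zero (suc y) (suc n′) zero (suc y′) b b′ nz nz′ e = refl
  subtractivePath-cong (suc n) (suc x) (suc y) (suc n′) (suc x′) (suc y′) b b′ nz nz′ e
    with y ℕ.≤? x | y′ ℕ.≤? x′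
  ... | yes _   | yes _     = cong (map (map₂ (T ∙_))) (subtractivePath-cong n (x ℕ.∸ y) (suc y)
    n′ (x′ ℕ.∸ y′) (suc y′) (drop-fuelˡ x y b) (drop-fuelˡ x′ y′ b′)
    (ℕ.<-≤-trans ℕ.z<s (ℕ.m≤n+m (suc y) _)) (ℕ.<-≤-trans ℕ.z<s (ℕ.m≤n+m (suc y′) _))
    (cross-∸ (suc x) (suc y) (suc x′) (suc y′) e))
  ... | no  _   | no  _     = cong (λ s → (-1ℤ , T) ∷ map (map₂ (L ∙_)) s)
    (subtractivePath-cong n (suc x) (y ℕ.∸ x) n′ (suc x′) (y′ ℕ.∸ x′)
    (drop-fuelʳ x y b) (drop-fuelʳ x′ y′ b′) ℕ.z<s ℕ.z<s (begin
      suc x ℕ.* (y′ ℕ.∸ x′)  ≡⟨ ℕ.*-comm (suc x) _ ⟩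
      (y′ ℕ.∸ x′) ℕ.* suc x  ≡⟨ cross-∸ (suc y) (suc x) (suc y′) (suc x′)
            (trans (ℕ.*-comm (suc y) (suc x′)) (trans (sym e) (ℕ.*-comm (suc x) (suc y′)))) ⟨
      (y ℕ.∸ x) ℕ.* suc x′   ≡⟨ ℕ.*-comm _ (suc x′) ⟩
      suc x′ ℕ.* (y ℕ.∸ x)   ∎))
    where open ≡-Reasoning
  ... | yes y≤x | no  y′≰x′ = contradiction (cross-≤ e y≤x) y′≰x′
  ... | no  y≰x | yes y′≤x′ = contradiction (cross-≤ (sym e) y′≤x′) y≰x

  positivePath : ℕ → ℕ → List (ℤ × Carrier)
  positivePath x y = subtractivePath (x ℕ.+ y) x y

  positivePath-cong : ∀ x y x′ y′ → 0 ℕ.< x ℕ.+ y → 0 ℕ.< x′ ℕ.+ y′ →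
                      x ℕ.* y′ ≡ x′ ℕ.* y → positivePath x y ≡ positivePath x′ y′
  positivePath-cong x y x′ y′ = subtractivePath-cong _ x y _ x′ y′ ℕ.≤-refl ℕ.≤-refl

  -- For x/y < 0 the edge S leads from ∞ to 0, and S carries the chain from ∞ to |y|/|x| to one from
  -- 0 to x/y. Only the sign of the first argument matters; it is given the product xy, which is 0
  -- at both 0 and ∞, so these count as nonnegative.
  signedPath : ℤ → ℤ → ℤ → List (ℤ × Carrier)
  signedPath (+ _)    x y = positivePath (∣ x ∣) (∣ y ∣)
  signedPath -[1+ _ ] x y = (1ℤ , S) ∷ map (map₂ (S ∙_)) (positivePath (∣ y ∣) (∣ x ∣))

  columnPath : ℤ → ℤ → List (ℤ × Carrier)
  columnPath x y = signedPath (x * y) x y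

  path : ℙ¹ℚ → List (ℤ × Carrier)
  path (point x y _) = columnPath x y

  -- The lists themselves coincide, so for every f the value of f on the chain is a function on
  -- ℙ¹(ℚ).
  path-cong : ∀ {p q} → p ≈ᴾ q → path p ≡ path q
  path-cong {point x y nz} {point x′ y′ nz′} (proportional e)
    with x * y in xy | x′ * y′ in x′y′
  ... | + _      | + _      = positivePath-cong (∣ x ∣) (∣ y ∣) (∣ x′ ∣) (∣ y′ ∣)
    (abs-nonzero x y nz) (abs-nonzero x′ y′ nz′) (abs-cross x y x′ y′ e)
  ... | -[1+ _ ] | -[1+ _ ] = cong (λ s → (1ℤ , S) ∷ map (map₂ (S ∙_)) s)
    (positivePath-cong (∣ y ∣) (∣ x ∣) (∣ y′ ∣) (∣ x′ ∣)
      (abs-nonzero y x (nz ∘ λ (p , q) → q , p)) (abs-nonzero y′ x′ (nz′ ∘ λ (p , q) → q , p))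
      (trans (ℕ.*-comm (∣ y ∣) (∣ x′ ∣)) (trans (sym (abs-cross x y x′ y′ e)) (ℕ.*-comm (∣ x ∣) (∣ y′ ∣)))))
  ... | + _      | -[1+ _ ] = contradiction xy (sign-agrees x′ y′ x y nz (sym e) x′y′)
  ... | -[1+ _ ] | + _      = contradiction x′y′ (sign-agrees x y x′ y′ nz′ e xy)

  -- Represents g a b c d says that g is a word in T and L acting like (a b; c d).
  data Represents : Carrier → ℕ → ℕ → ℕ → ℕ → Set c where
    unit  : Represents ε 1 0 0 1
    above : ∀ {g a b c d} → 0 ℕ.< c ℕ.+ d → Represents g a b c d →
            Represents (T ∙ g) (c ℕ.+ a) (d ℕ.+ b) c d
    below : ∀ {g a b c d} → 0 ℕ.< a ℕ.+ b → Represents g a b c d →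
            Represents (L ∙ g) a b (a ℕ.+ c) (b ℕ.+ d)

  represents-rows : ∀ {g a b c d} → Represents g a b c d → 0 ℕ.< a ℕ.+ c × 0 ℕ.< b ℕ.+ d
  represents-rows unit                             = ℕ.z<s , ℕ.z<s
  represents-rows (above {a = a} {b} {c} {d} _ r) =
    let p , q = represents-rows r in
    ℕ.<-≤-trans p (ℕ.+-monoˡ-≤ c (ℕ.m≤n+m a c)) , ℕ.<-≤-trans q (ℕ.+-monoˡ-≤ d (ℕ.m≤n+m b d))
  represents-rows (below {a = a} {b} {c} {d} _ r) =
    let p , q = represents-rows r in
    ℕ.<-≤-trans p (ℕ.+-monoʳ-≤ a (ℕ.m≤n+m c a)) , ℕ.<-≤-trans q (ℕ.+-monoʳ-≤ b (ℕ.m≤n+m d b))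

-- Functions with Manin's relations and their values along chains.

module ManinFunctions
  {c ℓ} {G : Group c ℓ} (X : ModularGenerators G) {m ℓm} (M : LeftModule ℤ.+-*-ring m ℓm)
  where
  open ModularGenerators X
  open Group G using (_≈_; _∙_; ε; ∙-congˡ; ∙-congʳ; assoc; identityʳ; identityˡ)
    renaming (Carrier to |G|; sym to ≈-sym; trans to ≈-trans)
  open Paths G S T L
  open LeftModule M
  open Evaluation M
  open import Relation.Binary.Reasoning.Setoid ≈ᴹ-setoid

  record IsManin (f : |G| → Carrierᴹ) : Set (c ⊔ ℓ ⊔ ℓm) where
    field
      respects : ∀ {g h} → g ≈ h → f g ≈ᴹ f h
      S-rel    : ∀ g → f g +ᴹ f (g ∙ S) ≈ᴹ 0ᴹ
      U-rel    : ∀ g → f g +ᴹ f (g ∙ U) +ᴹ f (g ∙ (U ∙ U)) ≈ᴹ 0ᴹ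

  open IsManin

  translate : ∀ h {f} → IsManin f → IsManin (f ∘ (h ∙_))
  translate h F = record
    { respects = λ e → respects F (∙-congˡ e)
    ; S-rel    = λ g → ≈ᴹ-trans (+ᴹ-congˡ (respects F (≈-sym (assoc h g S)))) (S-rel F (h ∙ g))
    ; U-rel    = λ g → ≈ᴹ-trans (+ᴹ-cong (+ᴹ-congˡ (respects F (≈-sym (assoc h g U))))
                                         (respects F (≈-sym (assoc h g (U ∙ U))))) (U-rel F (h ∙ g))
    }

  module _ {f : |G| → Carrierᴹ} (F : IsManin f) where

    -- The edge from g0 to g∞ is split at g1: gL leads from g0 to g1 and gT from g1 to g∞. By the
    -- S-relation these are the reversed edges gU and gU² of the triangle relation.
    mediant : ∀ g → f g ≈ᴹ f (g ∙ T) +ᴹ f (g ∙ L)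
    mediant g = combine (f g ∷ f (g ∙ T) ∷ f (g ∙ L) ∷ f (g ∙ U) ∷ f (g ∙ (U ∙ U)) ∷ [])
      (var 0F) (var 1F ⊕ var 2F)
      ((var 0F ⊕ var 3F ⊕ var 4F) ⊕ ⊝ (var 3F ⊕ var 2F) ⊕ ⊝ (var 4F ⊕ var 1F))
      (begin
        _                  ≈⟨ +ᴹ-cong (+ᴹ-cong (U-rel F g) (-ᴹ‿cong L-rel)) (-ᴹ‿cong T-rel) ⟩
        0ᴹ +ᴹ -ᴹ 0ᴹ +ᴹ -ᴹ 0ᴹ ≈⟨ +ᴹ-cong (-ᴹ‿inverseʳ 0ᴹ) ≈ᴹ-refl ⟩
        0ᴹ +ᴹ -ᴹ 0ᴹ          ≈⟨ -ᴹ‿inverseʳ 0ᴹ ⟩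
        0ᴹ                 ∎)
      where
      L-rel : f (g ∙ U) +ᴹ f (g ∙ L) ≈ᴹ 0ᴹ
      L-rel = ≈ᴹ-trans (+ᴹ-congˡ (respects F (≈-trans (∙-congˡ L≈US) (≈-sym (assoc g U S)))))
                       (S-rel F (g ∙ U))
      T-rel : f (g ∙ (U ∙ U)) +ᴹ f (g ∙ T) ≈ᴹ 0ᴹ
      T-rel = ≈ᴹ-trans (+ᴹ-congˡ (respects F (≈-trans (∙-congˡ T≈U²S) (≈-sym (assoc g (U ∙ U) S)))))
                       (S-rel F (g ∙ (U ∙ U)))

  -0≈0 : -ᴹ 0ᴹ ≈ᴹ 0ᴹ
  -0≈0 = ≈ᴹ-trans (≈ᴹ-sym (+ᴹ-identityˡ _)) (-ᴹ‿inverseʳ 0ᴹ)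

  along : (|G| → Carrierᴹ) → ℕ → ℕ → Carrierᴹ
  along f x y = eval f (positivePath x y)

  along-0/y : ∀ f y → along f 0 (suc y) ≈ᴹ -ᴹ f ε
  along-0/y f y = ≈ᴹ-trans (+ᴹ-identityʳ _) (-1*ₗ {n = 0} (f ε))

  along-x/0 : ∀ f x → along f x 0 ≈ᴹ 0ᴹ
  along-x/0 f zero    = ≈ᴹ-refl
  along-x/0 f (suc x) = ≈ᴹ-refl

  -- T maps x/y to (y + x)/y and fixes ∞. For y > 0 this is the step of the algorithm itself; for y
  -- = 0 both chains are empty.
  along-T : ∀ f x y → 0 ℕ.< x ℕ.+ y → along f (y ℕ.+ x) y ≈ᴹ along (f ∘ (T ∙_)) x y
  along-T f x zero    _ = ≈ᴹ-trans (along-x/0 f x) (≈ᴹ-sym (along-x/0 (f ∘ (T ∙_)) x))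
  along-T f x (suc y) _ with y ℕ.≤? y ℕ.+ x
  ... | no  y≰y+x = contradiction (ℕ.m≤m+n y x) y≰y+x
  ... | yes _     = ≈ᴹ-reflexive (trans
    (eval-map f (T ∙_) (subtractivePath (y ℕ.+ x ℕ.+ suc y) (y ℕ.+ x ℕ.∸ y) (suc y)))
    (cong (eval (f ∘ (T ∙_))) (subtractivePath-cong _ _ (suc y) _ x (suc y)
      (ℕ.+-monoˡ-≤ (suc y) (ℕ.m∸n≤m (y ℕ.+ x) y)) ℕ.≤-refl (nonzero (y ℕ.+ x ℕ.∸ y)) (nonzero x)
      (cong (ℕ._* suc y) (ℕ.m+n∸m≡n y x)))))
    where
    nonzero : ∀ k → 0 ℕ.< k ℕ.+ suc y
    nonzero k = ℕ.<-≤-trans ℕ.z<s (ℕ.m≤n+m (suc y) k)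

  -- L maps x/y to x/(x + y) and ∞ to 1, which -T reaches from ∞. The algorithm makes this step only
  -- if x and y are both positive. At x = 0 it stops with -ε, and the mediant relation replaces ε by
  -- T and L.
  along-L : ∀ {f} → IsManin f → ∀ x y → 0 ℕ.< x ℕ.+ y →
             along f x (x ℕ.+ y) ≈ᴹ -ᴹ f T +ᴹ along (f ∘ (L ∙_)) x y
  along-L {f} F zero (suc y) _ = begin
    along f 0 (suc y)                              ≈⟨ along-0/y f y ⟩
    -ᴹ f ε                                         ≈⟨ -ᴹ‿cong (mediant F ε) ⟩
    -ᴹ (f (ε ∙ T) +ᴹ f (ε ∙ L))
      ≈⟨ -ᴹ‿cong (+ᴹ-cong (respects F (identityˡ T))
                          (respects F (≈-trans (identityˡ L) (≈-sym (identityʳ L))))) ⟩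
    -ᴹ (f T +ᴹ f (L ∙ ε))
      ≈⟨ rearrange (f T ∷ f (L ∙ ε) ∷ []) (⊝ (var 0F ⊕ var 1F)) (⊝ var 0F ⊕ ⊝ var 1F) ⟩
    -ᴹ f T +ᴹ -ᴹ f (L ∙ ε)                        ≈⟨ +ᴹ-congˡ (along-0/y (f ∘ (L ∙_)) y) ⟨
    -ᴹ f T +ᴹ along (f ∘ (L ∙_)) 0 (suc y)        ∎
  along-L {f} F (suc x) y _ with x ℕ.+ y ℕ.≤? x
  -- Here y = 0 and the target is 1. The algorithm takes the T-branch to T0, which leaves -T, while
  -- the remaining L-chain is empty.
  ... | yes x+y≤x = begin
    eval f (map (map₂ (T ∙_)) (subtractivePath n (x ℕ.∸ (x ℕ.+ y)) (suc x ℕ.+ y)))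
      ≡⟨ eval-map f (T ∙_) (subtractivePath n _ _) ⟩
    eval (f ∘ (T ∙_)) (subtractivePath n (x ℕ.∸ (x ℕ.+ y)) (suc x ℕ.+ y))
      ≡⟨ cong (λ z → eval (f ∘ (T ∙_)) (subtractivePath n z (suc x ℕ.+ y))) (ℕ.m≤n⇒m∸n≡0 (ℕ.m≤m+n x y)) ⟩
    eval (f ∘ (T ∙_)) (subtractivePath n 0 (suc x ℕ.+ y))
      ≡⟨ cong (eval (f ∘ (T ∙_)))
           (subtractivePath-cong n 0 (suc x ℕ.+ y) (suc x ℕ.+ y) 0 (suc x ℕ.+ y)
             (ℕ.m≤n+m _ x) ℕ.≤-refl ℕ.z<s ℕ.z<s refl) ⟩
    along (f ∘ (T ∙_)) 0 (suc x ℕ.+ y)             ≈⟨ along-0/y (f ∘ (T ∙_)) (x ℕ.+ y) ⟩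
    -ᴹ f (T ∙ ε)                                   ≈⟨ -ᴹ‿cong (respects F (identityʳ T)) ⟩
    -ᴹ f T                                         ≈⟨ +ᴹ-identityʳ _ ⟨
    -ᴹ f T +ᴹ 0ᴹ                                   ≈⟨ +ᴹ-congˡ (along-x/0 (f ∘ (L ∙_)) (suc x)) ⟨
    -ᴹ f T +ᴹ along (f ∘ (L ∙_)) (suc x) 0
      ≡⟨ cong (λ z → -ᴹ f T +ᴹ along (f ∘ (L ∙_)) (suc x) z) (sym y≡0) ⟩
    -ᴹ f T +ᴹ along (f ∘ (L ∙_)) (suc x) y        ∎
    where
    n = x ℕ.+ (suc x ℕ.+ y)
    y≡0 : y ≡ 0
    y≡0 = ℕ.n≤0⇒n≡0 (ℕ.+-cancelˡ-≤ x y 0 (ℕ.≤-trans x+y≤x (ℕ.m≤m+n x 0)))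
  ... | no _ = +ᴹ-cong (-1*ₗ {n = 0} (f T)) (≈ᴹ-reflexive (trans
    (eval-map f (L ∙_) (subtractivePath (x ℕ.+ suc (x ℕ.+ y)) (suc x) (x ℕ.+ y ℕ.∸ x)))
    (cong (eval (f ∘ (L ∙_))) (subtractivePath-cong _ (suc x) (x ℕ.+ y ℕ.∸ x) _ (suc x) y
      (ℕ.≤-trans (ℕ.+-monoʳ-≤ (suc x) (ℕ.m∸n≤m (x ℕ.+ y) x)) (ℕ.≤-reflexive (sym (ℕ.+-suc x (x ℕ.+ y)))))
      ℕ.≤-refl ℕ.z<s ℕ.z<s
      (cong (suc x ℕ.*_) (sym (ℕ.m+n∸m≡n x y)))))))

  along-cong : ∀ {f g} → (∀ h → f h ≈ᴹ g h) → ∀ x y → along f x y ≈ᴹ along g x y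
  along-cong f≈g x y = eval-cong f≈g (positivePath x y)

  -- The columns of g are g∞ and g0, so the chain to g∞ should be the chain to g0 followed by the
  -- edge g. The induction removes the first letter of the word and replaces f by its left
  -- translate, which satisfies the same relations.
  along-represents : ∀ {f} → IsManin f → ∀ {g a b c d} → Represents g a b c d →
                     along f a c ≈ᴹ f g +ᴹ along f b d
  along-represents {f} F unit = begin
    0ᴹ                   ≈⟨ -ᴹ‿inverseʳ _ ⟨
    f ε +ᴹ -ᴹ f ε        ≈⟨ +ᴹ-congˡ (along-0/y f 0) ⟨
    f ε +ᴹ along f 0 1   ∎
  along-represents {f} F (above {g} {a} {b} {c} {d} _ r) = begin
    along f (c ℕ.+ a) c                         ≈⟨ along-T f a c (proj₁ (represents-rows r)) ⟩
    along (f ∘ (T ∙_)) a c                      ≈⟨ along-represents (translate T F) r ⟩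
    f (T ∙ g) +ᴹ along (f ∘ (T ∙_)) b d
      ≈⟨ +ᴹ-congˡ (along-T f b d (proj₂ (represents-rows r))) ⟨
    f (T ∙ g) +ᴹ along f (d ℕ.+ b) d            ∎
  along-represents {f} F (below {g} {a} {b} {c} {d} _ r) = begin
    along f a (a ℕ.+ c)                           ≈⟨ along-L F a c (proj₁ (represents-rows r)) ⟩
    -ᴹ f T +ᴹ along f∘L a c                       ≈⟨ +ᴹ-congˡ (along-represents (translate L F) r) ⟩
    -ᴹ f T +ᴹ (f (L ∙ g) +ᴹ along f∘L b d)
      ≈⟨ rearrange (f T ∷ f (L ∙ g) ∷ along f∘L b d ∷ [])
           (⊝ var 0F ⊕ (var 1F ⊕ var 2F)) (var 1F ⊕ (⊝ var 0F ⊕ var 2F)) ⟩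
    f (L ∙ g) +ᴹ (-ᴹ f T +ᴹ along f∘L b d)
      ≈⟨ +ᴹ-congˡ (along-L F b d (proj₂ (represents-rows r))) ⟨
    f (L ∙ g) +ᴹ along f b (b ℕ.+ d)              ∎
    where
    f∘L = f ∘ (L ∙_)

  alongᶻ : (|G| → Carrierᴹ) → ℤ → ℤ → Carrierᴹ
  alongᶻ f x y = eval f (columnPath x y)

  columnPath-same : ∀ x y {n} → x * y ≡ + n → columnPath x y ≡ positivePath (∣ x ∣) (∣ y ∣)
  columnPath-same x y xy = cong (λ z → signedPath z x y) xy

  columnPath-opposite : ∀ x y {n} → x * y ≡ -[1+ n ] →
                        columnPath x y ≡ (1ℤ , S) ∷ map (map₂ (S ∙_)) (positivePath (∣ y ∣) (∣ x ∣))
  columnPath-opposite x y xy = cong (λ z → signedPath z x y) xy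

  neg-neg : ∀ x y → - x * - y ≡ x * y
  neg-neg = solve-∀

  alongᶻ-neg : ∀ f x y → alongᶻ f (- x) (- y) ≡ alongᶻ f x y
  alongᶻ-neg f x y with x * y in xy
  ... | + n      = cong (eval f) (trans (columnPath-same (- x) (- y) (trans (neg-neg x y) xy))
    (cong₂ positivePath (ℤ.∣-i∣≡∣i∣ x) (ℤ.∣-i∣≡∣i∣ y)))
  ... | -[1+ n ] = cong (eval f) (trans (columnPath-opposite (- x) (- y) (trans (neg-neg x y) xy))
    (cong₂ (λ m n → (1ℤ , S) ∷ map (map₂ (S ∙_)) (positivePath n m)) (ℤ.∣-i∣≡∣i∣ x) (ℤ.∣-i∣≡∣i∣ y)))

  along-opposite : ∀ {f} → IsManin f → ∀ x y {n} → x * y ≡ -[1+ n ] →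
                   alongᶻ f x y ≈ᴹ f S +ᴹ along (f ∘ (S ∙_)) (∣ y ∣) (∣ x ∣)
  along-opposite {f} F x y xy = begin
    alongᶻ f x y
      ≡⟨ cong (eval f) (columnPath-opposite x y xy) ⟩
    1ℤ *ₗ f S +ᴹ eval f (map (map₂ (S ∙_)) (positivePath (∣ y ∣) (∣ x ∣)))
      ≈⟨ +ᴹ-cong (*ₗ-identityˡ _) (≈ᴹ-reflexive (eval-map f (S ∙_) (positivePath (∣ y ∣) (∣ x ∣)))) ⟩
    f S +ᴹ along (f ∘ (S ∙_)) (∣ y ∣) (∣ x ∣)
      ∎

  -- S exchanges the two signs, but `signedPath` is built asymmetrically. For xy < 0 the claim is
  -- its definition; for xy = 0 the points 0 and ∞ are compared directly, and 0/0 has to be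
  -- excluded; for xy > 0 the definition applies to -y/x.
  alongᶻ-S : ∀ {f} → IsManin f → ∀ x y → ¬ (x ≡ 0ℤ × y ≡ 0ℤ) →
             alongᶻ f x y ≈ᴹ f S +ᴹ alongᶻ (f ∘ (S ∙_)) (- y) x
  alongᶻ-S {f} F x y nz = go (x * y) refl
    where
    f∘S = f ∘ (S ∙_)
    S∙S : ∀ g → S ∙ (S ∙ g) ≈ g
    S∙S g = ≈-trans (≈-sym (assoc S S g)) (≈-trans (∙-congʳ S²≈ε) (identityˡ g))
    S+ε : f S +ᴹ f ε ≈ᴹ 0ᴹ
    S+ε = ≈ᴹ-trans (+ᴹ-comm _ _) (≈ᴹ-trans (+ᴹ-congˡ (respects F (≈-sym (identityˡ S)))) (S-rel F ε))
    rotate : ∀ x y → - y * x ≡ - (x * y)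
    rotate = solve-∀
    zero-case : ∀ x y → ¬ (x ≡ 0ℤ × y ≡ 0ℤ) → x ≡ 0ℤ ⊎ y ≡ 0ℤ →
                along f (∣ x ∣) (∣ y ∣) ≈ᴹ f S +ᴹ along f∘S (∣ y ∣) (∣ x ∣)
    zero-case x y nz (inj₁ refl) with ∣ y ∣ in ∣y∣
    ... | zero  = contradiction (refl , ℤ.∣i∣≡0⇒i≡0 ∣y∣) nz
    ... | suc k = begin
      along f 0 (suc k)            ≈⟨ along-0/y f k ⟩
      -ᴹ f ε
        ≈⟨ combine (f S ∷ f ε ∷ []) (⊝ var 1F) (var 0F) (⊝ (var 0F ⊕ var 1F))
                                        (≈ᴹ-trans (-ᴹ‿cong S+ε) -0≈0) ⟩
      f S                          ≈⟨ +ᴹ-identityʳ _ ⟨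
      f S +ᴹ along f∘S (suc k) 0   ∎
    zero-case x y nz (inj₂ refl) with ∣ x ∣ in ∣x∣
    ... | zero  = contradiction (ℤ.∣i∣≡0⇒i≡0 ∣x∣ , refl) nz
    ... | suc k = begin
      0ᴹ                           ≈⟨ -ᴹ‿inverseʳ _ ⟨
      f S +ᴹ -ᴹ f S                ≈⟨ +ᴹ-congˡ (-ᴹ‿cong (respects F (identityʳ S))) ⟨
      f S +ᴹ -ᴹ f (S ∙ ε)          ≈⟨ +ᴹ-congˡ (along-0/y f∘S k) ⟨
      f S +ᴹ along f∘S 0 (suc k)   ∎
    go : ∀ z → x * y ≡ z → alongᶻ f x y ≈ᴹ f S +ᴹ alongᶻ f∘S (- y) x
    go -[1+ n ] xy = begin
      alongᶻ f x y                        ≈⟨ along-opposite F x y xy ⟩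
      f S +ᴹ along f∘S (∣ y ∣) (∣ x ∣)
        ≡⟨ cong (λ k → f S +ᴹ along f∘S k (∣ x ∣)) (ℤ.∣-i∣≡∣i∣ y) ⟨
      f S +ᴹ along f∘S (∣ - y ∣) (∣ x ∣)
        ≡⟨ cong (λ s → f S +ᴹ eval f∘S s) (columnPath-same (- y) x (trans (rotate x y) (cong -_ xy))) ⟨
      f S +ᴹ alongᶻ f∘S (- y) x           ∎
    go (+ zero)  xy = begin
      alongᶻ f x y                        ≡⟨ cong (eval f) (columnPath-same x y xy) ⟩
      along f (∣ x ∣) (∣ y ∣)             ≈⟨ zero-case x y nz (ℤ.i*j≡0⇒i≡0∨j≡0 x xy) ⟩
      f S +ᴹ along f∘S (∣ y ∣) (∣ x ∣)
        ≡⟨ cong (λ k → f S +ᴹ along f∘S k (∣ x ∣)) (ℤ.∣-i∣≡∣i∣ y) ⟨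
      f S +ᴹ along f∘S (∣ - y ∣) (∣ x ∣)
        ≡⟨ cong (λ s → f S +ᴹ eval f∘S s) (columnPath-same (- y) x (trans (rotate x y) (cong -_ xy))) ⟨
      f S +ᴹ alongᶻ f∘S (- y) x           ∎
    -- Applying the definition at -y/x adds a second S, so S² = ε restores the original chain, and
    -- the two extra edges S and S² cancel.
    go (+ suc n) xy = begin
      alongᶻ f x y
        ≡⟨ cong (eval f) (columnPath-same x y xy) ⟩
      along f (∣ x ∣) (∣ y ∣)
        ≈⟨ along-cong (λ g → respects F (≈-sym (S∙S g))) (∣ x ∣) (∣ y ∣) ⟩
      along (f∘S ∘ (S ∙_)) (∣ x ∣) (∣ y ∣)
        ≡⟨ cong (along (f∘S ∘ (S ∙_)) (∣ x ∣)) (ℤ.∣-i∣≡∣i∣ y) ⟨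
      rest
        ≈⟨ combine (f S ∷ f ε ∷ rest ∷ []) (var 2F) (var 0F ⊕ (var 1F ⊕ var 2F))
             (⊝ (var 0F ⊕ var 1F)) (≈ᴹ-trans (-ᴹ‿cong S+ε) -0≈0) ⟩
      f S +ᴹ (f ε +ᴹ rest)
        ≈⟨ +ᴹ-congˡ (+ᴹ-congʳ (respects F S²≈ε)) ⟨
      f S +ᴹ (f (S ∙ S) +ᴹ rest)
        ≈⟨ +ᴹ-congˡ (along-opposite (translate S F) (- y) x (trans (rotate x y) (cong -_ xy))) ⟨
      f S +ᴹ alongᶻ f∘S (- y) x                              ∎
      where rest = along (f∘S ∘ (S ∙_)) (∣ x ∣) (∣ - y ∣)

  -- The identity F(g∞) = f(g) + F(g0), written for the columns (a, c) and (b, d) separately from g,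
  -- so that entries and group element can be changed independently.
  Edge : (|G| → Carrierᴹ) → |G| → ℤ → ℤ → ℤ → ℤ → Set ℓm
  Edge f g a b c d = alongᶻ f a c ≈ᴹ f g +ᴹ alongᶻ f b d

  module _ {f : |G| → Carrierᴹ} (F : IsManin f) where

    edge-represents : ∀ {g a b c d} → Represents g a b c d → Edge f g (+ a) (+ b) (+ c) (+ d)
    edge-represents {g} {a} {b} {c} {d} r = begin
      alongᶻ f (+ a) (+ c)
        ≡⟨ cong (eval f) (columnPath-same (+ a) (+ c) (sym (ℤ.pos-* a c))) ⟩
      along f a c                   ≈⟨ along-represents F r ⟩
      f g +ᴹ along f b d
        ≡⟨ cong (λ s → f g +ᴹ eval f s) (columnPath-same (+ b) (+ d) (sym (ℤ.pos-* b d))) ⟨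
      f g +ᴹ alongᶻ f (+ b) (+ d)   ∎

    edge-neg : ∀ {g} a b c d → Edge f g a b c d → Edge f g (- a) (- b) (- c) (- d)
    edge-neg a b c d e = ≈ᴹ-trans (≈ᴹ-reflexive (alongᶻ-neg f a c))
      (≈ᴹ-trans e (+ᴹ-congˡ (≈ᴹ-reflexive (sym (alongᶻ-neg f b d)))))

    -- Right multiplication by S exchanges the columns up to sign, that is, it reverses the edge.
    edge-right : ∀ {g} a b c d → Edge f (g ∙ S) b (- a) d (- c) → Edge f g a b c d
    edge-right {g} a b c d e = begin
      alongᶻ f a c                    ≡⟨ alongᶻ-neg f a c ⟨
      alongᶻ f (- a) (- c)            ≈⟨ combine (f g ∷ f (g ∙ S) ∷ alongᶻ f (- a) (- c) ∷ [])
                                           (var 2F) (var 0F ⊕ (var 1F ⊕ var 2F)) (⊝ (var 0F ⊕ var 1F))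
                                           (≈ᴹ-trans (-ᴹ‿cong (S-rel F g)) -0≈0) ⟩
      f g +ᴹ (f (g ∙ S) +ᴹ alongᶻ f (- a) (- c)) ≈⟨ +ᴹ-congˡ e ⟨
      f g +ᴹ alongᶻ f b d             ∎

    -- Moving both endpoints by S changes both chains by the same summand f S, which drops out of
    -- the difference.
    edge-left : ∀ {g} a b c d → ¬ (a ≡ 0ℤ × c ≡ 0ℤ) → ¬ (b ≡ 0ℤ × d ≡ 0ℤ) →
                Edge (f ∘ (S ∙_)) (S ∙ g) (- c) (- d) a b → Edge f g a b c d
    edge-left {g} a b c d nz₁ nz₂ e = begin
      alongᶻ f a c                                         ≈⟨ alongᶻ-S F a c nz₁ ⟩
      f S +ᴹ alongᶻ f∘S (- c) a                            ≈⟨ +ᴹ-congˡ e ⟩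
      f S +ᴹ (f∘S (S ∙ g) +ᴹ alongᶻ f∘S (- d) b)
        ≈⟨ +ᴹ-congˡ (+ᴹ-congʳ (respects F S∙S∙g)) ⟩
      f S +ᴹ (f g +ᴹ alongᶻ f∘S (- d) b)
        ≈⟨ rearrange (f S ∷ f g ∷ alongᶻ f∘S (- d) b ∷ [])
             (var 0F ⊕ (var 1F ⊕ var 2F)) (var 1F ⊕ (var 0F ⊕ var 2F)) ⟩
      f g +ᴹ (f S +ᴹ alongᶻ f∘S (- d) b)                   ≈⟨ +ᴹ-congˡ (alongᶻ-S F b d nz₂) ⟨
      f g +ᴹ alongᶻ f b d                                  ∎
      where
      f∘S = f ∘ (S ∙_)
      S∙S∙g : S ∙ (S ∙ g) ≈ g
      S∙S∙g = ≈-trans (≈-sym (assoc S S g)) (≈-trans (∙-congʳ S²≈ε) (identityˡ g))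

    edge-respects : ∀ {g h} a b c d → g ≈ h → Edge f g a b c d → Edge f h a b c d
    edge-respects a b c d g≈h e = ≈ᴹ-trans e (+ᴹ-congʳ (respects F g≈h))

-- The four generators as relations for functions of two group elements.

module PairGenerators (G : Group 0ℓ 0ℓ) (_≟_ : Decidable₂ (Group._≈_ G)) (S U : Group.Carrier G) where
  G² : Group 0ℓ 0ℓ
  G² = DirectProduct.group G G

  module ℤ[G]  = GroupRing G _≟_
  module ℤ[G²] = GroupRing G² (×-decidable _≟_ _≟_)

  _⊗_ : ℤ[G].FormalSum → ℤ[G].FormalSum → ℤ[G²].FormalSum
  _⊗_ = cartesianProductWith λ (m , α) (n , β) → m * n , (α , β)

  open RawRing ℤ[G].groupRing using (1#)
    renaming (_+_ to infixl 6 _⊹_; _*_ to infixl 7 _⊛_)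
  open RawRing ℤ[G²].groupRing using ()
    renaming (_+_ to infixl 6 _⊞_; _*_ to infixl 7 _⊠_; -_ to infix 8 ⊟_)

  s u : ℤ[G].FormalSum
  s = (1ℤ , S) ∷ []
  u = (1ℤ , U) ∷ []

  g₁ g₂ g₃ g₄ : ℤ[G²].FormalSum
  g₁ = (1# ⊹ s) ⊗ (1# ⊹ s)
  g₂ = (s ⊗ s) ⊞ (s ⊗ (u ⊛ s)) ⊞ ((u ⊛ s) ⊗ (u ⊛ s)) ⊞ (1# ⊗ u) ⊞ ⊟ ((u ⊛ u) ⊗ (u ⊛ u))
  g₃ = ((1# ⊹ u ⊹ u ⊛ u) ⊗ 1#) ⊠ ((1# ⊗ 1#) ⊞ (s ⊗ s))
  g₄ = (1# ⊗ (1# ⊹ u ⊹ u ⊛ u)) ⊠ ((1# ⊗ 1#) ⊞ (s ⊗ s))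

  gens : List ℤ[G²].FormalSum
  gens = g₁ ∷ g₂ ∷ g₃ ∷ g₄ ∷ []

module PairRelations {G : Group 0ℓ 0ℓ} (X : ModularGenerators G)
                      (_≟_ : Decidable₂ (Group._≈_ G)) where
  open ModularGenerators X
  open Group G using (Carrier; _≈_; _∙_; ε; ∙-congˡ; ∙-congʳ; assoc; identityʳ; identityˡ)
    renaming (refl to ≈-refl; sym to ≈-sym; trans to ≈-trans)
  open PairGenerators G _≟_ S U public

  module Relations {m ℓm} (M : LeftModule ℤ.+-*-ring m ℓm) where
    open LeftModule M
    open Evaluation M
    open ManinFunctions X M
    open IsManin

    SS : ∀ g → (g ∙ S) ∙ S ≈ g
    SS g = ≈-trans (assoc g S S) (≈-trans (∙-congˡ S²≈ε) (identityʳ g))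

    symmetrized : (Carrier × Carrier → Carrierᴹ) → Carrier → Carrier → Carrierᴹ
    symmetrized φ α β = φ (α , β) +ᴹ φ (α ∙ S , β ∙ S)

    record IsPairManin (φ : Carrier × Carrier → Carrierᴹ) : Set ℓm where
      field
        pair-respects : ∀ {α α′ β β′} → α ≈ α′ → β ≈ β′ → φ (α , β) ≈ᴹ φ (α′ , β′)
        left-manin    : ∀ β → IsManin (λ α → symmetrized φ α β)
        right-manin   : ∀ α → IsManin (symmetrized φ α)
        triangle      : ∀ α β →
          φ (α , β) +ᴹ φ (α ∙ U , β ∙ U) +ᴹ φ (α ∙ (U ∙ U) , β ∙ (U ∙ U)) ≈ᴹ
          symmetrized φ α (β ∙ U) +ᴹ symmetrized φ α β +ᴹ symmetrized φ (α ∙ U) (β ∙ U)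

    Kills : (Carrier × Carrier → Carrierᴹ) → Set ℓm
    Kills φ = ∀ {y} → y ∈ gens → ∀ g → eval (φ ∘ (Group._∙_ G² g)) y ≈ᴹ 0ᴹ

    values₁ : (Carrier × Carrier → Carrierᴹ) → Carrier → Carrier → Vec Carrierᴹ 4
    values₁ φ α β = φ (α , β) ∷ φ (α , β ∙ S) ∷ φ (α ∙ S , β) ∷ φ (α ∙ S , β ∙ S) ∷ []

    -- The last two values do not occur in `g₂`. They are added to both sides to complete the two
    -- symmetrized terms on the right of `triangle` and the sum over 1, U, U² on its left.
    values₂ : (Carrier × Carrier → Carrierᴹ) → Carrier → Carrier → Vec Carrierᴹ 7
    values₂ φ α β = φ (α ∙ S , β ∙ S) ∷ φ (α ∙ S , (β ∙ U) ∙ S) ∷ φ ((α ∙ U) ∙ S , (β ∙ U) ∙ S)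
      ∷ φ (α , β ∙ U)
      ∷ φ (α ∙ (U ∙ U) , β ∙ (U ∙ U)) ∷ φ (α , β) ∷ φ (α ∙ U , β ∙ U) ∷ []

    values₃ : (Carrier × Carrier → Carrierᴹ) → Carrier → Carrier → Vec Carrierᴹ 6
    values₃ φ α β = φ (α , β) ∷ φ (α ∙ S , β ∙ S) ∷ φ (α ∙ U , β) ∷ φ ((α ∙ U) ∙ S , β ∙ S)
      ∷ φ (α ∙ (U ∙ U) , β) ∷ φ ((α ∙ (U ∙ U)) ∙ S , β ∙ S) ∷ []

    values₄ : (Carrier × Carrier → Carrierᴹ) → Carrier → Carrier → Vec Carrierᴹ 6
    values₄ φ α β = φ (α , β) ∷ φ (α ∙ S , β ∙ S) ∷ φ (α , β ∙ U) ∷ φ (α ∙ S , (β ∙ U) ∙ S)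
      ∷ φ (α , β ∙ (U ∙ U)) ∷ φ (α ∙ S , (β ∙ (U ∙ U)) ∙ S) ∷ []

    form₁ : List (ℤ × Fin 4)
    form₁ = (1ℤ , 0F) ∷ (1ℤ , 1F) ∷ (1ℤ , 2F) ∷ (1ℤ , 3F) ∷ []

    form₂ : List (ℤ × Fin 7)
    form₂ = (1ℤ , 0F) ∷ (1ℤ , 1F) ∷ (1ℤ , 2F) ∷ (1ℤ , 3F) ∷ (-1ℤ , 4F) ∷ []

    form₃ : List (ℤ × Fin 6)
    form₃ = (1ℤ , 0F) ∷ (1ℤ , 1F) ∷ (1ℤ , 2F) ∷ (1ℤ , 3F) ∷ (1ℤ , 4F) ∷ (1ℤ , 5F) ∷ []

    module _ {φ : Carrier × Carrier → Carrierᴹ}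
             (φ-cong : ∀ {α α′ β β′} → α ≈ α′ → β ≈ β′ → φ (α , β) ≈ᴹ φ (α′ , β′)) where

      private
        εε : ∀ g → g ∙ (ε ∙ ε) ≈ g
        εε g = ≈-trans (∙-congˡ (identityˡ ε)) (identityʳ g)
        ε∙ : ∀ g k → g ∙ (ε ∙ k) ≈ g ∙ k
        ε∙ g k = ∙-congˡ (identityˡ k)
        ∙ε : ∀ g k → g ∙ (k ∙ ε) ≈ g ∙ k
        ∙ε g k = ∙-congˡ (identityʳ k)
        assoc˘ : ∀ g k l → g ∙ (k ∙ l) ≈ (g ∙ k) ∙ l
        assoc˘ g k l = ≈-sym (assoc g k l)

      translate₁ : ∀ α β → eval (φ ∘ (Group._∙_ G² (α , β))) g₁ ≈ᴹ
        eval (lookup (values₁ φ α β)) form₁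
      translate₁ α β = eval-pointwise (φ ∘ (Group._∙_ G² (α , β))) (lookup (values₁ φ α β)) g₁ form₁
        ( (refl , φ-cong (identityʳ α) (identityʳ β))
        ∷ (refl , φ-cong (identityʳ α) ≈-refl)
        ∷ (refl , φ-cong ≈-refl (identityʳ β))
        ∷ (refl , ≈ᴹ-refl) ∷ [])

      translate₂ : ∀ α β → eval (φ ∘ (Group._∙_ G² (α , β))) g₂ ≈ᴹ
        eval (lookup (values₂ φ α β)) form₂
      translate₂ α β = eval-pointwise (φ ∘ (Group._∙_ G² (α , β))) (lookup (values₂ φ α β)) g₂ form₂
        ( (refl , ≈ᴹ-refl)
        ∷ (refl , φ-cong ≈-refl (assoc˘ β U S))
        ∷ (refl , φ-cong (assoc˘ α U S) (assoc˘ β U S))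
        ∷ (refl , φ-cong (identityʳ α) ≈-refl)
        ∷ (refl , ≈ᴹ-refl) ∷ [])

      translate₃ : ∀ α β → eval (φ ∘ (Group._∙_ G² (α , β))) g₃ ≈ᴹ
        eval (lookup (values₃ φ α β)) form₃
      translate₃ α β = eval-pointwise (φ ∘ (Group._∙_ G² (α , β))) (lookup (values₃ φ α β)) g₃ form₃
        ( (refl , φ-cong (εε α) (εε β))
        ∷ (refl , φ-cong (ε∙ α S) (ε∙ β S))
        ∷ (refl , φ-cong (∙ε α U) (εε β))
        ∷ (refl , φ-cong (assoc˘ α U S) (ε∙ β S))
        ∷ (refl , φ-cong (∙ε α (U ∙ U)) (εε β))
        ∷ (refl , φ-cong (assoc˘ α (U ∙ U) S) (ε∙ β S)) ∷ [])

      translate₄ : ∀ α β → eval (φ ∘ (Group._∙_ G² (α , β))) g₄ ≈ᴹ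
        eval (lookup (values₄ φ α β)) form₃
      translate₄ α β = eval-pointwise (φ ∘ (Group._∙_ G² (α , β))) (lookup (values₄ φ α β)) g₄ form₃
        ( (refl , φ-cong (εε α) (εε β))
        ∷ (refl , φ-cong (ε∙ α S) (ε∙ β S))
        ∷ (refl , φ-cong (εε α) (∙ε β U))
        ∷ (refl , φ-cong (ε∙ α S) (assoc˘ β U S))
        ∷ (refl , φ-cong (εε α) (∙ε β (U ∙ U)))
        ∷ (refl , φ-cong (ε∙ α S) (assoc˘ β (U ∙ U) S)) ∷ [])

      kills⇒pairManin : Kills φ → IsPairManin φ
      kills⇒pairManin kills = record
        { pair-respects = φ-cong
        ; left-manin = λ β → record
          { respects = λ e → +ᴹ-cong (φ-cong e ≈-refl) (φ-cong (∙-congʳ e) ≈-refl)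
          -- The second translation by S gives S² in the first variable. Once it is removed, the
          -- four terms are those of `g₁`; the relation in the other variable uses the same four.
          ; S-rel = λ α → ≈ᴹ-trans (+ᴹ-congˡ (+ᴹ-congˡ (φ-cong (SS α) ≈-refl)))
              (combine (values₁ φ α β)
                ((var 0F ⊕ var 3F) ⊕ (var 2F ⊕ var 1F)) (sum []) (sum form₁)
                (≈ᴹ-trans (≈ᴹ-sym (translate₁ α β)) (kills (here refl) (α , β))))
          ; U-rel = λ α → combine (values₃ φ α β)
              (((var 0F ⊕ var 1F) ⊕ (var 2F ⊕ var 3F)) ⊕ (var 4F ⊕ var 5F)) (sum []) (sum form₃)
              (≈ᴹ-trans (≈ᴹ-sym (translate₃ α β)) (kills (there (there (here refl))) (α , β)))
          }
        ; right-manin = λ α → record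
          { respects = λ e → +ᴹ-cong (φ-cong ≈-refl e) (φ-cong ≈-refl (∙-congʳ e))
          ; S-rel = λ β → ≈ᴹ-trans (+ᴹ-congˡ (+ᴹ-congˡ (φ-cong ≈-refl (SS β))))
              (combine (values₁ φ α β)
                ((var 0F ⊕ var 3F) ⊕ (var 1F ⊕ var 2F)) (sum []) (sum form₁)
                (≈ᴹ-trans (≈ᴹ-sym (translate₁ α β)) (kills (here refl) (α , β))))
          ; U-rel = λ β → combine (values₄ φ α β)
              (((var 0F ⊕ var 1F) ⊕ (var 2F ⊕ var 3F)) ⊕ (var 4F ⊕ var 5F)) (sum []) (sum form₃)
              (≈ᴹ-trans (≈ᴹ-sym (translate₄ α β)) (kills (there (there (there (here refl)))) (α , β)))
          }
        ; triangle = λ α β → ≈ᴹ-sym (combine (values₂ φ α β)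
            (((var 3F ⊕ var 1F) ⊕ (var 5F ⊕ var 0F)) ⊕ (var 6F ⊕ var 2F))
            ((var 5F ⊕ var 6F) ⊕ var 4F) (sum form₂)
            (≈ᴹ-trans (≈ᴹ-sym (translate₂ α β)) (kills (there (here refl)) (α , β))))
        }

    pairManin⇒kills : ∀ {φ} → IsPairManin φ → Kills φ
    pairManin⇒kills {φ} Φ = kills
      where
      open IsPairManin Φ
      open import Relation.Binary.Reasoning.Setoid ≈ᴹ-setoid
      kills : Kills φ
      kills (here refl) (α , β) = ≈ᴹ-trans (translate₁ pair-respects α β)
        (combine (values₁ φ α β) (sum form₁) (sum []) ((var 0F ⊕ var 3F) ⊕ (var 2F ⊕ var 1F))
          (≈ᴹ-trans (+ᴹ-congˡ (+ᴹ-congˡ (pair-respects (≈-sym (SS α)) ≈-refl))) (S-rel (left-manin β) α)))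
      kills (there (here refl)) (α , β) = ≈ᴹ-trans (translate₂ pair-respects α β)
        (combine (values₂ φ α β) (sum form₂) (sum [])
          ((((var 3F ⊕ var 1F) ⊕ (var 5F ⊕ var 0F)) ⊕ (var 6F ⊕ var 2F)) ⊕ ⊝ ((var 5F ⊕ var 6F) ⊕ var 4F))
          (≈ᴹ-trans (+ᴹ-congʳ (≈ᴹ-sym (triangle α β))) (-ᴹ‿inverseʳ _)))
      kills (there (there (here refl))) (α , β) = ≈ᴹ-trans (translate₃ pair-respects α β)
        (combine (values₃ φ α β) (sum form₃) (sum [])
          (((var 0F ⊕ var 1F) ⊕ (var 2F ⊕ var 3F)) ⊕ (var 4F ⊕ var 5F))
          (U-rel (left-manin β) α))
      kills (there (there (there (here refl)))) (α , β) = ≈ᴹ-trans (translate₄ pair-respects α β)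
        (combine (values₄ φ α β) (sum form₃) (sum [])
          (((var 0F ⊕ var 1F) ⊕ (var 2F ⊕ var 3F)) ⊕ (var 4F ⊕ var 5F))
          (U-rel (right-manin α) β))

-- The intersection theorem over an abstract modular action.

pullback : ∀ {a ℓ b} {B : Set b} (X : DecSetoid a ℓ) → (B → DecSetoid.Carrier X) → DecSetoid b ℓ
pullback X f = record
  { _≈_ = _≈_ on f
  ; isDecEquivalence = record
    { isEquivalence = record { refl = X.refl ; sym = X.sym ; trans = X.trans }
    ; _≟_ = λ x y → f x X.≟ f y
    }
  }
  where
  module X = DecSetoid X
  open X using (_≈_)

eval-indicator : ∀ {b p} {B : Set b} {P : Pred B p} (P? : Decidable P) (f : B → ℤ) s →
                 ℤ-Evaluation.eval f (filter (P? ∘ proj₂) s) ≡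
                 ℤ-Evaluation.eval (λ b → indicator (P? b) * f b) s
eval-indicator P? f []            = refl
eval-indicator P? f ((n , b) ∷ s) with P? b
... | yes _ = cong₂ _+_ (cong (n *_) (sym (ℤ.*-identityˡ (f b)))) (eval-indicator P? f s)
... | no  _ = trans (eval-indicator P? f s) (trans (sym (ℤ.+-identityˡ _)) (cong (_+ _) (sym (ℤ.*-zeroʳ n))))

-- The action enters through the triangle with vertices ∞, 0 and U0, around which U turns, and
-- through Manin's theorem in the form `path-edge`: evaluation along `path` is a primitive of every
-- Manin function.
record ModularAction {G : Group 0ℓ 0ℓ} (X : ModularGenerators G) (P : DecSetoid 0ℓ 0ℓ) : Set₁ where
  open ModularGenerators X
  open Group G
  open DecSetoid P using () renaming (Carrier to Point; _≈_ to _~_)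
  infixr 7 _•_
  field
    _•_     : Carrier → Point → Point
    •-congʳ : ∀ {g h} p → g ≈ h → g • p ~ h • p
    ∞ 𝟎     : Point
    S∞      : ∀ g → (g ∙ S) • ∞ ~ g • 𝟎
    S𝟎      : ∀ g → (g ∙ S) • 𝟎 ~ g • ∞
    U∞      : ∀ g → (g ∙ U) • ∞ ~ g • 𝟎
    UU∞     : ∀ g → (g ∙ (U ∙ U)) • ∞ ~ (g ∙ U) • 𝟎
    UU𝟎     : ∀ g → (g ∙ (U ∙ U)) • 𝟎 ~ g • ∞
    path      : Point → List (ℤ × Carrier)
    path-cong : ∀ {p q} → p ~ q → path p ≡ path q
    path-edge : ∀ (M : LeftModule ℤ.+-*-ring 0ℓ 0ℓ) (let open LeftModule M; open Evaluation M)
                {f} → ManinFunctions.IsManin X M f →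
                ∀ g → eval f (path (g • ∞)) ≈ᴹ f g +ᴹ eval f (path (g • 𝟎))

-- Carrying the list of generators as a variable with an equation makes the conclusions speak of the
-- ideal in the theorem, while the proofs compute with `gens`.
module Intersection {G : Group 0ℓ 0ℓ} {X : ModularGenerators G} {P : DecSetoid 0ℓ 0ℓ}
                    (A : ModularAction X P) (_≟_ : Decidable₂ (Group._≈_ G))
                    {gs : List (List (ℤ × Group.Carrier G × Group.Carrier G))}
                    (gs≡gens : gs ≡ PairGenerators.gens G _≟_ (ModularGenerators.S X) (ModularGenerators.U X))
                    where
  open ModularGenerators X
  open ModularAction A
  open Group G
    using (Carrier; _≈_; _∙_; ε; _⁻¹; ∙-cong; ∙-congˡ; ∙-congʳ; ⁻¹-cong; assoc; identityˡ)
    renaming (refl to ≈-refl; sym to ≈-sym; trans to ≈-trans)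
  module P = DecSetoid P
  open P using () renaming (Carrier to Point; _≈_ to _~_)
  open PairRelations X _≟_
  open QuotientByLeftIdeal G² (×-decidable _≟_ _≟_) gs
  open LeftIdeals ℤ[G²].groupRing
  open FreeAbelian P using (sumOver)
    renaming (FormalSum to Divisor; _≋_ to _≋ᴾ_; coefficient to coefficientᴾ)

  ∂ : Carrier → Divisor
  ∂ γ = (1ℤ , γ • ∞) ∷ (-1ℤ , γ • 𝟎) ∷ []

  module Boundary (M : LeftModule ℤ.+-*-ring 0ℓ 0ℓ) where
    open LeftModule M
    open Evaluation M
    open ManinFunctions X M
    open IsManin
    open import Relation.Binary.Reasoning.Setoid ≈ᴹ-setoid

    boundary : (Point → Carrierᴹ) → Carrier → Carrierᴹ
    boundary F g = F (g • ∞) +ᴹ -ᴹ F (g • 𝟎)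

    eval-∂ : ∀ F g → eval F (∂ g) ≈ᴹ boundary F g
    eval-∂ F g = +ᴹ-cong (*ₗ-identityˡ _) (≈ᴹ-trans (+ᴹ-identityʳ _) (-1*ₗ {n = 0} _))

    -- Both sums telescope: S reverses an edge, and U leads once around its triangle.
    boundary-manin : ∀ {F} → (∀ {p q} → p ~ q → F p ≈ᴹ F q) → IsManin (boundary F)
    boundary-manin {F} F-cong = record
      { respects = λ e → +ᴹ-cong (F-cong (•-congʳ ∞ e)) (-ᴹ‿cong (F-cong (•-congʳ 𝟎 e)))
      ; S-rel = λ g → begin
          boundary F g +ᴹ boundary F (g ∙ S)
            ≈⟨ +ᴹ-congˡ (+ᴹ-cong (F-cong (S∞ g)) (-ᴹ‿cong (F-cong (S𝟎 g)))) ⟩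
          boundary F g +ᴹ (F (g • 𝟎) +ᴹ -ᴹ F (g • ∞))
            ≈⟨ rearrange (F (g • ∞) ∷ F (g • 𝟎) ∷ []) ((var 0F ⊕ ⊝ var 1F) ⊕ (var 1F ⊕ ⊝ var 0F)) (sum []) ⟩
          0ᴹ ∎
      ; U-rel = λ g → begin
          boundary F g +ᴹ boundary F (g ∙ U) +ᴹ boundary F (g ∙ (U ∙ U))
            ≈⟨ +ᴹ-cong (+ᴹ-congˡ (+ᴹ-congʳ (F-cong (U∞ g))))
                       (+ᴹ-cong (F-cong (UU∞ g)) (-ᴹ‿cong (F-cong (UU𝟎 g)))) ⟩
          boundary F g +ᴹ (F (g • 𝟎) +ᴹ -ᴹ F ((g ∙ U) • 𝟎)) +ᴹ (F ((g ∙ U) • 𝟎) +ᴹ -ᴹ F (g • ∞))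
            ≈⟨ rearrange (F (g • ∞) ∷ F (g • 𝟎) ∷ F ((g ∙ U) • 𝟎) ∷ [])
                 ((var 0F ⊕ ⊝ var 1F) ⊕ (var 1F ⊕ ⊝ var 2F) ⊕ (var 2F ⊕ ⊝ var 0F)) (sum []) ⟩
          0ᴹ ∎
      }

    manin-boundary : ∀ {f} → IsManin f → ∀ g → boundary (eval f ∘ path) g ≈ᴹ f g
    manin-boundary {f} F g = combine
      (eval f (path (g • ∞)) ∷ eval f (path (g • 𝟎)) ∷ f g ∷ [])
      (var 0F ⊕ ⊝ var 1F) (var 2F) (var 0F ⊕ ⊝ (var 2F ⊕ var 1F))
      (≈ᴹ-trans (+ᴹ-congʳ (path-edge M F g)) (-ᴹ‿inverseʳ _))

    -- Manin's theorem: the relations in IsManin generate all relations between modular symbols.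
    manin-null : ∀ {b p} {B : Set b} {Q : Pred B p} (Q? : Decidable Q) {f} → IsManin f →
                 ∀ (π : B → Carrier) x →
                 sumOver Q? (∂ ∘ π) x ≋ᴾ [] → eval (f ∘ π) (filter (Q? ∘ proj₂) x) ≈ᴹ 0ᴹ
    manin-null Q? {f} F π x null = begin
      eval (f ∘ π) (filter (Q? ∘ proj₂) x)
        ≈⟨ eval-cong (λ b → ≈ᴹ-trans (≈ᴹ-sym (manin-boundary F (π b)))
                                     (≈ᴹ-sym (eval-∂ (eval f ∘ path) (π b)))) (filter (Q? ∘ proj₂) x) ⟩
      eval (eval (eval f ∘ path) ∘ ∂ ∘ π) (filter (Q? ∘ proj₂) x)
        ≈⟨ eval-sumOver P Q? (eval f ∘ path) (∂ ∘ π) x ⟨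
      eval (eval f ∘ path) (sumOver Q? (∂ ∘ π) x)
        ≈⟨ eval-null P (λ p~q → ≈ᴹ-reflexive (cong (eval f) (path-cong p~q))) (sumOver Q? (∂ ∘ π) x) null ⟩
      0ᴹ ∎

    manin-≈ : ∀ {f g} → (∀ a → f a ≈ᴹ g a) → IsManin f → IsManin g
    manin-≈ f≈g F = record
      { respects = λ {a} {b} e → ≈ᴹ-trans (≈ᴹ-sym (f≈g a)) (≈ᴹ-trans (respects F e) (f≈g b))
      ; S-rel = λ a → ≈ᴹ-trans (≈ᴹ-sym (+ᴹ-cong (f≈g a) (f≈g (a ∙ S)))) (S-rel F a)
      ; U-rel = λ a → ≈ᴹ-trans (≈ᴹ-sym (+ᴹ-cong (+ᴹ-cong (f≈g a) (f≈g (a ∙ U)))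
                                           (f≈g (a ∙ (U ∙ U))))) (U-rel F a)
      }

    manin-*ₗ : ∀ n {f} → IsManin f → IsManin (λ a → n *ₗ f a)
    manin-*ₗ n F = record
      { respects = *ₗ-congˡ ∘ respects F
      ; S-rel = λ a → ≈ᴹ-trans (≈ᴹ-sym (*ₗ-distribˡ n _ _)) (≈ᴹ-trans (*ₗ-congˡ (S-rel F a)) (*ₗ-zeroʳ n))
      ; U-rel = λ a → ≈ᴹ-trans (+ᴹ-congʳ (≈ᴹ-sym (*ₗ-distribˡ n _ _))) (≈ᴹ-trans (≈ᴹ-sym (*ₗ-distribˡ n _ _))
                       (≈ᴹ-trans (*ₗ-congˡ (U-rel F a)) (*ₗ-zeroʳ n)))
      }

    manin-eval : ∀ {b} {B : Set b} {k : Carrier → B → Carrierᴹ} →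
                 (∀ b → IsManin (λ a → k a b)) → ∀ s → IsManin (λ a → eval (k a) s)
    manin-eval {k = k} K s = record
      { respects = λ e → eval-cong (λ b → respects (K b) e) s
      ; S-rel = λ a → ≈ᴹ-trans (≈ᴹ-sym (eval-+ (k a) (k (a ∙ S)) s))
          (≈ᴹ-trans (eval-cong (λ b → S-rel (K b) a) s) (eval-0 s))
      ; U-rel = λ a → ≈ᴹ-trans (+ᴹ-congʳ (≈ᴹ-sym (eval-+ (k a) (k (a ∙ U)) s)))
          (≈ᴹ-trans (≈ᴹ-sym (eval-+ (λ b → k a b +ᴹ k (a ∙ U) b) (k (a ∙ (U ∙ U))) s))
          (≈ᴹ-trans (eval-cong (λ b → U-rel (K b) a) s) (eval-0 s)))
      }

  quot : Carrier × Carrier → Carrier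
  quot (α , β) = β ∙ α ⁻¹

  G-decSetoid : DecSetoid 0ℓ 0ℓ
  G-decSetoid = ℤ[G].decSetoid

  module _ {H : Carrier → Pred Carrier 0ℓ} (H? : ∀ γ → Decidable (H γ))
           (H⇒∞ : ∀ {γ g} → H γ g → g • ∞ ~ γ • ∞) (∞⇒H : ∀ {γ g} → g • ∞ ~ γ • ∞ → H γ g)
           (M : LeftModule ℤ.+-*-ring 0ℓ 0ℓ) {φ : Carrier × Carrier → LeftModule.Carrierᴹ M}
           (Q : Relations.IsPairManin M φ) where
    open LeftModule M
    open Evaluation M
    open ManinFunctions X M
    open IsManin
    open Boundary M
    open Relations M
    open IsPairManin Q
    open import Relation.Binary.Reasoning.Setoid ≈ᴹ-setoid

    private
      h : Carrier → Carrier → Carrierᴹ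
      h = symmetrized φ

      F : Point → Carrier → Carrierᴹ
      F p α = eval (h α) (path p)

      -- For fixed p the value is a fixed integer combination of functions h(·, γ), each of which
      -- satisfies the relations.
      F-manin : ∀ p → IsManin (F p)
      F-manin p = manin-eval left-manin (path p)

      F-cong : ∀ {p q} → p ~ q → ∀ α → F p α ≈ᴹ F q α
      F-cong p~q α = ≈ᴹ-reflexive (cong (eval (h α)) (path-cong p~q))

      h-F : ∀ α β → h α β ≈ᴹ F (β • ∞) α +ᴹ -ᴹ F (β • 𝟎) α
      h-F α β = ≈ᴹ-sym (manin-boundary (right-manin α) β)

      K : Carrier × Carrier → Carrierᴹ
      K (α , β) = F (β • ∞) α

      K-cong : ∀ {α α′ β β′} → α ≈ α′ → β ≈ β′ → K (α , β) ≈ᴹ K (α′ , β′)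
      K-cong {α′ = α′} e e′ = ≈ᴹ-trans (respects (F-manin _) e) (F-cong (•-congʳ ∞ e′) α′)

      q : Carrier × Carrier → Carrierᴹ
      q x = φ x +ᴹ -ᴹ K x

      q-cong : ∀ {α α′ β β′} → α ≈ α′ → β ≈ β′ → q (α , β) ≈ᴹ q (α′ , β′)
      q-cong e e′ = +ᴹ-cong (pair-respects e e′) (-ᴹ‿cong (K-cong e e′))

      -- Subtracting K turns the pair relations into the relations along the diagonal.
      q-S : ∀ α β → q (α , β) +ᴹ q (α ∙ S , β ∙ S) ≈ᴹ 0ᴹ
      q-S α β = combine
        (φ (α , β) ∷ φ (α ∙ S , β ∙ S) ∷ F (β • ∞) α ∷ F (β • 𝟎) α ∷ F ((β ∙ S) • ∞) (α ∙ S) ∷ [])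
        ((var 0F ⊕ ⊝ var 2F) ⊕ (var 1F ⊕ ⊝ var 4F)) (sum [])
        (((var 0F ⊕ var 1F) ⊕ ⊝ (var 2F ⊕ ⊝ var 3F)) ⊕ ⊝ (var 3F ⊕ var 4F))
        (begin
          _                      ≈⟨ +ᴹ-cong (≈ᴹ-trans (+ᴹ-congʳ (h-F α β)) (-ᴹ‿inverseʳ _))
                                     (-ᴹ‿cong (≈ᴹ-trans (+ᴹ-congˡ (F-cong (S∞ β) (α ∙ S)))
                                                          (S-rel (F-manin (β • 𝟎)) α))) ⟩
          0ᴹ +ᴹ -ᴹ 0ᴹ            ≈⟨ -ᴹ‿inverseʳ 0ᴹ ⟩
          0ᴹ                     ∎)

      -- Write 1 for U0. Then h(α, βU) + h(α, β) telescopes to F(β∞)(α) - F(β1)(α), and h(αU, βU) is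
      -- F(β0)(αU) - F(β1)(αU). The U-relation for F(β1) turns the two negative terms into
      -- F(β1)(αU²). As βU∞ = β0 and βU²∞ = β1, the right side of `triangle` is K(α, β) + K(αU, βU)
      -- + K(αU², βU²).
      q-U : ∀ α β → q (α , β) +ᴹ q (α ∙ U , β ∙ U) +ᴹ q (α ∙ (U ∙ U) , β ∙ (U ∙ U)) ≈ᴹ 0ᴹ
      q-U α β = begin
        _ ≈⟨ +ᴹ-cong (+ᴹ-congˡ (+ᴹ-congˡ (-ᴹ‿cong (F-cong (U∞ β) (α ∙ U)))))
                     (+ᴹ-congˡ (-ᴹ‿cong (F-cong (UU∞ β) (α ∙ (U ∙ U))))) ⟩
        _ ≈⟨ combine
          (φ (α , β) ∷ φ (α ∙ U , β ∙ U) ∷ φ (α ∙ (U ∙ U) , β ∙ (U ∙ U))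
            ∷ F (β • ∞) α ∷ F (β • 𝟎) α ∷ F ((β ∙ U) • 𝟎) α ∷ F (β • 𝟎) (α ∙ U) ∷ F ((β ∙ U) • 𝟎) (α ∙ U)
            ∷ F ((β ∙ U) • 𝟎) (α ∙ (U ∙ U)) ∷ [])
          ((var 0F ⊕ ⊝ var 3F) ⊕ (var 1F ⊕ ⊝ var 6F) ⊕ (var 2F ⊕ ⊝ var 8F)) (sum [])
          (((var 0F ⊕ var 1F ⊕ var 2F) ⊕ ⊝ ((var 4F ⊕ ⊝ var 5F) ⊕ (var 3F ⊕ ⊝ var 4F) ⊕ (var 6F ⊕ ⊝ var 7F)))
            ⊕ ⊝ (var 5F ⊕ var 7F ⊕ var 8F))
          (begin
            _
              ≈⟨ +ᴹ-cong (≈ᴹ-trans (+ᴹ-congʳ split) (-ᴹ‿inverseʳ _))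
                         (-ᴹ‿cong (U-rel (F-manin ((β ∙ U) • 𝟎)) α)) ⟩
            0ᴹ +ᴹ -ᴹ 0ᴹ   ≈⟨ -ᴹ‿inverseʳ 0ᴹ ⟩
            0ᴹ            ∎) ⟩
        0ᴹ ∎
        where
        split : φ (α , β) +ᴹ φ (α ∙ U , β ∙ U) +ᴹ φ (α ∙ (U ∙ U) , β ∙ (U ∙ U)) ≈ᴹ
                (F (β • 𝟎) α +ᴹ -ᴹ F ((β ∙ U) • 𝟎) α) +ᴹ (F (β • ∞) α +ᴹ -ᴹ F (β • 𝟎) α)
                +ᴹ (F (β • 𝟎) (α ∙ U) +ᴹ -ᴹ F ((β ∙ U) • 𝟎) (α ∙ U))
        split = ≈ᴹ-trans (triangle α β) (+ᴹ-cong (+ᴹ-cong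
          (≈ᴹ-trans (h-F α (β ∙ U)) (+ᴹ-congʳ (F-cong (U∞ β) α))) (h-F α β))
          (≈ᴹ-trans (h-F (α ∙ U) (β ∙ U)) (+ᴹ-congʳ (F-cong (U∞ β) (α ∙ U)))))

      diagonal-manin : ∀ g → IsManin (λ α → q (α , g ∙ α))
      diagonal-manin g = record
        { respects = λ e → q-cong e (∙-congˡ e)
        ; S-rel = λ α → ≈ᴹ-trans (+ᴹ-congˡ (q-cong ≈-refl (≈-sym (assoc g α S)))) (q-S α (g ∙ α))
        ; U-rel = λ α → ≈ᴹ-trans (+ᴹ-cong (+ᴹ-congˡ (q-cong ≈-refl (≈-sym (assoc g α U))))
                                          (q-cong ≈-refl (≈-sym (assoc g α (U ∙ U))))) (q-U α (g ∙ α))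
        }

    module _ (x : ℤ[G²].FormalSum)
             (x∈I-H : ∀ γ → sumOver (H? γ ∘ proj₂) (∂ ∘ proj₁) x ≋ᴾ [])
             (x∈I-D : ∀ g → sumOver (λ p → quot p ≟ g) (∂ ∘ proj₁) x ≋ᴾ []) where

      -- Among pairs with a common β∞ the function K depends on α alone, through a Manin function;
      -- such pairs form one coset in the definition of I_H.
      K-null : eval K x ≈ᴹ 0ᴹ
      K-null = eval-classes (pullback P λ (α , β) → β • ∞) K x λ (_ , γ) → begin
        eval K (filter (λ t → proj₂ (proj₂ t) • ∞ P.≟ γ • ∞) x)
          ≈⟨ eval-filter-cong (λ (α , β) → β • ∞ P.≟ γ • ∞) (λ (α , β) β~γ → F-cong β~γ α) x ⟩
        eval (F (γ • ∞) ∘ proj₁) (filter (λ t → proj₂ (proj₂ t) • ∞ P.≟ γ • ∞) x)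
          ≡⟨ cong (eval (F (γ • ∞) ∘ proj₁)) (filter-≐ _ (H? γ ∘ proj₂ ∘ proj₂) (∞⇒H , H⇒∞) x) ⟩
        eval (F (γ • ∞) ∘ proj₁) (filter (H? γ ∘ proj₂ ∘ proj₂) x)
          ≈⟨ manin-null (H? γ ∘ proj₂) (F-manin (γ • ∞)) proj₁ x (x∈I-H γ) ⟩
        0ᴹ ∎

      -- On the pairs with βα⁻¹ = g one has β = gα, so q - K there is a Manin function of α.
      q-null : eval q x ≈ᴹ 0ᴹ
      q-null = eval-classes (pullback G-decSetoid quot) q x λ c → begin
        eval q (filter (λ t → quot (proj₂ t) ≟ quot c) x)
          ≈⟨ eval-filter-cong (λ p → quot p ≟ quot c) (λ (α , β) e → q-cong ≈-refl (unquot α β e)) x ⟩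
        eval (λ (α , _) → q (α , quot c ∙ α)) (filter (λ t → quot (proj₂ t) ≟ quot c) x)
          ≈⟨ manin-null (λ p → quot p ≟ quot c) (diagonal-manin (quot c)) proj₁ x (x∈I-D (quot c)) ⟩
        0ᴹ ∎
        where
        unquot : ∀ α β {g} → β ∙ α ⁻¹ ≈ g → β ≈ g ∙ α
        unquot α β e = ≈-trans (≈-sym (GroupProperties.//-rightDividesˡ G α β)) (∙-congʳ e)

      pairManin-null : eval φ x ≈ᴹ 0ᴹ
      pairManin-null = begin
        eval φ x
          ≈⟨ eval-cong (λ p → rearrange (φ p ∷ K p ∷ []) (var 0F) ((var 0F ⊕ ⊝ var 1F) ⊕ var 1F)) x ⟩
        eval (λ p → q p +ᴹ K p) x        ≈⟨ eval-+ q K x ⟩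
        eval q x +ᴹ eval K x             ≈⟨ +ᴹ-cong q-null K-null ⟩
        0ᴹ +ᴹ 0ᴹ                         ≈⟨ +ᴹ-identityˡ _ ⟩
        0ᴹ                               ∎

  monomial-pairManin : Relations.IsPairManin quotient monomial
  monomial-pairManin = Relations.kills⇒pairManin quotient (λ e e′ → monomial-cong (e , e′))
    (λ {y} y∈gens → monomials-null (subst (y ∈_) (sym gs≡gens) y∈gens))

  intersection⊆ideal : ∀ {H : Carrier → Pred Carrier 0ℓ} (H? : ∀ γ → Decidable (H γ)) →
    (∀ {γ g} → H γ g → g • ∞ ~ γ • ∞) → (∀ {γ g} → g • ∞ ~ γ • ∞ → H γ g) → ∀ x →
    (∀ γ → sumOver (H? γ ∘ proj₂) (∂ ∘ proj₁) x ≋ᴾ []) →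
    (∀ g → sumOver (λ p → quot p ≟ g) (∂ ∘ proj₁) x ≋ᴾ []) →
    LeftIdeal⟨ gs ⟩ x
  intersection⊆ideal H? H⇒∞ ∞⇒H x x∈I-H x∈I-D = null⇒ideal x (subst (_∼ []) (eval-monomials x)
    (pairManin-null H? H⇒∞ ∞⇒H quotient monomial-pairManin x x∈I-H x∈I-D))

  -- The converse: integer-valued functions that vanish on the ideal.

  module ℤ-Boundary = Boundary ℤ-module
  open ℤ-Boundary using (boundary; eval-∂; boundary-manin; manin-≈; manin-*ₗ)
  open ℤ-Evaluation using (eval; eval-cong; eval-sumOver)
  open ManinFunctions X ℤ-module using (IsManin)
  open IsManin
  open Relations ℤ-module using (IsPairManin; symmetrized; pairManin⇒kills)
  open IsPairManin

  module _ {φ : Carrier × Carrier → ℤ} (Φ : IsPairManin φ) where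

    -- The statement about all left translates is used at the identity pair.
    pairManin-kills-ideal : ∀ {x} → LeftIdeal⟨ gs ⟩ x → eval φ x ≡ 0ℤ
    pairManin-kills-ideal {x} i = trans
      (eval-cong (λ (α , β) → pair-respects Φ (≈-sym (identityˡ α)) (≈-sym (identityˡ β))) x)
      (eval-ideal ℤ-module (λ (e , e′) → pair-respects Φ e e′)
        (λ {y} y∈gs → pairManin⇒kills Φ (subst (y ∈_) gs≡gens y∈gs)) i (ε , ε))

  opposite : ∀ {x y} → x + y ≡ 0ℤ → y ≡ - x
  opposite {x} {y} e = trans (lemma x y) (trans (cong (_- x) e) (ℤ.+-identityˡ (- x)))
    where
    lemma : ∀ x y → y ≡ x + y - x
    lemma = solve-∀

  zero-manin : IsManin (λ _ → 0ℤ)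
  zero-manin = record { respects = λ _ → refl ; S-rel = λ _ → refl ; U-rel = λ _ → refl }

  module _ {d : Carrier → ℤ} (D : IsManin d) where

    -- Since d(αS) = -d(α), symmetrizing gives the product of d(α) and the boundary of χ at β, which
    -- is a Manin function in either variable.
    horizontal : ∀ {χ : Point → ℤ} → (∀ {p q} → p ~ q → χ p ≡ χ q) →
                 IsPairManin (λ (α , β) → χ (β • ∞) * d α)
    horizontal {χ} χ-cong = record
      { pair-respects = λ e e′ → cong₂ _*_ (χ-cong (•-congʳ ∞ e′)) (respects D e)
      ; left-manin = λ β → manin-≈ (λ α → sym (split α β)) (manin-*ₗ (boundary χ β) D)
      ; right-manin = λ α → manin-≈ (λ β → trans (ℤ.*-comm (d α) _) (sym (split α β)))
                              (manin-*ₗ (d α) (boundary-manin χ-cong))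
      ; triangle = λ α β → trans
          (cong₂ _+_ (cong₂ (λ i j → χ (β • ∞) * d α + i * j) (χ-cong (U∞ β)) refl)
                     (cong₂ _*_ (χ-cong (UU∞ β)) (opposite {d α + d (α ∙ U)} (U-rel D α))))
          (trans (lemma (χ (β • ∞)) (χ (β • 𝟎)) (χ ((β ∙ U) • 𝟎)) (d α) (d (α ∙ U)))
          (sym (cong₂ _+_ (cong₂ _+_ (trans (split α (β ∙ U))
              (cong (λ i → (i + - χ ((β ∙ U) • 𝟎)) * d α) (χ-cong (U∞ β))))
                                     (split α β))
                          (trans (split (α ∙ U) (β ∙ U))
              (cong (λ i → (i + - χ ((β ∙ U) • 𝟎)) * d (α ∙ U)) (χ-cong (U∞ β)))))))
      }
      where
      φ : Carrier × Carrier → ℤ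
      φ (α , β) = χ (β • ∞) * d α
      split : ∀ α β → symmetrized φ α β ≡ boundary χ β * d α
      split α β = trans (cong₂ (λ i j → χ (β • ∞) * d α + i * j) (χ-cong (S∞ β)) (opposite (S-rel D α)))
                        (lemma (χ (β • ∞)) (χ (β • 𝟎)) (d α))
        where
        lemma : ∀ m n k → m * k + n * - k ≡ (m + - n) * k
        lemma = solve-∀
      lemma : ∀ i j k m n → i * m + j * n + k * - (m + n) ≡
              (j + - k) * m + (i + - j) * m + (j + - k) * n
      lemma = solve-∀

    -- The same product appears with the variables exchanged, and with the opposite sign because the
    -- vertical side lies over 0 instead of ∞.
    vertical : ∀ {χ : Point → ℤ} → (∀ {p q} → p ~ q → χ p ≡ χ q) →
               IsPairManin (λ (α , β) → χ (α • 𝟎) * d β)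
    vertical {χ} χ-cong = record
      { pair-respects = λ e e′ → cong₂ _*_ (χ-cong (•-congʳ 𝟎 e)) (respects D e′)
      ; left-manin = λ β → manin-≈ (λ α → trans (swap (d β) (boundary χ α)) (sym (split α β)))
                             (manin-*ₗ (- d β) (boundary-manin χ-cong))
      ; right-manin = λ α → manin-≈ (λ β → sym (split α β)) (manin-*ₗ (- boundary χ α) D)
      ; triangle = λ α β → trans
          (cong (λ i → χ (α • 𝟎) * d β + χ ((α ∙ U) • 𝟎) * d (β ∙ U) + i)
                (cong₂ _*_ (χ-cong (UU𝟎 α)) (opposite {d β + d (β ∙ U)} (U-rel D β))))
          (trans (lemma (χ (α • ∞)) (χ (α • 𝟎)) (χ ((α ∙ U) • 𝟎)) (d β) (d (β ∙ U)))
          (sym (cong₂ _+_ (cong₂ _+_ (split α (β ∙ U)) (split α β))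
            (trans (split (α ∙ U) (β ∙ U))
              (cong (λ i → - (i + - χ ((α ∙ U) • 𝟎)) * d (β ∙ U)) (χ-cong (U∞ α)))))))
      }
      where
      φ : Carrier × Carrier → ℤ
      φ (α , β) = χ (α • 𝟎) * d β
      swap : ∀ m n → - m * n ≡ - n * m
      swap = solve-∀
      split : ∀ α β → symmetrized φ α β ≡ - boundary χ α * d β
      split α β = trans (cong₂ (λ i j → χ (α • 𝟎) * d β + i * j) (χ-cong (S𝟎 α)) (opposite (S-rel D β)))
                        (lemma (χ (α • ∞)) (χ (α • 𝟎)) (d β))
        where
        lemma : ∀ m n k → n * k + m * - k ≡ - (m + - n) * k
        lemma = solve-∀
      lemma : ∀ i j k m n → j * m + k * n + i * - (m + n) ≡
              - (i + - j) * n + - (i + - j) * m + - (j + - k) * n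
      lemma = solve-∀

    -- Right translation of both entries preserves βα⁻¹, so the relations of d already hold along
    -- each diagonal and all symmetrized values are 0.
    diagonal : ∀ {ρ : Carrier → ℤ} → (∀ {g h} → g ≈ h → ρ g ≡ ρ h) →
               IsPairManin (λ p → ρ (quot p) * d (proj₁ p))
    diagonal {ρ} ρ-cong = record
      { pair-respects = λ e e′ → cong₂ _*_ (ρ-cong (∙-cong e′ (⁻¹-cong e))) (respects D e)
      ; left-manin = λ β → manin-≈ (λ α → sym (split α β)) zero-manin
      ; right-manin = λ α → manin-≈ (λ β → sym (split α β)) zero-manin
      ; triangle = λ α β → trans
          (cong₂ _+_ (cong (λ i → ρ (β ∙ α ⁻¹) * d α + i * d (α ∙ U)) (ρ-cong (quot-∙ α β U)))
                     (cong₂ _*_ (ρ-cong (quot-∙ α β (U ∙ U))) (opposite {d α + d (α ∙ U)} (U-rel D α))))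
          (trans (lemma (ρ (β ∙ α ⁻¹)) (d α) (d (α ∙ U)))
          (sym (cong₂ _+_ (cong₂ _+_ (split α (β ∙ U)) (split α β)) (split (α ∙ U) (β ∙ U)))))
      }
      where
      quot-∙ : ∀ α β g → (β ∙ g) ∙ (α ∙ g) ⁻¹ ≈ β ∙ α ⁻¹
      quot-∙ α β g = ≈-trans (∙-congˡ (GroupProperties.⁻¹-anti-homo-∙ G α g))
        (≈-trans (≈-sym (assoc (β ∙ g) (g ⁻¹) (α ⁻¹))) (∙-congʳ (GroupProperties.//-rightDividesʳ G g β)))
      φ : Carrier × Carrier → ℤ
      φ p = ρ (quot p) * d (proj₁ p)
      split : ∀ α β → symmetrized φ α β ≡ 0ℤ
      split α β = trans (cong₂ (λ i j → ρ (β ∙ α ⁻¹) * d α + i * j)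
                               (ρ-cong (quot-∙ α β S)) (opposite (S-rel D α)))
                        (lemma (ρ (β ∙ α ⁻¹)) (d α))
        where
        lemma : ∀ m k → m * k + m * - k ≡ 0ℤ
        lemma = solve-∀
      lemma : ∀ i m n → i * m + i * n + i * - (m + n) ≡ 0ℤ + 0ℤ + 0ℤ
      lemma = solve-∀

  δ : Point → Point → ℤ
  δ p q = indicator (q P.≟ p)

  δ-cong : ∀ {p q r} → q ~ r → δ p q ≡ δ p r
  δ-cong {p} {q} {r} q~r = indicator-cong (q P.≟ p) (r P.≟ p) (P.trans (P.sym q~r)) (P.trans q~r)

  multiplicity : Point → Carrier → ℤ
  multiplicity p α = eval (δ p) (∂ α)

  multiplicity-manin : ∀ p → IsManin (multiplicity p)
  multiplicity-manin p = manin-≈ (λ α → sym (eval-∂ (δ p) α)) (boundary-manin δ-cong)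

  -- Each coefficient becomes a linear functional of x whose kernel function, an indicator times a
  -- multiplicity, has the shape treated by `horizontal`, `vertical` and `diagonal`.
  coefficient-sumOver : ∀ {b ℓ} {B : Set b} {Q : Pred B ℓ} (Q? : Decidable Q) (π : B → Carrier) x p →
                        coefficientᴾ (sumOver Q? (∂ ∘ π) x) p ≡
                        eval (λ b → indicator (Q? b) * multiplicity p (π b)) x
  coefficient-sumOver Q? π x p = trans (coefficient-eval P (sumOver Q? (∂ ∘ π) x) p)
    (trans (eval-sumOver P Q? (δ p) (∂ ∘ π) x) (eval-indicator Q? (multiplicity p ∘ π) x))

  module _ {H : Carrier → Pred Carrier 0ℓ} (H? : ∀ γ → Decidable (H γ)) where

    ideal⊆horizontal : (∀ {γ g} → H γ g → g • ∞ ~ γ • ∞) → (∀ {γ g} → g • ∞ ~ γ • ∞ → H γ g) →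
                       ∀ {x} → LeftIdeal⟨ gs ⟩ x → ∀ γ → sumOver (H? γ ∘ proj₂) (∂ ∘ proj₁) x ≋ᴾ []
    ideal⊆horizontal H⇒∞ ∞⇒H {x} i γ p = trans (coefficient-sumOver (H? γ ∘ proj₂) proj₁ x p)
      (trans (eval-cong (λ (α , β) → cong (_* multiplicity p α)
               (indicator-cong (H? γ β) (β • ∞ P.≟ γ • ∞) H⇒∞ ∞⇒H)) x)
             (pairManin-kills-ideal (horizontal (multiplicity-manin p) (δ-cong {γ • ∞})) i))

    ideal⊆vertical : (∀ {γ g} → H γ g → g • 𝟎 ~ γ • 𝟎) → (∀ {γ g} → g • 𝟎 ~ γ • 𝟎 → H γ g) →
                     ∀ {x} → LeftIdeal⟨ gs ⟩ x → ∀ γ → sumOver (H? γ ∘ proj₁) (∂ ∘ proj₂) x ≋ᴾ []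
    ideal⊆vertical H⇒𝟎 𝟎⇒H {x} i γ p = trans (coefficient-sumOver (H? γ ∘ proj₁) proj₂ x p)
      (trans (eval-cong (λ (α , β) → cong (_* multiplicity p β)
               (indicator-cong (H? γ α) (α • 𝟎 P.≟ γ • 𝟎) H⇒𝟎 𝟎⇒H)) x)
             (pairManin-kills-ideal (vertical (multiplicity-manin p) (δ-cong {γ • 𝟎})) i))

  ideal⊆diagonal : ∀ {x} → LeftIdeal⟨ gs ⟩ x → ∀ g → sumOver (λ p → quot p ≟ g) (∂ ∘ proj₁) x ≋ᴾ []
  ideal⊆diagonal {x} i g p = trans (coefficient-sumOver (λ c → quot c ≟ g) proj₁ x p)
    (pairManin-kills-ideal (diagonal (multiplicity-manin p) λ {h} {k} h≈k →
      indicator-cong (h ≟ g) (k ≟ g) (≈-trans (≈-sym h≈k)) (≈-trans h≈k)) i)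

-- The group PSL₂(ℤ) and its action on ℙ¹(ℚ).

open import Defs

private
  module Γ = Group Γ
  module ℙ = DecSetoid ℙ¹

coordinates : ∀ {p q} → ℙ¹ℚ.x p ≡ ℙ¹ℚ.x q → ℙ¹ℚ.y p ≡ ℙ¹ℚ.y q → p ≈ᴾ q
coordinates refl refl = proportional refl

•-congˡ : ∀ g {p q} → p ≈ᴾ q → g • p ≈ᴾ g • q
•-congˡ (sl₂ (mat a b c d) _) {point x y _} {point x′ y′ _} (proportional e) = proportional (begin
  (a * x + b * y) * (c * x′ + d * y′)
    ≡⟨ expand a b c d x y x′ y′ ⟩
  a * c * (x * x′) + a * d * (x * y′) + (b * c * (x′ * y) + b * d * (y * y′))
    ≡⟨ cong₂ (λ m n → a * c * (x * x′) + a * d * m + (b * c * n + b * d * (y * y′))) e (sym e) ⟩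
  a * c * (x * x′) + a * d * (x′ * y) + (b * c * (x * y′) + b * d * (y * y′))
    ≡⟨ collect a b c d x y x′ y′ ⟩
  (a * x′ + b * y′) * (c * x + d * y)                                    ∎)
  where
  open ≡-Reasoning
  expand : ∀ a b c d x y x′ y′ → (a * x + b * y) * (c * x′ + d * y′) ≡
           a * c * (x * x′) + a * d * (x * y′) + (b * c * (x′ * y) + b * d * (y * y′))
  expand = solve-∀
  collect : ∀ a b c d x y x′ y′ →
            a * c * (x * x′) + a * d * (x′ * y) + (b * c * (x * y′) + b * d * (y * y′)) ≡
            (a * x′ + b * y′) * (c * x + d * y)
  collect = solve-∀

•-congʳ : ∀ {g h} p → g ≈± h → g • p ≈ᴾ h • p
•-congʳ (point x y _) (plus refl) = proportional refl
•-congʳ {h = sl₂ (mat a b c d) _} (point x y _) (minus refl) = proportional (lemma a b c d x y)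
  where
  lemma : ∀ a b c d x y → (- a * x + - b * y) * (c * x + d * y) ≡ (a * x + b * y) * (- c * x + - d * y)
  lemma = solve-∀

-- The cross difference xy′ - x′y of two points is multiplied by det g = 1.
•-cancelˡ : ∀ g {p q} → g • p ≈ᴾ g • q → p ≈ᴾ q
•-cancelˡ (sl₂ (mat a b c d) det≡1) {point x y _} {point x′ y′ _} (proportional e) = proportional
  (ℤ.i-j≡0⇒i≡j (x * y′) (x′ * y) (begin
    x * y′ - x′ * y                        ≡⟨ ℤ.*-identityˡ _ ⟨
    1ℤ * (x * y′ - x′ * y)                 ≡⟨ cong (_* (x * y′ - x′ * y)) det≡1 ⟨
    (a * d - b * c) * (x * y′ - x′ * y)    ≡⟨ lemma a b c d x y x′ y′ ⟩
    (a * x + b * y) * (c * x′ + d * y′) - (a * x′ + b * y′) * (c * x + d * y) ≡⟨ ℤ.i≡j⇒i-j≡0 e ⟩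
    0ℤ                                     ∎))
  where
  open ≡-Reasoning
  lemma : ∀ a b c d x y x′ y′ → (a * d - b * c) * (x * y′ - x′ * y) ≡
          (a * x + b * y) * (c * x′ + d * y′) - (a * x′ + b * y′) * (c * x + d * y)
  lemma = solve-∀

product-• : ∀ k g h {p q} → matrix k ≡ matrix g · matrix h → h • p ≈ᴾ q → k • p ≈ᴾ g • q
product-• k g h {p} {q} e hp≈q = ℙ.trans {k • p} {g • (h • p)} {g • q}
  (coordinates (trans (cong (λ M → Matrix.a M * x + Matrix.b M * y) e)
                      (lemma (Matrix.a G) (Matrix.b G) k′ l′ m′ n′ x y))
               (trans (cong (λ M → Matrix.c M * x + Matrix.d M * y) e)
                      (lemma (Matrix.c G) (Matrix.d G) k′ l′ m′ n′ x y)))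
  (•-congˡ g hp≈q)
  where
  open ℙ¹ℚ p using (x; y)
  G = matrix g
  open Matrix (matrix h) renaming (a to k′; b to l′; c to m′; d to n′)
  lemma : ∀ a b k l m n x y →
          (a * k + b * m) * x + (a * l + b * n) * y ≡ a * (k * x + l * y) + b * (m * x + n * y)
  lemma = solve-∀

-- Multiplication in SL₂(ℤ), without the computation of the determinants that
-- would otherwise be unfolded in every comparison of two products.
opaque
  _⊙_ : SL₂ℤ → SL₂ℤ → SL₂ℤ
  _⊙_ = Γ._∙_

  inverse : SL₂ℤ → SL₂ℤ
  inverse = Γ._⁻¹

  ⊙-isGroup : IsGroup _≈±_ _⊙_ Γ.ε inverse
  ⊙-isGroup = Γ.isGroup

  matrix-⊙ : ∀ g h → matrix (g ⊙ h) ≡ matrix g · matrix h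
  matrix-⊙ g h = refl

  ⊙-modular : S ⊙ S ≈± Γ.ε × T ≈± (U ⊙ U) ⊙ S × US ≈± U ⊙ S
  ⊙-modular = minus refl , plus refl , plus refl

Γ⊙ : Group 0ℓ 0ℓ
Γ⊙ = record { isGroup = ⊙-isGroup }

modular : ModularGenerators Γ⊙
modular = let p , q , r = ⊙-modular in record
  { S = S ; T = T ; U = U ; L = US ; S²≈ε = p ; T≈U²S = q ; L≈US = r }

positive : ∀ a b c d → a ℕ.* d ≡ 1 ℕ.+ b ℕ.* c → SL₂ℤ
positive a b c d e = sl₂ (mat (+ a) (+ b) (+ c) (+ d)) (begin
  + a * + d - + b * + c          ≡⟨ cong₂ _-_ (ℤ.pos-* a d) (ℤ.pos-* b c) ⟨
  + (a ℕ.* d) - + (b ℕ.* c)      ≡⟨ cong (λ k → + k - + (b ℕ.* c)) e ⟩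
  1ℤ + + (b ℕ.* c) - + (b ℕ.* c) ≡⟨ cancel (+ (b ℕ.* c)) ⟩
  1ℤ                             ∎)
  where
  open ≡-Reasoning
  cancel : ∀ m → 1ℤ + m - m ≡ 1ℤ
  cancel = solve-∀

-- Factorization of nonnegative matrices of determinant 1 into T and L.

data Column-order : ℕ → ℕ → ℕ → ℕ → Set where
  unit  : Column-order 1 0 0 1
  above : ∀ a b c d → 0 ℕ.< c ℕ.+ d → Column-order (c ℕ.+ a) (d ℕ.+ b) c d
  below : ∀ a b c d → 0 ℕ.< a ℕ.+ b → Column-order a b (a ℕ.+ c) (b ℕ.+ d)

-- Unless the matrix is the identity, one row dominates the other entrywise and can be reduced by
-- it. The diagonal entries are compared with the entry in the other row of the same column.
column-order : ∀ a b c d → a ℕ.* d ≡ 1 ℕ.+ b ℕ.* c → Column-order a b c d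
column-order a b c d e with ℕ.<-≤-connex c a | ℕ.<-≤-connex b d
... | inj₁ c<a | inj₁ b<d with ℕ.m≤n⇒∃[o]m+o≡n c<a | ℕ.m≤n⇒∃[o]m+o≡n b<d
-- With a = 1 + c + a′ and d = 1 + b + d′, the product ad exceeds 1 + bc by a sum of nonnegative
-- terms that includes b, c, a′ and d′. All four are therefore 0.
...   | a′ , refl | d′ , refl = corner b c a′ d′ e
  where
  expand : ∀ b c a d → (1 ℕ.+ c ℕ.+ a) ℕ.* (1 ℕ.+ b ℕ.+ d) ≡
           1 ℕ.+ b ℕ.* c ℕ.+ (b ℕ.+ (c ℕ.+ (d ℕ.+ (a ℕ.+ (c ℕ.* d ℕ.+ a ℕ.* (b ℕ.+ d))))))
  expand = ℕ-Solver.solve-∀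
  corner : ∀ b c a d → (1 ℕ.+ c ℕ.+ a) ℕ.* (1 ℕ.+ b ℕ.+ d) ≡ 1 ℕ.+ b ℕ.* c →
           Column-order (1 ℕ.+ c ℕ.+ a) b c (1 ℕ.+ b ℕ.+ d)
  corner b c a d e with ℕ.+-cancelˡ-≡ (1 ℕ.+ b ℕ.* c) _ 0
    (trans (sym (expand b c a d)) (trans e (sym (ℕ.+-identityʳ _))))
  corner zero zero zero zero _ | refl = unit
column-order a b c d e | inj₁ c<a | inj₂ d≤b with ℕ.m≤n⇒∃[o]m+o≡n (ℕ.<⇒≤ c<a) | ℕ.m≤n⇒∃[o]m+o≡n d≤b
... | a′ , refl | b′ , refl = above a′ b′ c d (positive-sum c d (c ℕ.+ a′) (d ℕ.+ b′) e)
  where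
  positive-sum : ∀ c d m n → m ℕ.* d ≡ 1 ℕ.+ n ℕ.* c → 0 ℕ.< c ℕ.+ d
  positive-sum zero    zero    m _ e = contradiction (trans (sym (ℕ.*-zeroʳ m)) e) λ ()
  positive-sum zero    (suc d) _ _ _ = ℕ.z<s
  positive-sum (suc c) d       _ _ _ = ℕ.z<s
column-order a b c d e | inj₂ a≤c | inj₁ b<d with ℕ.m≤n⇒∃[o]m+o≡n a≤c | ℕ.m≤n⇒∃[o]m+o≡n (ℕ.<⇒≤ b<d)
... | c′ , refl | d′ , refl = below a b c′ d′ (positive-sum a b e)
  where
  positive-sum : ∀ a b {m n} → a ℕ.* m ≡ 1 ℕ.+ b ℕ.* n → 0 ℕ.< a ℕ.+ b
  positive-sum zero    zero    ()
  positive-sum zero    (suc b) _ = ℕ.z<s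
  positive-sum (suc a) b       _ = ℕ.z<s
column-order a b c d e | inj₂ a≤c | inj₂ d≤b = contradiction (begin
  1 ℕ.+ b ℕ.* c   ≡⟨ e ⟨
  a ℕ.* d         ≤⟨ ℕ.*-mono-≤ a≤c d≤b ⟩
  c ℕ.* b         ≡⟨ ℕ.*-comm c b ⟩
  b ℕ.* c         ∎) ℕ.1+n≰n
  where open ℕ.≤-Reasoning

above-det : ∀ a b c d → (c ℕ.+ a) ℕ.* d ≡ 1 ℕ.+ (d ℕ.+ b) ℕ.* c → a ℕ.* d ≡ 1 ℕ.+ b ℕ.* c
above-det a b c d e = ℕ.+-cancelˡ-≡ (c ℕ.* d) _ _ (trans (sym (lhs a c d)) (trans e (rhs b c d)))
  where
  lhs : ∀ a c d → (c ℕ.+ a) ℕ.* d ≡ c ℕ.* d ℕ.+ a ℕ.* d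
  lhs = ℕ-Solver.solve-∀
  rhs : ∀ b c d → 1 ℕ.+ (d ℕ.+ b) ℕ.* c ≡ c ℕ.* d ℕ.+ (1 ℕ.+ b ℕ.* c)
  rhs = ℕ-Solver.solve-∀

below-det : ∀ a b c d → a ℕ.* (b ℕ.+ d) ≡ 1 ℕ.+ b ℕ.* (a ℕ.+ c) → a ℕ.* d ≡ 1 ℕ.+ b ℕ.* c
below-det a b c d e = ℕ.+-cancelˡ-≡ (a ℕ.* b) _ _ (trans (sym (lhs a b d)) (trans e (rhs a b c)))
  where
  lhs : ∀ a b d → a ℕ.* (b ℕ.+ d) ≡ a ℕ.* b ℕ.+ a ℕ.* d
  lhs = ℕ-Solver.solve-∀
  rhs : ∀ a b c → 1 ℕ.+ b ℕ.* (a ℕ.+ c) ≡ a ℕ.* b ℕ.+ (1 ℕ.+ b ℕ.* c)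
  rhs = ℕ-Solver.solve-∀

T-positive : ∀ a b c d e e′ → T ⊙ positive a b c d e ≈± positive (c ℕ.+ a) (d ℕ.+ b) c d e′
T-positive a b c d e e′ = plus (trans (matrix-⊙ _ _) (mat-cong (upper-row (+ a) (+ c)) (upper-row (+ b) (+ d))
                                         (lower-row (+ a) (+ c)) (lower-row (+ b) (+ d))))
  where
  upper-row : ∀ x y → 1ℤ * x + 1ℤ * y ≡ y + x
  upper-row = solve-∀
  lower-row : ∀ x y → 0ℤ * x + 1ℤ * y ≡ y
  lower-row = solve-∀

US-positive : ∀ a b c d e e′ → US ⊙ positive a b c d e ≈± positive a b (a ℕ.+ c) (b ℕ.+ d) e′
US-positive a b c d e e′ = plus (trans (matrix-⊙ _ _) (mat-cong (upper-row (+ a) (+ c)) (upper-row (+ b) (+ d))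
                                          (lower-row (+ a) (+ c)) (lower-row (+ b) (+ d))))
  where
  upper-row : ∀ x y → 1ℤ * x + 0ℤ * y ≡ x
  upper-row = solve-∀
  lower-row : ∀ x y → 1ℤ * x + 1ℤ * y ≡ x + y
  lower-row = solve-∀

-- Reduction of arbitrary matrices to nonnegative ones.

data Nonnegative : Matrix → Set where
  plus  : ∀ a b c d → Nonnegative (mat (+ a) (+ b) (+ c) (+ d))
  minus : ∀ a b c d → Nonnegative (neg (mat (+ a) (+ b) (+ c) (+ d)))

negate : ∀ {M} → Nonnegative M → Nonnegative (neg M)
negate (plus a b c d)  = minus a b c d
negate (minus a b c d) = subst Nonnegative (sym (neg-involutive _)) (plus a b c d)

-- The columns of M are points of ℙ¹(ℚ).  They are adjacent in the Farey
-- tessellation, so no edge crosses the line from 0 to ∞ and S maps the edges on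
-- its negative side to those on its positive side.
data Quadrant (M : Matrix) : Set where
  here  : Nonnegative M → Quadrant M
  right : Nonnegative (M · matrix S) → Quadrant M
  left  : Nonnegative (matrix S · M) → Quadrant M
  both  : Nonnegative (matrix S · (M · matrix S)) → Quadrant M

·S : ∀ a b c d → mat a b c d · matrix S ≡ mat b (- a) d (- c)
·S a b c d = mat-cong (first a b) (second a b) (first c d) (second c d)
  where
  first : ∀ x y → x * 0ℤ + y * 1ℤ ≡ y
  first = solve-∀
  second : ∀ x y → x * -1ℤ + y * 0ℤ ≡ - x
  second = solve-∀

S· : ∀ a b c d → matrix S · mat a b c d ≡ mat (- c) (- d) a b
S· a b c d = mat-cong (first a c) (first b d) (second a c) (second b d)
  where
  first : ∀ x y → 0ℤ * x + -1ℤ * y ≡ - y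
  first = solve-∀
  second : ∀ x y → 1ℤ * x + 0ℤ * y ≡ x
  second = solve-∀

S·S : ∀ a b c d → matrix S · (mat a b c d · matrix S) ≡ mat (- d) (- - c) b (- a)
S·S a b c d = trans (cong (matrix S ·_) (·S a b c d)) (S· b (- a) d (- c))

det-neg : ∀ M → det (neg M) ≡ det M
det-neg (mat a b c d) = lemma a b c d
  where
  lemma : ∀ a b c d → - a * - d - - b * - c ≡ a * d - b * c
  lemma = solve-∀

negate-quadrant : ∀ {M} → Quadrant M → Quadrant (neg M)
negate-quadrant (here n)      = here (negate n)
negate-quadrant {M} (right n) = right (subst Nonnegative (sym (neg-·ˡ M (matrix S))) (negate n))
negate-quadrant {M} (left n)  = left (subst Nonnegative (sym (neg-·ʳ (matrix S) M)) (negate n))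
negate-quadrant {M} (both n)  = both (subst Nonnegative (sym (trans (cong (matrix S ·_) (neg-·ˡ M (matrix S)))
                                                               (neg-·ʳ (matrix S) (M · matrix S)))) (negate n))

-- For a ≥ 0 the signs of the other entries decide the case; ad - bc = 1 rules out edges that would
-- cross the line from 0 to ∞.
quadrant : ∀ M → det M ≡ 1ℤ → Quadrant M
quadrant (mat (+ a)    b c d) e = quadrant⁺ a b c d e
  where
  no-sum : ∀ a b c d → + a * -[1+ d ] - b * c ≡ 1ℤ → b * c ≡ + (∣ b ∣ ℕ.* ∣ c ∣) → ⊥
  no-sum a b c d e bc = impossible (a ℕ.* suc d ℕ.+ ∣ b ∣ ℕ.* ∣ c ∣) (begin
    - (+ (a ℕ.* suc d) + + (∣ b ∣ ℕ.* ∣ c ∣))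
      ≡⟨ cong₂ (λ m n → - (m + n)) (ℤ.pos-* a (suc d)) (sym bc) ⟩
    - (+ a * + suc d + b * c)                    ≡⟨ regroup (+ a) (+ suc d) (b * c) ⟩
    + a * -[1+ d ] - b * c                       ≡⟨ e ⟩
    1ℤ                                           ∎)
    where
    open ≡-Reasoning
    regroup : ∀ x y z → - (x * y + z) ≡ x * - y - z
    regroup = solve-∀
    impossible : ∀ n → - (+ n) ≡ 1ℤ → ⊥
    impossible zero    ()
    impossible (suc n) ()

  sum : ∀ a b c d → + a * + d - b * c ≡ 1ℤ → - (b * c) ≡ + (∣ b ∣ ℕ.* ∣ c ∣) →
        a ℕ.* d ℕ.+ ∣ b ∣ ℕ.* ∣ c ∣ ≡ 1
  sum a b c d e bc = ℤ.+-injective (trans (cong₂ _+_ (ℤ.pos-* a d) (sym bc)) e)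

  no-units : ∀ a b c d → suc a ℕ.* suc d ℕ.+ suc b ℕ.* suc c ≡ 1 → ⊥
  no-units a b c d e = contradiction
    (trans (sym (ℕ.+-suc _ _)) (ℕ.suc-injective e)) λ ()

  quadrant⁺ : ∀ a b c d → + a * d - b * c ≡ 1ℤ → Quadrant (mat (+ a) b c d)
  quadrant⁺ a (+ b)    (+ c)    (+ d)    e = here (plus a b c d)
  quadrant⁺ a (+ b)    (+ c)    -[1+ d ] e = contradiction (sym (ℤ.pos-* b c)) (no-sum a (+ b) (+ c) d e)
  quadrant⁺ a -[1+ b ] -[1+ c ] -[1+ d ] e = contradiction refl (no-sum a -[1+ b ] -[1+ c ] d e)
  quadrant⁺ a (+ b)    -[1+ c ] -[1+ d ] e =
    left (subst Nonnegative (sym (S· (+ a) (+ b) -[1+ c ] -[1+ d ])) (plus (suc c) (suc d) a b))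
  quadrant⁺ a -[1+ b ] (+ c)    -[1+ d ] e =
    right (subst Nonnegative (sym (·S (+ a) -[1+ b ] (+ c) -[1+ d ])) (minus (suc b) a (suc d) c))
  quadrant⁺ a -[1+ b ] -[1+ c ] (+ d)    e =
    both (subst Nonnegative (sym (S·S (+ a) -[1+ b ] -[1+ c ] (+ d))) (minus d (suc c) (suc b) a))
  -- From here on a, d ≥ 0 and bc ≤ 0, so ad + |b||c| = 1 and some entry must vanish. A zero may be
  -- given either sign, and its position decides which side S is applied on.
  quadrant⁺ a       (+ zero)  -[1+ c ] (+ d)     e =
    both (subst Nonnegative (sym (S·S (+ a) 0ℤ -[1+ c ] (+ d))) (minus d (suc c) 0 a))
  quadrant⁺ zero    (+ b)     -[1+ c ] (+ d)     e =
    right (subst Nonnegative (sym (·S 0ℤ (+ b) -[1+ c ] (+ d))) (plus b 0 d (suc c)))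
  quadrant⁺ a       (+ b)     -[1+ c ] (+ zero)  e =
    left (subst Nonnegative (sym (S· (+ a) (+ b) -[1+ c ] 0ℤ)) (plus (suc c) 0 a b))
  quadrant⁺ (suc a) (+ suc b) -[1+ c ] (+ suc d) e =
    contradiction (sum (suc a) (+ suc b) -[1+ c ] (suc d) e refl) (no-units a b c d)
  quadrant⁺ a       -[1+ b ]  (+ zero)  (+ d)     e =
    both (subst Nonnegative (sym (S·S (+ a) -[1+ b ] 0ℤ (+ d))) (minus d 0 (suc b) a))
  quadrant⁺ zero    -[1+ b ]  (+ c)     (+ d)     e =
    left (subst Nonnegative (sym (S· 0ℤ -[1+ b ] (+ c) (+ d))) (minus c d 0 (suc b)))
  quadrant⁺ a       -[1+ b ]  (+ c)     (+ zero)  e =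
    right (subst Nonnegative (sym (·S (+ a) -[1+ b ] (+ c) 0ℤ)) (minus (suc b) a 0 c))
  quadrant⁺ (suc a) -[1+ b ]  (+ suc c) (+ suc d) e =
    contradiction (sum (suc a) -[1+ b ] (+ suc c) (suc d) e refl) (no-units a b c d)
quadrant M@(mat -[1+ a ] b c d) e = subst Quadrant (neg-involutive M)
  (negate-quadrant (quadrant (neg M) (trans (det-neg M) e)))

open Paths Γ⊙ S T US using (path; path-cong; Represents; unit; above; below)

-- Descent on the sum of the entries: subtracting the dominated row splits off a left factor T or L
-- and keeps the determinant. The row subtracted is nonzero, so the sum drops.
represent : ∀ n a b c d e → a ℕ.+ b ℕ.+ (c ℕ.+ d) ℕ.≤ n →
            ∃[ g ] Represents g a b c d × g ≈± positive a b c d e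
represent n a b c d e _ with column-order a b c d e
represent n _ _ _ _ e _ | unit = Γ.ε , unit , plus refl
represent zero _ _ _ _ e bound | above a b c d 0<c+d =
  contradiction bound (ℕ.<⇒≱ (ℕ.<-≤-trans 0<c+d (ℕ.m≤n+m (c ℕ.+ d) (c ℕ.+ a ℕ.+ (d ℕ.+ b)))))
represent (suc n) _ _ _ _ e bound | above a b c d 0<c+d =
  let e′ = above-det a b c d e
      g , r , g≈ = represent n a b c d e′ (ℕ.s≤s⁻¹ (ℕ.≤-trans (smaller a b c d 0<c+d) bound))
  in T ⊙ g , above 0<c+d r , Γ.trans (Group.∙-congˡ Γ⊙ {T} g≈) (T-positive a b c d e′ e)
  where
  smaller : ∀ a b c d → 0 ℕ.< c ℕ.+ d → suc (a ℕ.+ b ℕ.+ (c ℕ.+ d)) ℕ.≤ c ℕ.+ a ℕ.+ (d ℕ.+ b) ℕ.+ (c ℕ.+ d)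
  smaller a b c d 0<c+d = subst (a ℕ.+ b ℕ.+ (c ℕ.+ d) ℕ.<_) (lemma a b c d) (ℕ.m<n+m _ 0<c+d)
    where
    lemma : ∀ a b c d → c ℕ.+ d ℕ.+ (a ℕ.+ b ℕ.+ (c ℕ.+ d)) ≡ c ℕ.+ a ℕ.+ (d ℕ.+ b) ℕ.+ (c ℕ.+ d)
    lemma = ℕ-Solver.solve-∀
represent zero _ _ _ _ e bound | below a b c d 0<a+b =
  contradiction bound (ℕ.<⇒≱ (ℕ.<-≤-trans 0<a+b (ℕ.m≤m+n (a ℕ.+ b) (a ℕ.+ c ℕ.+ (b ℕ.+ d)))))
represent (suc n) _ _ _ _ e bound | below a b c d 0<a+b =
  let e′ = below-det a b c d e
      g , r , g≈ = represent n a b c d e′ (ℕ.s≤s⁻¹ (ℕ.≤-trans (smaller a b c d 0<a+b) bound))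
  in US ⊙ g , below 0<a+b r , Γ.trans (Group.∙-congˡ Γ⊙ {US} g≈) (US-positive a b c d e′ e)
  where
  smaller : ∀ a b c d → 0 ℕ.< a ℕ.+ b → suc (a ℕ.+ b ℕ.+ (c ℕ.+ d)) ℕ.≤ a ℕ.+ b ℕ.+ (a ℕ.+ c ℕ.+ (b ℕ.+ d))
  smaller a b c d 0<a+b = subst (a ℕ.+ b ℕ.+ (c ℕ.+ d) ℕ.<_) (lemma a b c d) (ℕ.m<n+m _ 0<a+b)
    where
    lemma : ∀ a b c d → a ℕ.+ b ℕ.+ (a ℕ.+ b ℕ.+ (c ℕ.+ d)) ≡ a ℕ.+ b ℕ.+ (a ℕ.+ c ℕ.+ (b ℕ.+ d))
    lemma = ℕ-Solver.solve-∀

ℕ-det : ∀ a b c d → det (mat (+ a) (+ b) (+ c) (+ d)) ≡ 1ℤ → a ℕ.* d ≡ 1 ℕ.+ b ℕ.* c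
ℕ-det a b c d e = ℤ.+-injective (begin
  + (a ℕ.* d)                            ≡⟨ ℤ.pos-* a d ⟩
  + a * + d                              ≡⟨ uncancel (+ a * + d) (+ b * + c) ⟩
  (+ a * + d - + b * + c) + + b * + c    ≡⟨ cong₂ _+_ e (sym (ℤ.pos-* b c)) ⟩
  1ℤ + + (b ℕ.* c)                       ∎)
  where
  open ≡-Reasoning
  uncancel : ∀ x y → x ≡ (x - y) + y
  uncancel = solve-∀

first-column : ∀ a b c d → a * d - b * c ≡ 1ℤ → ¬ (a ≡ 0ℤ × c ≡ 0ℤ)
first-column a b c d e (refl , refl) = contradiction (trans (sym (lemma b d)) e) λ ()
  where
  lemma : ∀ b d → 0ℤ * d - b * 0ℤ ≡ 0ℤ
  lemma = solve-∀

second-column : ∀ a b c d → a * d - b * c ≡ 1ℤ → ¬ (b ≡ 0ℤ × d ≡ 0ℤ)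
second-column a b c d e (refl , refl) = contradiction (trans (sym (lemma a c)) e) λ ()
  where
  lemma : ∀ a c → a * 0ℤ - 0ℤ * c ≡ 0ℤ
  lemma = solve-∀

module _ {m ℓm} (M : LeftModule ℤ.+-*-ring m ℓm) where
  open LeftModule M
  open Evaluation M
  open ManinFunctions modular M

  EdgeOf : (SL₂ℤ → Carrierᴹ) → SL₂ℤ → Matrix → Set ℓm
  EdgeOf f g (mat a b c d) = Edge f g a b c d

  module _ {f : SL₂ℤ → Carrierᴹ} (F : IsManin f) where

    edge-positive : ∀ g a b c d → det (mat (+ a) (+ b) (+ c) (+ d)) ≡ 1ℤ →
                    (∀ e → positive a b c d e ≈± g) → Edge f g (+ a) (+ b) (+ c) (+ d)
    edge-positive g a b c d det≡1 p≈g =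
      let e = ℕ-det a b c d det≡1
          h , r , h≈p = represent _ a b c d e ℕ.≤-refl
      in edge-respects F (+ a) (+ b) (+ c) (+ d) (Γ.trans h≈p (p≈g e)) (edge-represents F r)

    edge-nonnegative : ∀ {M} → Nonnegative M → ∀ g → matrix g ≡ M → EdgeOf f g M
    edge-nonnegative (plus a b c d)  g e = edge-positive g a b c d
      (trans (cong det (sym e)) (det≡1 g)) (λ _ → plus (sym e))
    edge-nonnegative (minus a b c d) g e = edge-neg F (+ a) (+ b) (+ c) (+ d) (edge-positive g a b c d
      (trans (sym (det-neg (mat (+ a) (+ b) (+ c) (+ d)))) (trans (cong det (sym e)) (det≡1 g)))
      (λ _ → minus (sym (trans (cong neg e) (neg-involutive _)))))

  -- The columns are moved to the nonnegative side by S on the right, on the left or on both sides.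
  -- A factor on the left also replaces f by its translate by S.
  edge : ∀ {f} → IsManin f → ∀ g → EdgeOf f g (matrix g)
  edge {f} F g@(sl₂ M@(mat a b c d) e) with quadrant M e
  ... | here n  = edge-nonnegative F n g refl
  ... | right n = edge-right F a b c d
    (subst (EdgeOf f (g ⊙ S)) (·S a b c d) (edge-nonnegative F n (g ⊙ S) (matrix-⊙ g S)))
  ... | left n  = edge-left F a b c d (first-column a b c d e) (second-column a b c d e)
    (subst (EdgeOf (λ h → f (S ⊙ h)) (S ⊙ g)) (S· a b c d)
      (edge-nonnegative (translate S F) n (S ⊙ g) (matrix-⊙ S g)))
  ... | both n  = edge-left F a b c d (first-column a b c d e) (second-column a b c d e)
    (edge-right (translate S F) (- c) (- d) a b
      (subst (EdgeOf (λ h → f (S ⊙ h)) ((S ⊙ g) ⊙ S))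
        (trans (cong (_· matrix S) (S· a b c d)) (·S (- c) (- d) a b))
        (edge-nonnegative (translate S F) n′ ((S ⊙ g) ⊙ S)
          (trans (matrix-⊙ (S ⊙ g) S) (cong (_· matrix S) (matrix-⊙ S g))))))
    where
    n′ = subst Nonnegative (sym (·-assoc (matrix S) M (matrix S))) n

  -- Applying g to ∞ and 𝟎 produces the columns of its matrix, up to terms multiplied by 0 and 1.
  path-edge : ∀ {f} → IsManin f → ∀ g → eval f (path (g • ∞)) ≈ᴹ f g +ᴹ eval f (path (g • 𝟎))
  path-edge {f} F g@(sl₂ (mat a b c d) _) = begin
    alongᶻ f (a * 1ℤ + b * 0ℤ) (c * 1ℤ + d * 0ℤ)
      ≡⟨ cong₂ (alongᶻ f) (first a b) (first c d) ⟩
    alongᶻ f a c                                          ≈⟨ edge F g ⟩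
    f g +ᴹ alongᶻ f b d
      ≡⟨ cong₂ (λ x y → f g +ᴹ alongᶻ f x y) (second a b) (second c d) ⟨
    f g +ᴹ alongᶻ f (a * 0ℤ + b * 1ℤ) (c * 0ℤ + d * 1ℤ)   ∎
    where
    open import Relation.Binary.Reasoning.Setoid ≈ᴹ-setoid
    first : ∀ x y → x * 1ℤ + y * 0ℤ ≡ x
    first = solve-∀
    second : ∀ x y → x * 0ℤ + y * 1ℤ ≡ y
    second = solve-∀

-- Cosets as fibres of the action, and the two inclusions.

Γ-modular : ModularGenerators Γ
Γ-modular = record
  { S = S ; T = T ; U = U ; L = US ; S²≈ε = minus refl ; T≈U²S = plus refl ; L≈US = plus refl }

module _ (M : LeftModule ℤ.+-*-ring 0ℓ 0ℓ) where
  open LeftModule M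
  private
    module Opaque = ManinFunctions modular M
    module Plain = ManinFunctions Γ-modular M

  -- The two products have the same matrix, so their elements are identified by `plus` and f takes
  -- equivalent values on them.
  hide-∙ : ∀ {f} → Plain.IsManin f → Opaque.IsManin f
  hide-∙ {f} F = record
    { respects = respects
    ; S-rel = λ g → ≈ᴹ-trans (+ᴹ-congˡ (respects (plus (matrix-⊙ g S)))) (S-rel g)
    ; U-rel = λ g → ≈ᴹ-trans (+ᴹ-cong (+ᴹ-congˡ (respects (plus (matrix-⊙ g U))))
        (respects (plus (trans (matrix-⊙ g (U ⊙ U)) (cong (matrix g ·_) (matrix-⊙ U U)))))) (U-rel g)
    }
    where
    open Plain.IsManin F

action : ModularAction Γ-modular ℙ¹
action = record
  { _•_     = _•_
  ; •-congʳ = λ p e → •-congʳ p e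
  ; ∞ = ∞
  ; 𝟎 = 𝟎
  ; S∞  = λ g → proportional (_≈ᴾ_.cross (product-• (g Γ.∙ S) g S {∞} {𝟎} refl (proportional refl)))
  ; S𝟎  = λ g → proportional (_≈ᴾ_.cross (product-• (g Γ.∙ S) g S {𝟎} {∞} refl (proportional refl)))
  ; U∞  = λ g → proportional (_≈ᴾ_.cross (product-• (g Γ.∙ U) g U {∞} {𝟎} refl (proportional refl)))
  ; UU∞ = λ g → proportional (_≈ᴾ_.cross (product-• (g Γ.∙ (U Γ.∙ U)) (g Γ.∙ U) U {∞} {𝟎}
      (sym (·-assoc (matrix g) (matrix U) (matrix U))) (proportional refl)))
  ; UU𝟎 = λ g → proportional (_≈ᴾ_.cross
      (product-• (g Γ.∙ (U Γ.∙ U)) g (U Γ.∙ U) {𝟎} {∞} refl (proportional refl)))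
  ; path = path
  ; path-cong = path-cong
  ; path-edge = λ M F g → path-edge M (hide-∙ M F) g
  }

open Subgroups Γ

module _ {H : Pred SL₂ℤ 0ℓ} {p : ℙ¹ℚ} (stabilizer : ∀ γ → H γ ⇔ γ • p ≈ᴾ p) where

  -- The coset γH of the stabilizer H of p is the fibre over γp of the map sending g to gp; this
  -- turns the cosets of the definitions into conditions on points.
  leftCoset⇒orbit : ∀ {γ g} → LeftCoset γ H g → g • p ≈ᴾ γ • p
  leftCoset⇒orbit {γ} {g} (h , Hh , plus e)  = product-• g γ h {p} {p} e (Equivalence.to (stabilizer h) Hh)
  -- Here -g is exactly the product γh, and -g acts on points as g does.
  leftCoset⇒orbit {γ} {g} (h , Hh , minus e) = ℙ.trans {g • p} {g′ • p} {γ • p}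
    (•-congʳ {g} {g′} p (minus (sym (neg-involutive (matrix g)))))
    (product-• g′ γ h {p} {p} (trans (cong neg e) (neg-involutive _)) (Equivalence.to (stabilizer h) Hh))
    where g′ = sl₂ (neg (matrix g)) (trans (det-neg (matrix g)) (det≡1 g))

  orbit⇒leftCoset : ∀ {γ g} → g • p ≈ᴾ γ • p → LeftCoset γ H g
  orbit⇒leftCoset {γ} {g} gp≈γp =
    -- The element γ⁻¹g fixes p, because applying γ to p and to its image gives equal points.
    γ⁻¹g , Equivalence.from (stabilizer γ⁻¹g) (•-cancelˡ γ {γ⁻¹g • p} {p}
      (ℙ.trans {γ • (γ⁻¹g • p)} {g • p} (ℙ.sym {g • p} {γ • (γ⁻¹g • p)}
        (product-• g γ γ⁻¹g {p} {γ⁻¹g • p} e (proportional refl))) gp≈γp)) , plus e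
    where
    γ⁻¹g = (γ Γ.⁻¹) Γ.∙ g
    e : matrix g ≡ matrix γ · (adj (matrix γ) · matrix g)
    e = sym (trans (sym (·-assoc (matrix γ) (adj (matrix γ)) (matrix g)))
      (trans (cong (_· matrix g) (·-inverseʳ (matrix γ) (det≡1 γ))) (·-identityˡ (matrix g))))

-- Abstracting from S and U keeps the determinants of their products from being unfolded.
generators≡gens : generators ≡ PairGenerators.gens Γ _≟±_ (ModularGenerators.S Γ-modular)
                                                          (ModularGenerators.U Γ-modular)
generators≡gens = go S U refl refl refl
  where
  go : ∀ s u → s ≡ ModularGenerators.S Γ-modular → u ≡ ModularGenerators.U Γ-modular →
       generators ≡ PairGenerators.gens Γ _≟±_ s u →
       generators ≡ PairGenerators.gens Γ _≟±_ (ModularGenerators.S Γ-modular)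
                                               (ModularGenerators.U Γ-modular)
  go _ _ refl refl e = e

open Intersection action _≟±_ generators≡gens
  using (intersection⊆ideal; ideal⊆horizontal; ideal⊆vertical; ideal⊆diagonal)


intersection⊆𝓘₂ : ∀ {x} → I-H x → I-D x → 𝓘₂ x
intersection⊆𝓘₂ {x} = intersection⊆ideal {H = λ γ → LeftCoset γ Γ∞} (leftCoset? (⟪⟫-resp T) Γ∞?)
  (λ {γ} {g} c → proportional (_≈ᴾ_.cross (leftCoset⇒orbit {p = ∞} Γ∞⇔stabilizer {γ} {g} c)))
  (λ {γ} {g} e → orbit⇒leftCoset {p = ∞} Γ∞⇔stabilizer {γ} {g} (proportional (_≈ᴾ_.cross e))) x

𝓘₂⊆I-H : ∀ {x} → 𝓘₂ x → I-H x
𝓘₂⊆I-H = ideal⊆horizontal {H = λ γ → LeftCoset γ Γ∞} (leftCoset? (⟪⟫-resp T) Γ∞?)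
  (λ {γ} {g} c → proportional (_≈ᴾ_.cross (leftCoset⇒orbit {p = ∞} Γ∞⇔stabilizer {γ} {g} c)))
  (λ {γ} {g} e → orbit⇒leftCoset {p = ∞} Γ∞⇔stabilizer {γ} {g} (proportional (_≈ᴾ_.cross e)))

𝓘₂⊆I-V : ∀ {x} → 𝓘₂ x → I-V x
𝓘₂⊆I-V = ideal⊆vertical {H = λ γ → LeftCoset γ Γ₀} (leftCoset? (⟪⟫-resp US) Γ₀?)
  (λ {γ} {g} c → proportional (_≈ᴾ_.cross (leftCoset⇒orbit {p = 𝟎} Γ₀⇔stabilizer {γ} {g} c)))
  (λ {γ} {g} e → orbit⇒leftCoset {p = 𝟎} Γ₀⇔stabilizer {γ} {g} (proportional (_≈ᴾ_.cross e)))

theorem3 : I-H ∩ I-V ∩ I-D ≐ 𝓘₂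
theorem3 =
  (λ (x∈I-H , _ , x∈I-D) → intersection⊆𝓘₂ x∈I-H x∈I-D) ,
  (λ x∈𝓘₂ → 𝓘₂⊆I-H x∈𝓘₂ , 𝓘₂⊆I-V x∈𝓘₂ , ideal⊆diagonal x∈𝓘₂)
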